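{- Let $(-)^{\bullet}$ be the interpretation of the intensional level $\mathbf{mTT}$ of the Minimalist Foundation in Homotopy Type Theory ($\mathbf{HoTT}$) described in the context. If $\mathcal{J}$ is a judgement derivable in $\mathbf{mTT}$, then its interpretation $\mathcal{J}^{\bullet}$ holds in $\mathbf{HoTT}$ (that is, it is defined and all the $\mathbf{HoTT}$-judgements it consists of are derivable). Moreover, if $P\ prop\ [\Gamma]$ or $P\ prop_s\ [\Gamma]$ is derivable in $\mathbf{mTT}$, then $\mathsf{pr_S}(P^{\bullet}):\mathsf{isSet}(P^{\bullet})\ [\Gamma^{\bullet}]$ is derivable in $\mathbf{HoTT}$, where $\mathsf{pr_S}(P^{\bullet}):\equiv \mathfrak{s}_{coe}(P^{\bullet},\mathsf{pr_P}(P^{\bullet}))$.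
   Context: **The theory HoTT.** Intensional Martin-Löf type theory as in the HoTT Book: types $\mathbf 0,\mathbf 1,\mathbb N,+,\mathsf{List},\Pi,\Sigma,\mathrm{Id}$ (also written $=$), a cumulative hierarchy of univalent universes $\mathcal U_0:\mathcal U_1:\dots$, and higher inductive types, among them propositional truncation $\|A\|$ with constructors $|-|:A\to\|A\|$ and $\mathsf{sq}_A:\Pi_{x,y:\|A\|}\,x=y$ and eliminator $\mathsf{ind}_{\|\ \|}(e,x.c,s):C$ for $e:\|A\|$, $c:C\ [x:A]$, $s:\mathsf{isProp}(C)$, with $\mathsf{ind}_{\|\ \|}(|a|,x.c,s)\equiv c[a/x]$. Definitional equality is $\equiv$. Put $\mathsf{isProp}(A):\equiv\Pi_{x,y:A}\,x=y$, $\mathsf{isSet}(A):\equiv\Pi_{x,y:A}\Pi_{p,q:x=y}\,p=q$, $\mathsf{Prop}_{\mathcal U_i}:\equiv\Sigma_{X:\mathcal U_i}\mathsf{isProp}(X)$, $\mathsf{Set}_{\mathcal U_i}:\equiv\Sigma_{X:\mathcal U_i}\mathsf{isSet}(X)$; projections are $\mathsf{pr}_1,\mathsf{pr}_2$. For h-propositions: $P\vee Q:\equiv\|P+Q\|$, $\mathsf{inl}_\vee(p):\equiv|\mathsf{inl}(p)|$, $\mathsf{inr}_\vee(q):\equiv|\mathsf{inr}(q)|$, $\mathsf{ind}_\vee(e,x.l_1,y.l_2,s):\equiv\mathsf{ind}_{\|\ \|}(e,z.\mathsf{ind}_+(z,x.l_1,y.l_2),s)$; $\exists_{x:A}P(x):\equiv\|\Sigma_{x:A}P(x)\|$,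 $(a,_\exists p):\equiv|(a,p)|$, $\mathsf{ind}_\exists(e,x.y.l,s):\equiv\mathsf{ind}_{\|\ \|}(e,z.\mathsf{ind}_\Sigma(z,x.y.l),s)$. Fix once and for all closed $\mathbf{HoTT}$-terms (any choice will do), for the relevant universes $\mathcal U_i$: $\mathfrak p_0:\mathsf{isProp}(\mathbf 0)$; $\mathfrak p_\to:\Pi_{A,B:\mathcal U_i}\Pi_{q:\mathsf{isProp}(B)}\mathsf{isProp}(A\to B)$; $\mathfrak p_\times:\Pi_{A,B:\mathcal U_i}\Pi_{p:\mathsf{isProp}(A)}\Pi_{q:\mathsf{isProp}(B)}\mathsf{isProp}(A\times B)$; $\mathfrak p_\Pi:\Pi_{A:\mathcal U_i}\Pi_{B:A\to\mathcal U_i}\Pi_{p:\Pi_{x:A}\mathsf{isProp}(B(x))}\mathsf{isProp}(\Pi_{x:A}B(x))$; $\mathfrak p_\vee:\Pi_{A,B:\mathcal U_i}\mathsf{isProp}(A\vee B)$; $\mathfrak p_\exists:\Pi_{A:\mathcal U_i}\Pi_{B:A\to\mathcal U_i}\mathsf{isProp}(\exists_{x:A}B(x))$; $\mathfrak p_{Id}:\Pi_{A:\mathcal U_i}\Pi_{s:\mathsf{isSet}(A)}\Pi_{a,b:A}\mathsf{isProp}(\mathrm{Id}_A(a,b))$; $\mathfrak s_{coe}:\Pi_{A:\mathcal U_i}\mathsf{isProp}(A)\to\mathsf{isSet}(A)$; $\mathfrak s_0:\mathsf{isSet}(\mathbf 0)$, $\mathfrak s_1:\mathsf{isSet}(\mathbf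 1)$; $\mathfrak s_\Pi:\Pi_{A:\mathcal U_i}\Pi_{B:A\to\mathcal U_i}\Pi_{s:\Pi_{x:A}\mathsf{isSet}(B(x))}\mathsf{isSet}(\Pi_{x:A}B(x))$; $\mathfrak s_\Sigma:\Pi_{A:\mathcal U_i}\Pi_{B:A\to\mathcal U_i}\Pi_{s:\mathsf{isSet}(A)}\Pi_{t:\Pi_{x:A}\mathsf{isSet}(B(x))}\mathsf{isSet}(\Sigma_{x:A}B(x))$; $\mathfrak s_+:\Pi_{A,B:\mathcal U_i}\Pi_{s:\mathsf{isSet}(A)}\Pi_{t:\mathsf{isSet}(B)}\mathsf{isSet}(A+B)$; $\mathfrak s_{\mathsf{List}}:\Pi_{A:\mathcal U_i}\Pi_{s:\mathsf{isSet}(A)}\mathsf{isSet}(\mathsf{List}(A))$; $\mathfrak s_{\mathsf{Prop}_0}:\mathsf{isSet}(\mathsf{Prop}_{\mathcal U_0})$. **The theory mTT.** A dependent type theory in the style of intensional Martin-Löf type theory with four sorts of types: $A\ set$, $A\ col$ (collections), $P\ prop$, $P\ prop_s$ (small propositions), all relative to contexts $[\Gamma]$; further judgements are definitional equality of types of each sort, $a\in A\ [\Gamma]$, and $a=b\in A\ [\Gamma]$. Structural rules: formation of contexts from types of any sort, variables, definitional equality is an equivalence relation, conversion ($a\in A$ and $A=B$ give $a\in B$), substitution of equal terms into types. Term congruence rules (in particular the $\xi$-rule) are absent and replaced by: from $c(x_1,\dots,x_n)\in C(x_1,\dots,x_n)\ [x_1\in A_1,\dots,x_n\in A_n(x_1,\dots,x_{n-1})]$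 and $a_i=b_i\in A_i(a_1,\dots,a_{i-1})$ for all $i$ infer $c(a_1,\dots,a_n)=c(b_1,\dots,b_n)\in C(a_1,\dots,a_n)$. Subsumption: every $prop_s$ is a $set$ and a $prop$, every $prop$ and every $set$ is a $col$ (and the same for equalities). *Sets*: $\mathsf N_0$ (eliminator $\mathsf{emp}_0$), $\mathsf N_1$ ($\star$, $\mathrm{El}_{\mathsf N_1}$), $\mathsf{List}(A)$ ($\epsilon$, $\mathsf{cons}(\ell,a)$, $\mathrm{El}_{\mathsf{List}}$), $A+B$ ($\mathsf{inl},\mathsf{inr},\mathrm{El}_+$), $\Sigma_{x\in A}B(x)$ ($\langle a,b\rangle$, $\mathrm{El}_\Sigma$), $\Pi_{x\in A}B(x)$ ($\lambda x.b$, $\mathsf{Ap}$), for $A$, $B$ sets, with the usual formation, introduction, (dependent, towards collections) elimination and $\beta$-rules of intensional Martin-Löf type theory. *Collections*: additionally $\Sigma_{x\in A}B(x)$ for collections $A,B(x)$; $\mathsf{prop_s}$ (the collection of small propositions); $A\to\mathsf{prop_s}$ for a set $A$ (with $\lambda$, $\mathsf{Ap}$, $\beta$). *Propositions*: $\bot$ ($\mathsf r_0$), $A\vee B$ ($\mathsf{inl}_\vee,\mathsf{inr}_\vee,\mathrm{El}_\vee$), $A\wedge B$ ($\langle a,_\wedge b\rangle,\pi_1,\pi_2$), $A\to B$ ($\lambda_\to,\mathsf{Ap}_\to$), for propositions $A,B$; $\exists_{x\in A}B(x)$ ($\langle a,_\exists b\rangle,\mathrm{El}_\exists$), $\forall_{x\in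 A}B(x)$ ($\lambda_\forall,\mathsf{Ap}_\forall$) for a collection $A$ and propositions $B(x)$; $\mathrm{Id}(A,a,b)$ for a collection $A$ ($\mathsf{id}_A(a)\in\mathrm{Id}(A,a,a)$; from $C(x,y)\ prop\ [x,y\in A]$, $p\in\mathrm{Id}(A,a,b)$, $c(x)\in C(x,x)\ [x\in A]$ infer $\mathrm{El}_{\mathrm{Id}}(p,c)\in C(a,b)$, with $\mathrm{El}_{\mathrm{Id}}(\mathsf{id}_A(a),c)=c(a)$). These have the natural-deduction rules with proof terms and $\beta$-equalities, and the eliminators of $\bot,\vee,\exists,\mathrm{Id}$ act towards propositions only. *Small propositions*: the propositions $\bot$, and $\vee,\wedge,\to$ of small propositions, $\exists_{x\in A},\forall_{x\in A}$ of small propositions with $A$ a set, $\mathrm{Id}(A,a,b)$ with $A$ a set. *Codes*: $\widehat\bot\in\mathsf{prop_s}$; if $p,q\in\mathsf{prop_s}$ then $p\,\widehat\vee\,q,\ p\,\widehat\wedge\,q,\ p\,\widehat\to\,q\in\mathsf{prop_s}$; if $A\ set$ and $p\in\mathsf{prop_s}\ [x\in A]$ then $\widehat{\forall}_{x\in A}p,\ \widehat{\exists}_{x\in A}p\in\mathsf{prop_s}$; if $A\ set$, $a,b\in A$ then $\widehat{\mathrm{Id}}(A,a,b)\in\mathsf{prop_s}$. If $p\in\mathsf{prop_s}$ then $\tau(p)\ prop_s$, with definitional equalities $\tau(\widehat\bot)=\bot$, $\tau(p\,\widehat\vee\,q)=\tau(p)\vee\tau(q)$, likewise for $\wedge,\to$,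 $\tau(\widehat\forall_{x\in A}p)=\forall_{x\in A}\tau(p)$, $\tau(\widehat\exists_{x\in A}p)=\exists_{x\in A}\tau(p)$, $\tau(\widehat{\mathrm{Id}}(A,a,b))=\mathrm{Id}(A,a,b)$. **The interpretation.** A partial map $(-)^\bullet$ from raw types and terms of $\mathbf{mTT}$ to those of $\mathbf{HoTT}$, defined together with proof terms $\mathsf{pr_P}(A^\bullet)$ (meant to witness $\mathsf{isProp}(A^\bullet)$) and $\mathsf{pr_S}(A^\bullet)$ (meant to witness $\mathsf{isSet}(A^\bullet)$), by recursion on the $\mathbf{mTT}$-expression. Variables: $x^\bullet:\equiv x$. Contexts: the empty context goes to the empty context, $(\Gamma,x\in A)^\bullet:\equiv\Gamma^\bullet,x:A^\bullet$. Types: - $(\mathsf{prop_s})^\bullet:\equiv\mathsf{Prop}_{\mathcal U_0}$, $\mathsf{pr_S}:\equiv\mathfrak s_{\mathsf{Prop}_0}$. $(A\to\mathsf{prop_s})^\bullet:\equiv A^\bullet\to\mathsf{Prop}_{\mathcal U_0}$, $\mathsf{pr_S}:\equiv\mathfrak s_\Pi(A^\bullet,\lambda x.\mathsf{Prop}_{\mathcal U_0},\lambda x.\mathfrak s_{\mathsf{Prop}_0})$. - $(\tau(p))^\bullet:\equiv\mathsf{pr}_1(p^\bullet)$, $\mathsf{pr_P}:\equiv\mathsf{pr}_2(p^\bullet)$. - $\mathsf N_0,\mathsf N_1,\mathsf{List}(A),A+B,\Sigma_{x\in A}B(x),\Pi_{x\in A}B(x)$ go to $\mathbf 0,\mathbf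 1,\mathsf{List}(A^\bullet),A^\bullet+B^\bullet,\Sigma_{x:A^\bullet}B(x)^\bullet,\Pi_{x:A^\bullet}B(x)^\bullet$, with $\mathsf{pr_S}$ equal respectively to $\mathfrak s_0$, $\mathfrak s_1$, $\mathfrak s_{\mathsf{List}}(A^\bullet,\mathsf{pr_S}(A^\bullet))$, $\mathfrak s_+(A^\bullet,B^\bullet,\mathsf{pr_S}(A^\bullet),\mathsf{pr_S}(B^\bullet))$, $\mathfrak s_\Sigma(A^\bullet,\lambda x.B(x)^\bullet,\mathsf{pr_S}(A^\bullet),\lambda x.\mathsf{pr_S}(B(x)^\bullet))$, $\mathfrak s_\Pi(A^\bullet,\lambda x.B(x)^\bullet,\lambda x.\mathsf{pr_S}(B(x)^\bullet))$. - $\bot,\ A\vee B,\ A\wedge B,\ A\to B,\ \exists_{x\in A}B(x),\ \forall_{x\in A}B(x),\ \mathrm{Id}(A,a,b)$ go to $\mathbf 0$, $A^\bullet\vee B^\bullet$, $A^\bullet\times B^\bullet$, $A^\bullet\to B^\bullet$, $\exists_{x:A^\bullet}B(x)^\bullet$, $\Pi_{x:A^\bullet}B(x)^\bullet$, $\mathrm{Id}_{A^\bullet}(a^\bullet,b^\bullet)$, with $\mathsf{pr_P}$ equal respectively to $\mathfrak p_0$, $\mathfrak p_\vee(A^\bullet,B^\bullet)$, $\mathfrak p_\times(A^\bullet,B^\bullet,\mathsf{pr_P}(A^\bullet),\mathsf{pr_P}(B^\bullet))$, $\mathfrak p_\to(A^\bullet,B^\bullet,\mathsf{pr_P}(B^\bullet))$,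 $\mathfrak p_\exists(A^\bullet,\lambda x.B(x)^\bullet)$, $\mathfrak p_\Pi(A^\bullet,\lambda x.B(x)^\bullet,\lambda x.\mathsf{pr_P}(B(x)^\bullet))$, $\mathfrak p_{Id}(A^\bullet,\mathsf{pr_S}(A^\bullet),a^\bullet,b^\bullet)$. - For every propositional type former $P$ (including $\tau(p)$): $\mathsf{pr_S}(P^\bullet):\equiv\mathfrak s_{coe}(P^\bullet,\mathsf{pr_P}(P^\bullet))$. Codes: each goes to the pair of the corresponding type and its proof: $(\widehat\bot)^\bullet:\equiv(\mathbf 0,\mathfrak p_0)$; $(p\,\widehat\vee\,q)^\bullet:\equiv(\mathsf{pr}_1(p^\bullet)\vee\mathsf{pr}_1(q^\bullet),\mathfrak p_\vee(\mathsf{pr}_1(p^\bullet),\mathsf{pr}_1(q^\bullet)))$; $(p\,\widehat\wedge\,q)^\bullet:\equiv(\mathsf{pr}_1(p^\bullet)\times\mathsf{pr}_1(q^\bullet),\mathfrak p_\times(\mathsf{pr}_1(p^\bullet),\mathsf{pr}_1(q^\bullet),\mathsf{pr}_2(p^\bullet),\mathsf{pr}_2(q^\bullet)))$; $(p\,\widehat\to\,q)^\bullet:\equiv(\mathsf{pr}_1(p^\bullet)\to\mathsf{pr}_1(q^\bullet),\mathfrak p_\to(\mathsf{pr}_1(p^\bullet),\mathsf{pr}_1(q^\bullet),\mathsf{pr}_2(q^\bullet)))$; $(\widehat\exists_{x\in A}p)^\bullet:\equiv(\exists_{x:A^\bullet}\mathsf{pr}_1(p^\bullet),\mathfrak p_\exists(A^\bullet,\lambda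 x.\mathsf{pr}_1(p^\bullet)))$; $(\widehat\forall_{x\in A}p)^\bullet:\equiv(\Pi_{x:A^\bullet}\mathsf{pr}_1(p^\bullet),\mathfrak p_\Pi(A^\bullet,\lambda x.\mathsf{pr}_1(p^\bullet),\lambda x.\mathsf{pr}_2(p^\bullet)))$; $(\widehat{\mathrm{Id}}(A,a,b))^\bullet:\equiv(\mathrm{Id}_{A^\bullet}(a^\bullet,b^\bullet),\mathfrak p_{Id}(A^\bullet,\mathsf{pr_S}(A^\bullet),a^\bullet,b^\bullet))$. Other terms: each constructor and eliminator goes to the corresponding one, applied to the interpreted arguments: $\mathsf{emp}_0,\mathsf r_0\mapsto\mathsf{ind}_0$; $\star\mapsto\star$, $\mathrm{El}_{\mathsf N_1}\mapsto\mathsf{ind}_1$; $\epsilon\mapsto\mathsf{nil}$, $\mathsf{cons}\mapsto\mathsf{cons}$, $\mathrm{El}_{\mathsf{List}}\mapsto\mathsf{ind}_{\mathsf{List}}$; $\mathsf{inl},\mathsf{inr},\mathrm{El}_+\mapsto\mathsf{inl},\mathsf{inr},\mathsf{ind}_+$; $\langle a,b\rangle,\langle a,_\wedge b\rangle\mapsto(a^\bullet,b^\bullet)$; $\mathrm{El}_\Sigma\mapsto\mathsf{ind}_\Sigma$; $\pi_i\mapsto\mathsf{pr}_i$; all abstractions $\lambda,\lambda_\to,\lambda_\forall\mapsto\lambda$ and all applications $\mapsto$ application; $\mathsf{inl}_\vee,\mathsf{inr}_\vee\mapsto\mathsf{inl}_\vee,\mathsf{inr}_\vee$, $\langle a,_\exists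 b\rangle\mapsto(a^\bullet,_\exists b^\bullet)$; $\mathrm{El}_\vee,\mathrm{El}_\exists\mapsto\mathsf{ind}_\vee,\mathsf{ind}_\exists$ with last argument $s:\equiv\mathsf{pr_P}(C^\bullet)$ for the target proposition $C$; $\mathsf{id}_A(a)\mapsto\mathsf{refl}_{a^\bullet}$, $\mathrm{El}_{\mathrm{Id}}\mapsto\mathsf{ind}_{\mathrm{Id}}$. Judgements: - $(A\ set\ [\Gamma])^\bullet$: $A^\bullet:\mathcal U_0\ [\Gamma^\bullet]$ and $\mathsf{pr_S}(A^\bullet):\mathsf{isSet}(A^\bullet)\ [\Gamma^\bullet]$ is derivable; $(A\ col\ [\Gamma])^\bullet$: the same with $\mathcal U_1$. - $(P\ prop_s\ [\Gamma])^\bullet$: $P^\bullet:\mathcal U_0\ [\Gamma^\bullet]$ and $\mathsf{pr_P}(P^\bullet):\mathsf{isProp}(P^\bullet)\ [\Gamma^\bullet]$ is derivable; $(P\ prop\ [\Gamma])^\bullet$: the same with $\mathcal U_1$. - $(A=B\ set\ [\Gamma])^\bullet$, resp. $col$: $(A^\bullet,\mathsf{pr_S}(A^\bullet))\equiv(B^\bullet,\mathsf{pr_S}(B^\bullet)):\mathsf{Set}_{\mathcal U_0}$, resp. $\mathsf{Set}_{\mathcal U_1}$, in context $\Gamma^\bullet$. - $(P=Q\ prop_s\ [\Gamma])^\bullet$, resp. $prop$: $(P^\bullet,\mathsf{pr_P}(P^\bullet))\equiv(Q^\bullet,\mathsf{pr_P}(Q^\bullet)):\mathsf{Prop}_{\mathcal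 U_0}$, resp. $\mathsf{Prop}_{\mathcal U_1}$, in context $\Gamma^\bullet$. - $(a\in A\ [\Gamma])^\bullet$: $a^\bullet:A^\bullet\ [\Gamma^\bullet]$; $(a=b\in A\ [\Gamma])^\bullet$: $a^\bullet\equiv b^\bullet:A^\bullet\ [\Gamma^\bullet]$. -}

module Defs where

open import Data.Fin.Base using (Fin; zero; suc; lift; _↑ʳ_)
open import Data.List.Base as List using ([]; _∷_)
open import Data.List.Relation.Unary.All using (All)
open import Data.Maybe.Base using (Maybe; just; nothing; _>>=_)
open import Data.Nat.Base as ℕ using (ℕ; zero; suc)
open import Data.Product.Base as Prod using (_,_)
open import Data.Unit.Base using (⊤; tt)
open import Relation.Binary.PropositionalEquality.Core using (_≡_)

-- Many-sorted well-scoped de Bruijn syntax.  An operator of arity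
-- (k₁ , s₁) ∷ (k₂ , s₂) ∷ … takes an argument of sort s₁ in which k₁ variables
-- are bound, etc.  Variables have sort tm, and the entries of contexts sort ty.
-- The last variable bound has index 0.

module Syntax {Sort : Set} (ty tm : Sort)
              (Op : Sort → List.List (ℕ Prod.× Sort) → Set) where

  private variable
    s     : Sort
    ar    : List.List (ℕ Prod.× Sort)
    k m n : ℕ

  data Expr : Sort → ℕ → Set
  data Args : List.List (ℕ Prod.× Sort) → ℕ → Set

  data Expr where
    var : Fin n → Expr tm n
    op  : Op s ar → Args ar n → Expr s n

  data Args where
    []  : Args [] n
    _∷_ : Expr s (k ℕ.+ n) → Args ar n → Args ((k , s) ∷ ar) n

  infixr 5 _∷_

  pattern #0 = var zero
  pattern #1 = var (suc zero)
  pattern #2 = var (suc (suc zero))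
  pattern #3 = var (suc (suc (suc zero)))

  ren     : (Fin n → Fin m) → Expr s n → Expr s m
  renArgs : (Fin n → Fin m) → Args ar n → Args ar m
  ren ρ (var x)   = var (ρ x)
  ren ρ (op o as) = op o (renArgs ρ as)
  renArgs ρ []               = []
  renArgs ρ (_∷_ {k = k} a as) = ren (lift k ρ) a ∷ renArgs ρ as

  wk : Expr s n → Expr s (suc n)
  wk = ren suc

  Sub : ℕ → ℕ → Set
  Sub n m = Fin n → Expr tm m

  infixl 5 _▹_

  _▹_ : Sub n m → Expr tm m → Sub (suc n) m
  (σ ▹ a) zero    = a
  (σ ▹ a) (suc x) = σ x

  liftˢ : ∀ k → Sub n m → Sub (k ℕ.+ n) (k ℕ.+ m)
  liftˢ zero    σ = σ
  liftˢ (suc k) σ = (λ x → wk (liftˢ k σ x)) ▹ #0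

  sub     : Sub n m → Expr s n → Expr s m
  subArgs : Sub n m → Args ar n → Args ar m
  sub σ (var x)   = σ x
  sub σ (op o as) = op o (subArgs σ as)
  subArgs σ []                 = []
  subArgs σ (_∷_ {k = k} a as) = sub (liftˢ k σ) a ∷ subArgs σ as

  infixl 8 _[_] _[_⨾_] _↑_[_]

  _[_] : Expr s (suc n) → Expr tm n → Expr s n
  e [ a ] = sub (var ▹ a) e

  _[_⨾_] : Expr s (suc (suc n)) → Expr tm n → Expr tm n → Expr s n
  e [ a ⨾ b ] = sub (var ▹ a ▹ b) e

  -- e(a) for a term a over k further variables: those declared after the
  -- context of e, without e's own last variable.
  _↑_[_] : Expr s (suc n) → ∀ k → Expr tm (k ℕ.+ n) → Expr s (k ℕ.+ n)
  e ↑ k [ a ] = sub ((λ x → var (k ↑ʳ x)) ▹ a) e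

  infixl 5 _▸_

  data Ctx : ℕ → Set where
    ∅   : Ctx zero
    _▸_ : Ctx n → Expr ty n → Ctx (suc n)

  lookup : Ctx n → Fin n → Expr ty n
  lookup (Γ ▸ A) zero    = wk A
  lookup (Γ ▸ A) (suc x) = wk (lookup Γ x)

-- Terms are unannotated except where the interpretation depends on a type.
-- Introduction and elimination rules repeat the formation premises of the
-- types involved.  Type formers preserve equality of types; equal terms may be
-- replaced by the repl rules only, so in particular there is no ξ-rule.

module MTT where

  data Sort : Set where
    ty tm : Sort

  private
    T t : ℕ → ℕ Prod.× Sort
    T k = k , ty
    t k = k , tm

  data Op : Sort → List.List (ℕ Prod.× Sort) → Set where
    N₀ᵒ N₁ᵒ                    : Op ty []
    Listᵒ                      : Op ty (T 0 ∷ [])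
    +ᵒ                         : Op ty (T 0 ∷ T 0 ∷ [])
    Σᵒ Πᵒ                      : Op ty (T 0 ∷ T 1 ∷ [])
    Propₛᵒ                     : Op ty []
    →Propₛᵒ                    : Op ty (T 0 ∷ [])
    ⊥ᵒ                         : Op ty []
    ∨ᵒ ∧ᵒ ⇒ᵒ                   : Op ty (T 0 ∷ T 0 ∷ [])
    ∃ᵒ ∀ᵒ                      : Op ty (T 0 ∷ T 1 ∷ [])
    Idᵒ                        : Op ty (T 0 ∷ t 0 ∷ t 0 ∷ [])
    τᵒ                         : Op ty (t 0 ∷ [])

    emp₀ᵒ                      : Op tm (t 0 ∷ [])
    ⋆ᵒ                         : Op tm []
    elN₁ᵒ                      : Op tm (t 0 ∷ t 0 ∷ [])
    εᵒ                         : Op tm []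
    consᵒ                      : Op tm (t 0 ∷ t 0 ∷ [])
    elListᵒ                    : Op tm (t 0 ∷ t 0 ∷ t 3 ∷ [])
    inlᵒ inrᵒ                  : Op tm (t 0 ∷ [])
    el+ᵒ                       : Op tm (t 0 ∷ t 1 ∷ t 1 ∷ [])
    pairᵒ                      : Op tm (t 0 ∷ t 0 ∷ [])
    elΣᵒ                       : Op tm (t 0 ∷ t 2 ∷ [])
    lamᵒ                       : Op tm (t 1 ∷ [])
    Apᵒ                        : Op tm (t 0 ∷ t 0 ∷ [])

    r₀ᵒ                        : Op tm (t 0 ∷ [])
    inl∨ᵒ inr∨ᵒ                : Op tm (t 0 ∷ [])
    el∨ᵒ                       : Op tm (T 0 ∷ t 0 ∷ t 1 ∷ t 1 ∷ [])
    pair∧ᵒ                     : Op tm (t 0 ∷ t 0 ∷ [])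
    π₁ᵒ π₂ᵒ                    : Op tm (t 0 ∷ [])
    lam⇒ᵒ                      : Op tm (t 1 ∷ [])
    Ap⇒ᵒ                       : Op tm (t 0 ∷ t 0 ∷ [])
    pair∃ᵒ                     : Op tm (t 0 ∷ t 0 ∷ [])
    el∃ᵒ                       : Op tm (T 0 ∷ t 0 ∷ t 2 ∷ [])
    lam∀ᵒ                      : Op tm (t 1 ∷ [])
    Ap∀ᵒ                       : Op tm (t 0 ∷ t 0 ∷ [])
    idᵒ                        : Op tm (T 0 ∷ t 0 ∷ [])
    elIdᵒ                      : Op tm (t 0 ∷ t 1 ∷ [])

    ⊥ᶜᵒ                        : Op tm []
    ∨ᶜᵒ ∧ᶜᵒ ⇒ᶜᵒ                : Op tm (t 0 ∷ t 0 ∷ [])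
    ∃ᶜᵒ ∀ᶜᵒ                    : Op tm (T 0 ∷ t 1 ∷ [])
    Idᶜᵒ                       : Op tm (T 0 ∷ t 0 ∷ t 0 ∷ [])

  open Syntax ty tm Op public

  infixr 6 _+_ _∨_ _∧_ _⇒_ _∨ᶜ_ _∧ᶜ_ _⇒ᶜ_

  pattern N₀          = op N₀ᵒ []
  pattern N₁          = op N₁ᵒ []
  pattern List A      = op Listᵒ (A ∷ [])
  pattern _+_ A B     = op +ᵒ (A ∷ B ∷ [])
  pattern Σ A B       = op Σᵒ (A ∷ B ∷ [])
  pattern Π A B       = op Πᵒ (A ∷ B ∷ [])
  pattern Propₛ       = op Propₛᵒ []
  pattern _→Propₛ A   = op →Propₛᵒ (A ∷ [])
  pattern ⊥           = op ⊥ᵒ []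
  pattern _∨_ A B     = op ∨ᵒ (A ∷ B ∷ [])
  pattern _∧_ A B     = op ∧ᵒ (A ∷ B ∷ [])
  pattern _⇒_ A B     = op ⇒ᵒ (A ∷ B ∷ [])
  pattern Exists A B      = op ∃ᵒ (A ∷ B ∷ [])
  pattern Forall A B     = op ∀ᵒ (A ∷ B ∷ [])
  pattern Id A a b    = op Idᵒ (A ∷ a ∷ b ∷ [])
  pattern τ p         = op τᵒ (p ∷ [])

  pattern emp₀ e      = op emp₀ᵒ (e ∷ [])
  pattern ⋆           = op ⋆ᵒ []
  pattern elN₁ e c    = op elN₁ᵒ (e ∷ c ∷ [])
  pattern ε           = op εᵒ []
  pattern cons l a    = op consᵒ (l ∷ a ∷ [])
  pattern elList l c d = op elListᵒ (l ∷ c ∷ d ∷ [])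
  pattern inl a       = op inlᵒ (a ∷ [])
  pattern inr b       = op inrᵒ (b ∷ [])
  pattern el+ e c d   = op el+ᵒ (e ∷ c ∷ d ∷ [])
  pattern pair a b    = op pairᵒ (a ∷ b ∷ [])
  pattern elΣ e c     = op elΣᵒ (e ∷ c ∷ [])
  pattern lam b       = op lamᵒ (b ∷ [])
  pattern Ap f a      = op Apᵒ (f ∷ a ∷ [])

  -- el∨ and el∃ carry their target proposition C: the interpretation needs
  -- its proof of being an h-proposition.
  pattern r₀ e        = op r₀ᵒ (e ∷ [])
  pattern inl∨ a      = op inl∨ᵒ (a ∷ [])
  pattern inr∨ b      = op inr∨ᵒ (b ∷ [])
  pattern el∨ C e c d = op el∨ᵒ (C ∷ e ∷ c ∷ d ∷ [])
  pattern pair∧ a b   = op pair∧ᵒ (a ∷ b ∷ [])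
  pattern π₁ e        = op π₁ᵒ (e ∷ [])
  pattern π₂ e        = op π₂ᵒ (e ∷ [])
  pattern lam⇒ b      = op lam⇒ᵒ (b ∷ [])
  pattern Ap⇒ f a     = op Ap⇒ᵒ (f ∷ a ∷ [])
  pattern pair∃ a b   = op pair∃ᵒ (a ∷ b ∷ [])
  pattern el∃ C e c   = op el∃ᵒ (C ∷ e ∷ c ∷ [])
  pattern lam∀ b      = op lam∀ᵒ (b ∷ [])
  pattern Ap∀ f a     = op Ap∀ᵒ (f ∷ a ∷ [])
  pattern id A a      = op idᵒ (A ∷ a ∷ [])
  pattern elId e c    = op elIdᵒ (e ∷ c ∷ [])

  pattern ⊥ᶜ          = op ⊥ᶜᵒ []
  pattern _∨ᶜ_ p q    = op ∨ᶜᵒ (p ∷ q ∷ [])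
  pattern _∧ᶜ_ p q    = op ∧ᶜᵒ (p ∷ q ∷ [])
  pattern _⇒ᶜ_ p q    = op ⇒ᶜᵒ (p ∷ q ∷ [])
  pattern Existsᶜ A p     = op ∃ᶜᵒ (A ∷ p ∷ [])
  pattern Forallᶜ A p    = op ∀ᶜᵒ (A ∷ p ∷ [])
  pattern Idᶜ A a b   = op Idᶜᵒ (A ∷ a ∷ b ∷ [])

  Ty Tm : ℕ → Set
  Ty = Expr ty
  Tm = Expr tm

  -- The four sorts of types, arranged so that a rule having a version for
  -- small and a version for large types is stated once, for a Size z.
  data Size : Set where
    small large : Size

  data Kind : Set where
    type prop′ : Size → Kind

  pattern set   = type small
  pattern col   = type large
  pattern propₛ = prop′ small
  pattern prop  = prop′ large

  data _⊑_ : Kind → Kind → Set where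
    propₛ⊑set  : propₛ ⊑ set
    propₛ⊑prop : propₛ ⊑ prop
    set⊑col    : set ⊑ col
    prop⊑col   : prop ⊑ col

  infix 4 _⊢_ _ctx _⊑_
  infix 5 _is_ _≐_is_ _∈_ _≐_∈_

  data Judgement (n : ℕ) : Set where
    _is_   : Ty n → Kind → Judgement n
    _≐_is_ : Ty n → Ty n → Kind → Judgement n
    _∈_    : Tm n → Ty n → Judgement n
    _≐_∈_  : Tm n → Tm n → Ty n → Judgement n

  private variable
    m n               : ℕ
    z                 : Size
    k k′              : Kind
    Γ Δ               : Ctx n
    A A′ B B′ C D     : Ty n
    a a′ b b′ c d e f l p q r : Tm n
    σ σ′              : Sub n m

  data _ctx : Ctx n → Set
  data _⊢_  : Ctx n → Judgement n → Set

  data _ctx where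
    ctx-∅ : ∅ ctx
    ctx-▸ : Γ ⊢ A is k → Γ ▸ A ctx

  data _⊢_ where

    var-∈ : Γ ctx → (x : Fin n) → Γ ⊢ var x ∈ lookup Γ x

    ty-refl  : Γ ⊢ A is k → Γ ⊢ A ≐ A is k
    ty-sym   : Γ ⊢ A ≐ B is k → Γ ⊢ B ≐ A is k
    ty-trans : Γ ⊢ A ≐ B is k → Γ ⊢ B ≐ C is k → Γ ⊢ A ≐ C is k
    tm-refl  : Γ ⊢ a ∈ A → Γ ⊢ a ≐ a ∈ A
    tm-sym   : Γ ⊢ a ≐ b ∈ A → Γ ⊢ b ≐ a ∈ A
    tm-trans : Γ ⊢ a ≐ b ∈ A → Γ ⊢ b ≐ c ∈ A → Γ ⊢ a ≐ c ∈ A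

    conv   : Γ ⊢ a ∈ A → Γ ⊢ A ≐ B is k → Γ ⊢ a ∈ B
    conv-≐ : Γ ⊢ a ≐ b ∈ A → Γ ⊢ A ≐ B is k → Γ ⊢ a ≐ b ∈ B

    subsume   : k ⊑ k′ → Γ ⊢ A is k → Γ ⊢ A is k′
    subsume-≐ : k ⊑ k′ → Γ ⊢ A ≐ B is k → Γ ⊢ A ≐ B is k′

    -- Replacement of equals, in types and in terms; σ and σ′ simultaneously
    -- substitute aᵢ and bᵢ for the variables xᵢ ∈ Aᵢ of Γ.
    repl-ty : {Γ : Ctx n} {Δ : Ctx m} →
              Γ ⊢ C is k → Δ ctx →
              (∀ x → Δ ⊢ σ x ≐ σ′ x ∈ sub σ (lookup Γ x)) →
              Δ ⊢ sub σ C ≐ sub σ′ C is k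
    repl-tm : {Γ : Ctx n} {Δ : Ctx m} →
              Γ ⊢ c ∈ C → Δ ctx →
              (∀ x → Δ ⊢ σ x ≐ σ′ x ∈ sub σ (lookup Γ x)) →
              Δ ⊢ sub σ c ≐ sub σ′ c ∈ sub σ C

    N₀-form : Γ ctx → Γ ⊢ N₀ is set
    N₀-elim : Γ ▸ N₀ ⊢ C is col → Γ ⊢ e ∈ N₀ → Γ ⊢ emp₀ e ∈ C [ e ]

    N₁-form  : Γ ctx → Γ ⊢ N₁ is set
    N₁-intro : Γ ctx → Γ ⊢ ⋆ ∈ N₁
    N₁-elim  : Γ ▸ N₁ ⊢ C is col → Γ ⊢ e ∈ N₁ → Γ ⊢ c ∈ C [ ⋆ ] →
               Γ ⊢ elN₁ e c ∈ C [ e ]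
    N₁-β     : Γ ▸ N₁ ⊢ C is col → Γ ⊢ c ∈ C [ ⋆ ] →
               Γ ⊢ elN₁ ⋆ c ≐ c ∈ C [ ⋆ ]

    List-form : Γ ⊢ A is set → Γ ⊢ List A is set
    List-cong : Γ ⊢ A ≐ A′ is set → Γ ⊢ List A ≐ List A′ is set
    List-ε    : Γ ⊢ A is set → Γ ⊢ ε ∈ List A
    List-cons : Γ ⊢ A is set → Γ ⊢ l ∈ List A → Γ ⊢ a ∈ A →
                Γ ⊢ cons l a ∈ List A
    List-elim : Γ ⊢ A is set → Γ ▸ List A ⊢ C is col →
                Γ ⊢ l ∈ List A → Γ ⊢ c ∈ C [ ε ] →
                Γ ▸ List A ▸ wk A ▸ C ↑ 2 [ #1 ] ⊢ d ∈ C ↑ 3 [ cons #2 #1 ] →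
                Γ ⊢ elList l c d ∈ C [ l ]
    List-βε   : Γ ⊢ A is set → Γ ▸ List A ⊢ C is col →
                Γ ⊢ c ∈ C [ ε ] →
                Γ ▸ List A ▸ wk A ▸ C ↑ 2 [ #1 ] ⊢ d ∈ C ↑ 3 [ cons #2 #1 ] →
                Γ ⊢ elList ε c d ≐ c ∈ C [ ε ]
    List-βcons : Γ ⊢ A is set → Γ ▸ List A ⊢ C is col →
                Γ ⊢ l ∈ List A → Γ ⊢ a ∈ A → Γ ⊢ c ∈ C [ ε ] →
                Γ ▸ List A ▸ wk A ▸ C ↑ 2 [ #1 ] ⊢ d ∈ C ↑ 3 [ cons #2 #1 ] →
                Γ ⊢ elList (cons l a) c d ≐ sub (var ▹ l ▹ a ▹ elList l c d) d
                  ∈ C [ cons l a ]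

    +-form : Γ ⊢ A is set → Γ ⊢ B is set → Γ ⊢ A + B is set
    +-cong : Γ ⊢ A ≐ A′ is set → Γ ⊢ B ≐ B′ is set →
             Γ ⊢ A + B ≐ A′ + B′ is set
    +-inl  : Γ ⊢ A is set → Γ ⊢ B is set → Γ ⊢ a ∈ A → Γ ⊢ inl a ∈ A + B
    +-inr  : Γ ⊢ A is set → Γ ⊢ B is set → Γ ⊢ b ∈ B → Γ ⊢ inr b ∈ A + B
    +-elim : Γ ⊢ A is set → Γ ⊢ B is set → Γ ▸ A + B ⊢ C is col →
             Γ ⊢ e ∈ A + B →
             Γ ▸ A ⊢ c ∈ C ↑ 1 [ inl #0 ] → Γ ▸ B ⊢ d ∈ C ↑ 1 [ inr #0 ] →
             Γ ⊢ el+ e c d ∈ C [ e ]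
    +-βinl : Γ ⊢ A is set → Γ ⊢ B is set → Γ ▸ A + B ⊢ C is col →
             Γ ⊢ a ∈ A →
             Γ ▸ A ⊢ c ∈ C ↑ 1 [ inl #0 ] → Γ ▸ B ⊢ d ∈ C ↑ 1 [ inr #0 ] →
             Γ ⊢ el+ (inl a) c d ≐ c [ a ] ∈ C [ inl a ]
    +-βinr : Γ ⊢ A is set → Γ ⊢ B is set → Γ ▸ A + B ⊢ C is col →
             Γ ⊢ b ∈ B →
             Γ ▸ A ⊢ c ∈ C ↑ 1 [ inl #0 ] → Γ ▸ B ⊢ d ∈ C ↑ 1 [ inr #0 ] →
             Γ ⊢ el+ (inr b) c d ≐ d [ b ] ∈ C [ inr b ]

    Σ-form  : Γ ⊢ A is type z → Γ ▸ A ⊢ B is type z → Γ ⊢ Σ A B is type z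
    Σ-cong  : Γ ⊢ A ≐ A′ is type z → Γ ▸ A ⊢ B ≐ B′ is type z →
              Γ ⊢ Σ A B ≐ Σ A′ B′ is type z
    Σ-intro : Γ ⊢ A is col → Γ ▸ A ⊢ B is col →
              Γ ⊢ a ∈ A → Γ ⊢ b ∈ B [ a ] → Γ ⊢ pair a b ∈ Σ A B
    Σ-elim  : Γ ⊢ A is col → Γ ▸ A ⊢ B is col → Γ ▸ Σ A B ⊢ C is col →
              Γ ⊢ e ∈ Σ A B → Γ ▸ A ▸ B ⊢ c ∈ C ↑ 2 [ pair #1 #0 ] →
              Γ ⊢ elΣ e c ∈ C [ e ]
    Σ-β     : Γ ⊢ A is col → Γ ▸ A ⊢ B is col → Γ ▸ Σ A B ⊢ C is col →
              Γ ⊢ a ∈ A → Γ ⊢ b ∈ B [ a ] →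
              Γ ▸ A ▸ B ⊢ c ∈ C ↑ 2 [ pair #1 #0 ] →
              Γ ⊢ elΣ (pair a b) c ≐ c [ a ⨾ b ] ∈ C [ pair a b ]

    Π-form  : Γ ⊢ A is set → Γ ▸ A ⊢ B is set → Γ ⊢ Π A B is set
    Π-cong  : Γ ⊢ A ≐ A′ is set → Γ ▸ A ⊢ B ≐ B′ is set →
              Γ ⊢ Π A B ≐ Π A′ B′ is set
    Π-intro : Γ ⊢ A is set → Γ ▸ A ⊢ B is set →
              Γ ▸ A ⊢ b ∈ B → Γ ⊢ lam b ∈ Π A B
    Π-elim  : Γ ⊢ A is set → Γ ▸ A ⊢ B is set →
              Γ ⊢ f ∈ Π A B → Γ ⊢ a ∈ A → Γ ⊢ Ap f a ∈ B [ a ]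
    Π-β     : Γ ⊢ A is set → Γ ▸ A ⊢ B is set →
              Γ ▸ A ⊢ b ∈ B → Γ ⊢ a ∈ A →
              Γ ⊢ Ap (lam b) a ≐ b [ a ] ∈ B [ a ]

    Propₛ-form   : Γ ctx → Γ ⊢ Propₛ is col
    →Propₛ-form  : Γ ⊢ A is set → Γ ⊢ A →Propₛ is col
    →Propₛ-cong  : Γ ⊢ A ≐ A′ is set → Γ ⊢ A →Propₛ ≐ A′ →Propₛ is col
    →Propₛ-intro : Γ ⊢ A is set → Γ ▸ A ⊢ p ∈ Propₛ → Γ ⊢ lam p ∈ A →Propₛ
    →Propₛ-elim  : Γ ⊢ A is set → Γ ⊢ f ∈ A →Propₛ → Γ ⊢ a ∈ A →
                   Γ ⊢ Ap f a ∈ Propₛ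
    →Propₛ-β     : Γ ⊢ A is set → Γ ▸ A ⊢ p ∈ Propₛ → Γ ⊢ a ∈ A →
                   Γ ⊢ Ap (lam p) a ≐ p [ a ] ∈ Propₛ

    ⊥-form : Γ ctx → Γ ⊢ ⊥ is propₛ
    ⊥-elim : Γ ⊢ C is prop → Γ ⊢ e ∈ ⊥ → Γ ⊢ r₀ e ∈ C

    ∨-form : Γ ⊢ A is prop′ z → Γ ⊢ B is prop′ z → Γ ⊢ A ∨ B is prop′ z
    ∨-cong : Γ ⊢ A ≐ A′ is prop′ z → Γ ⊢ B ≐ B′ is prop′ z →
             Γ ⊢ A ∨ B ≐ A′ ∨ B′ is prop′ z
    ∨-inl  : Γ ⊢ A is prop → Γ ⊢ B is prop → Γ ⊢ a ∈ A → Γ ⊢ inl∨ a ∈ A ∨ B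
    ∨-inr  : Γ ⊢ A is prop → Γ ⊢ B is prop → Γ ⊢ b ∈ B → Γ ⊢ inr∨ b ∈ A ∨ B
    ∨-elim : Γ ⊢ A is prop → Γ ⊢ B is prop → Γ ⊢ C is prop →
             Γ ⊢ e ∈ A ∨ B → Γ ▸ A ⊢ c ∈ wk C → Γ ▸ B ⊢ d ∈ wk C →
             Γ ⊢ el∨ C e c d ∈ C
    ∨-βinl : Γ ⊢ A is prop → Γ ⊢ B is prop → Γ ⊢ C is prop →
             Γ ⊢ a ∈ A → Γ ▸ A ⊢ c ∈ wk C → Γ ▸ B ⊢ d ∈ wk C →
             Γ ⊢ el∨ C (inl∨ a) c d ≐ c [ a ] ∈ C
    ∨-βinr : Γ ⊢ A is prop → Γ ⊢ B is prop → Γ ⊢ C is prop →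
             Γ ⊢ b ∈ B → Γ ▸ A ⊢ c ∈ wk C → Γ ▸ B ⊢ d ∈ wk C →
             Γ ⊢ el∨ C (inr∨ b) c d ≐ d [ b ] ∈ C

    ∧-form  : Γ ⊢ A is prop′ z → Γ ⊢ B is prop′ z → Γ ⊢ A ∧ B is prop′ z
    ∧-cong  : Γ ⊢ A ≐ A′ is prop′ z → Γ ⊢ B ≐ B′ is prop′ z →
              Γ ⊢ A ∧ B ≐ A′ ∧ B′ is prop′ z
    ∧-intro : Γ ⊢ A is prop → Γ ⊢ B is prop →
              Γ ⊢ a ∈ A → Γ ⊢ b ∈ B → Γ ⊢ pair∧ a b ∈ A ∧ B
    ∧-π₁    : Γ ⊢ A is prop → Γ ⊢ B is prop → Γ ⊢ e ∈ A ∧ B → Γ ⊢ π₁ e ∈ A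
    ∧-π₂    : Γ ⊢ A is prop → Γ ⊢ B is prop → Γ ⊢ e ∈ A ∧ B → Γ ⊢ π₂ e ∈ B
    ∧-β₁    : Γ ⊢ A is prop → Γ ⊢ B is prop → Γ ⊢ a ∈ A → Γ ⊢ b ∈ B →
              Γ ⊢ π₁ (pair∧ a b) ≐ a ∈ A
    ∧-β₂    : Γ ⊢ A is prop → Γ ⊢ B is prop → Γ ⊢ a ∈ A → Γ ⊢ b ∈ B →
              Γ ⊢ π₂ (pair∧ a b) ≐ b ∈ B

    ⇒-form  : Γ ⊢ A is prop′ z → Γ ⊢ B is prop′ z → Γ ⊢ A ⇒ B is prop′ z
    ⇒-cong  : Γ ⊢ A ≐ A′ is prop′ z → Γ ⊢ B ≐ B′ is prop′ z →
              Γ ⊢ A ⇒ B ≐ A′ ⇒ B′ is prop′ z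
    ⇒-intro : Γ ⊢ A is prop → Γ ⊢ B is prop →
              Γ ▸ A ⊢ b ∈ wk B → Γ ⊢ lam⇒ b ∈ A ⇒ B
    ⇒-elim  : Γ ⊢ A is prop → Γ ⊢ B is prop →
              Γ ⊢ f ∈ A ⇒ B → Γ ⊢ a ∈ A → Γ ⊢ Ap⇒ f a ∈ B
    ⇒-β     : Γ ⊢ A is prop → Γ ⊢ B is prop →
              Γ ▸ A ⊢ b ∈ wk B → Γ ⊢ a ∈ A →
              Γ ⊢ Ap⇒ (lam⇒ b) a ≐ b [ a ] ∈ B

    ∃-form  : Γ ⊢ A is type z → Γ ▸ A ⊢ B is prop′ z → Γ ⊢ Exists A B is prop′ z
    ∃-cong  : Γ ⊢ A ≐ A′ is type z → Γ ▸ A ⊢ B ≐ B′ is prop′ z →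
              Γ ⊢ Exists A B ≐ Exists A′ B′ is prop′ z
    ∃-intro : Γ ⊢ A is col → Γ ▸ A ⊢ B is prop →
              Γ ⊢ a ∈ A → Γ ⊢ b ∈ B [ a ] → Γ ⊢ pair∃ a b ∈ Exists A B
    ∃-elim  : Γ ⊢ A is col → Γ ▸ A ⊢ B is prop → Γ ⊢ C is prop →
              Γ ⊢ e ∈ Exists A B → Γ ▸ A ▸ B ⊢ c ∈ wk (wk C) →
              Γ ⊢ el∃ C e c ∈ C
    ∃-β     : Γ ⊢ A is col → Γ ▸ A ⊢ B is prop → Γ ⊢ C is prop →
              Γ ⊢ a ∈ A → Γ ⊢ b ∈ B [ a ] → Γ ▸ A ▸ B ⊢ c ∈ wk (wk C) →
              Γ ⊢ el∃ C (pair∃ a b) c ≐ c [ a ⨾ b ] ∈ C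

    ∀-form  : Γ ⊢ A is type z → Γ ▸ A ⊢ B is prop′ z → Γ ⊢ Forall A B is prop′ z
    ∀-cong  : Γ ⊢ A ≐ A′ is type z → Γ ▸ A ⊢ B ≐ B′ is prop′ z →
              Γ ⊢ Forall A B ≐ Forall A′ B′ is prop′ z
    ∀-intro : Γ ⊢ A is col → Γ ▸ A ⊢ B is prop →
              Γ ▸ A ⊢ b ∈ B → Γ ⊢ lam∀ b ∈ Forall A B
    ∀-elim  : Γ ⊢ A is col → Γ ▸ A ⊢ B is prop →
              Γ ⊢ f ∈ Forall A B → Γ ⊢ a ∈ A → Γ ⊢ Ap∀ f a ∈ B [ a ]
    ∀-β     : Γ ⊢ A is col → Γ ▸ A ⊢ B is prop →
              Γ ▸ A ⊢ b ∈ B → Γ ⊢ a ∈ A →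
              Γ ⊢ Ap∀ (lam∀ b) a ≐ b [ a ] ∈ B [ a ]

    Id-form  : Γ ⊢ A is type z → Γ ⊢ a ∈ A → Γ ⊢ b ∈ A →
               Γ ⊢ Id A a b is prop′ z
    Id-cong  : Γ ⊢ A ≐ A′ is type z → Γ ⊢ a ≐ a′ ∈ A → Γ ⊢ b ≐ b′ ∈ A →
               Γ ⊢ Id A a b ≐ Id A′ a′ b′ is prop′ z
    Id-intro : Γ ⊢ A is col → Γ ⊢ a ∈ A → Γ ⊢ id A a ∈ Id A a a
    Id-elim  : Γ ⊢ A is col → Γ ▸ A ▸ wk A ⊢ C is prop →
               Γ ⊢ a ∈ A → Γ ⊢ b ∈ A → Γ ⊢ p ∈ Id A a b →
               Γ ▸ A ⊢ c ∈ C [ #0 ] → Γ ⊢ elId p c ∈ C [ a ⨾ b ]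
    Id-β     : Γ ⊢ A is col → Γ ▸ A ▸ wk A ⊢ C is prop →
               Γ ⊢ a ∈ A → Γ ▸ A ⊢ c ∈ C [ #0 ] →
               Γ ⊢ elId (id A a) c ≐ c [ a ] ∈ C [ a ⨾ a ]

    ⊥ᶜ-intro : Γ ctx → Γ ⊢ ⊥ᶜ ∈ Propₛ
    ∨ᶜ-intro : Γ ⊢ p ∈ Propₛ → Γ ⊢ q ∈ Propₛ → Γ ⊢ p ∨ᶜ q ∈ Propₛ
    ∧ᶜ-intro : Γ ⊢ p ∈ Propₛ → Γ ⊢ q ∈ Propₛ → Γ ⊢ p ∧ᶜ q ∈ Propₛ
    ⇒ᶜ-intro : Γ ⊢ p ∈ Propₛ → Γ ⊢ q ∈ Propₛ → Γ ⊢ p ⇒ᶜ q ∈ Propₛ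
    ∃ᶜ-intro : Γ ⊢ A is set → Γ ▸ A ⊢ p ∈ Propₛ → Γ ⊢ Existsᶜ A p ∈ Propₛ
    ∀ᶜ-intro : Γ ⊢ A is set → Γ ▸ A ⊢ p ∈ Propₛ → Γ ⊢ Forallᶜ A p ∈ Propₛ
    Idᶜ-intro : Γ ⊢ A is set → Γ ⊢ a ∈ A → Γ ⊢ b ∈ A → Γ ⊢ Idᶜ A a b ∈ Propₛ

    τ-form : Γ ⊢ p ∈ Propₛ → Γ ⊢ τ p is propₛ
    τ-cong : Γ ⊢ p ≐ q ∈ Propₛ → Γ ⊢ τ p ≐ τ q is propₛ
    τ-⊥ᶜ   : Γ ctx → Γ ⊢ τ ⊥ᶜ ≐ ⊥ is propₛ
    τ-∨ᶜ   : Γ ⊢ p ∈ Propₛ → Γ ⊢ q ∈ Propₛ → Γ ⊢ τ (p ∨ᶜ q) ≐ τ p ∨ τ q is propₛ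
    τ-∧ᶜ   : Γ ⊢ p ∈ Propₛ → Γ ⊢ q ∈ Propₛ → Γ ⊢ τ (p ∧ᶜ q) ≐ τ p ∧ τ q is propₛ
    τ-⇒ᶜ   : Γ ⊢ p ∈ Propₛ → Γ ⊢ q ∈ Propₛ → Γ ⊢ τ (p ⇒ᶜ q) ≐ τ p ⇒ τ q is propₛ
    τ-∃ᶜ   : Γ ⊢ A is set → Γ ▸ A ⊢ p ∈ Propₛ →
             Γ ⊢ τ (Existsᶜ A p) ≐ Exists A (τ p) is propₛ
    τ-∀ᶜ   : Γ ⊢ A is set → Γ ▸ A ⊢ p ∈ Propₛ →
             Γ ⊢ τ (Forallᶜ A p) ≐ Forall A (τ p) is propₛ
    τ-Idᶜ  : Γ ⊢ A is set → Γ ⊢ a ∈ A → Γ ⊢ b ∈ A →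
             Γ ⊢ τ (Idᶜ A a b) ≐ Id A a b is propₛ

-- The theory is open-ended in its higher inductive types.  Propositional
-- truncation is built in; any others are given by a family of constants (type
-- formers, constructors, eliminators) with closed types, and of closed
-- definitional equations (their computation rules).

module HoTTSyntax (Const : Set) where

  private
    t : ℕ → ℕ Prod.× ⊤
    t k = k , tt

  data Op : ⊤ → List.List (ℕ Prod.× ⊤) → Set where
    Uᵒ            : ℕ → Op tt []
    Πᵒ Σᵒ         : Op tt (t 0 ∷ t 1 ∷ [])
    lamᵒ          : Op tt (t 1 ∷ [])
    appᵒ          : Op tt (t 0 ∷ t 0 ∷ [])
    pairᵒ         : Op tt (t 0 ∷ t 0 ∷ [])
    indΣᵒ         : Op tt (t 0 ∷ t 2 ∷ [])
    𝟎ᵒ 𝟏ᵒ ⋆ᵒ      : Op tt []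
    ind𝟎ᵒ         : Op tt (t 0 ∷ [])
    ind𝟏ᵒ         : Op tt (t 0 ∷ t 0 ∷ [])
    Natᵒ zeroᵒ    : Op tt []
    succᵒ         : Op tt (t 0 ∷ [])
    indNatᵒ       : Op tt (t 0 ∷ t 0 ∷ t 2 ∷ [])
    +ᵒ            : Op tt (t 0 ∷ t 0 ∷ [])
    inlᵒ inrᵒ     : Op tt (t 0 ∷ [])
    ind+ᵒ         : Op tt (t 0 ∷ t 1 ∷ t 1 ∷ [])
    Listᵒ         : Op tt (t 0 ∷ [])
    nilᵒ          : Op tt []
    consᵒ         : Op tt (t 0 ∷ t 0 ∷ [])
    indListᵒ      : Op tt (t 0 ∷ t 0 ∷ t 3 ∷ [])
    Idᵒ           : Op tt (t 0 ∷ t 0 ∷ t 0 ∷ [])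
    reflᵒ         : Op tt (t 0 ∷ [])
    indIdᵒ        : Op tt (t 0 ∷ t 1 ∷ [])
    ∥∥ᵒ           : Op tt (t 0 ∷ [])
    ∣∣ᵒ           : Op tt (t 0 ∷ [])
    sqᵒ           : Op tt (t 0 ∷ [])
    ind∥∥ᵒ        : Op tt (t 0 ∷ t 1 ∷ t 0 ∷ [])
    uaᵒ           : ℕ → Op tt []
    conᵒ          : Const → Op tt []

  open Syntax tt tt Op public

  Tm : ℕ → Set
  Tm = Expr tt

  infixr 6 _+_ _×_ _∨_
  infixr 5 _⟶_
  infixl 7 _·_

  pattern U i           = op (Uᵒ i) []
  pattern Π A B         = op Πᵒ (A ∷ B ∷ [])
  pattern lam b         = op lamᵒ (b ∷ [])
  pattern _·_ f a       = op appᵒ (f ∷ a ∷ [])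
  pattern Σ A B         = op Σᵒ (A ∷ B ∷ [])
  pattern pair a b      = op pairᵒ (a ∷ b ∷ [])
  pattern indΣ e c      = op indΣᵒ (e ∷ c ∷ [])
  pattern 𝟎             = op 𝟎ᵒ []
  pattern ind𝟎 e        = op ind𝟎ᵒ (e ∷ [])
  pattern 𝟏             = op 𝟏ᵒ []
  pattern ⋆             = op ⋆ᵒ []
  pattern ind𝟏 e c      = op ind𝟏ᵒ (e ∷ c ∷ [])
  pattern Nat           = op Natᵒ []
  pattern zeroᴺ         = op zeroᵒ []
  pattern succ a        = op succᵒ (a ∷ [])
  pattern indNat e c d  = op indNatᵒ (e ∷ c ∷ d ∷ [])
  pattern _+_ A B       = op +ᵒ (A ∷ B ∷ [])
  pattern inl a         = op inlᵒ (a ∷ [])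
  pattern inr b         = op inrᵒ (b ∷ [])
  pattern ind+ e c d    = op ind+ᵒ (e ∷ c ∷ d ∷ [])
  pattern List A        = op Listᵒ (A ∷ [])
  pattern nil           = op nilᵒ []
  pattern cons l a      = op consᵒ (l ∷ a ∷ [])
  pattern indList l c d = op indListᵒ (l ∷ c ∷ d ∷ [])
  pattern Id A a b      = op Idᵒ (A ∷ a ∷ b ∷ [])
  pattern refl a        = op reflᵒ (a ∷ [])
  pattern indId p c     = op indIdᵒ (p ∷ c ∷ [])
  pattern ∥_∥ A         = op ∥∥ᵒ (A ∷ [])
  pattern ∣_∣ a         = op ∣∣ᵒ (a ∷ [])
  pattern sq A          = op sqᵒ (A ∷ [])
  pattern ind∥∥ e c s   = op ind∥∥ᵒ (e ∷ c ∷ s ∷ [])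
  pattern ua i          = op (uaᵒ i) []
  pattern con c         = op (conᵒ c) []

  private variable
    n : ℕ

  ⌜_⌝ : Tm 0 → Tm n
  ⌜ a ⌝ = ren (λ ()) a

  _⟶_ _×_ : Tm n → Tm n → Tm n
  A ⟶ B = Π A (wk B)
  A × B = Σ A (wk B)

  pr₁ pr₂ : Tm n → Tm n
  pr₁ e = indΣ e #1
  pr₂ e = indΣ e #0

  isProp isSet : Tm n → Tm n
  isProp A = Π A (Π (wk A) (Id (wk (wk A)) #1 #0))
  isSet A  = Π A (Π (wk A) (Π (Id (wk (wk A)) #1 #0)
               (Π (Id (wk (wk (wk A))) #2 #1)
                  (Id (Id (wk (wk (wk (wk A)))) #3 #2) #1 #0))))

  PropU SetU : ℕ → Tm n
  PropU i = Σ (U i) (isProp #0)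
  SetU i  = Σ (U i) (isSet #0)

  _∨_ : Tm n → Tm n → Tm n
  A ∨ B = ∥ A + B ∥

  inl∨ inr∨ : Tm n → Tm n
  inl∨ a = ∣ inl a ∣
  inr∨ b = ∣ inr b ∣

  ind∨ : Tm n → Tm (suc n) → Tm (suc n) → Tm n → Tm n
  ind∨ e c d s = ind∥∥ e (ind+ #0 (ren (lift 1 suc) c) (ren (lift 1 suc) d)) s

  Exists : Tm n → Tm (suc n) → Tm n
  Exists A B = ∥ Σ A B ∥

  pair∃ : Tm n → Tm n → Tm n
  pair∃ a b = ∣ pair a b ∣

  ind∃ : Tm n → Tm (suc (suc n)) → Tm n → Tm n
  ind∃ e c s = ind∥∥ e (indΣ #0 (ren (lift 2 suc) c)) s

  isEquiv : Tm n → Tm n → Tm n → Tm n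
  isEquiv A B f =
      Σ (B ⟶ A) (Π (wk B) (Id (wk (wk B)) (wk (wk f) · (#1 · #0)) #0))
    × Σ (B ⟶ A) (Π (wk A) (Id (wk (wk A)) (#1 · (wk (wk f) · #0)) #0))

  _≃_ : Tm n → Tm n → Tm n
  A ≃ B = Σ (A ⟶ B) (isEquiv (wk A) (wk B) #0)

  -- Transport along p in the family X ↦ X, and the proof by path induction
  -- that it is an equivalence.
  idtoeqv : Tm n
  idtoeqv = lam (pair (indId #0 (lam #0)) (indId #0 (pair idinv idinv)))
    where
    idinv : Tm n
    idinv = pair (lam #0) (lam (refl #0))

  univalence : ℕ → Tm n
  univalence i = Π (U i) (Π (U i) (isEquiv (Id (U i) #1 #0) (#1 ≃ #0) idtoeqv))

record HITs : Set₁ where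
  field
    Const : Set
  open HoTTSyntax Const using (Tm)
  field
    type        : Const → Tm 0
    Eqn         : Set
    lhs rhs typ : Eqn → Tm 0

module HoTT (H : HITs) where

  open HITs H
  open HoTTSyntax Const public

  infix 4 _⊢_ _ctx
  infix 5 _∶_ _≐_∶_

  data Judgement (n : ℕ) : Set where
    _∶_   : Tm n → Tm n → Judgement n
    _≐_∶_ : Tm n → Tm n → Tm n → Judgement n

  private variable
    m n i j           : ℕ
    Γ Δ               : Ctx n
    A A′ B B′ C       : Tm n
    a a′ b b′ c c′ d d′ e e′ f f′ l l′ p p′ s s′ : Tm n
    σ σ′              : Sub n m

  data _ctx : Ctx n → Set
  data _⊢_  : Ctx n → Judgement n → Set

  data _ctx where
    ctx-∅ : ∅ ctx
    ctx-▸ : Γ ⊢ A ∶ U i → Γ ▸ A ctx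

  data _⊢_ where

    var-∶ : Γ ctx → (x : Fin n) → Γ ⊢ var x ∶ lookup Γ x

    ≐-refl  : Γ ⊢ a ∶ A → Γ ⊢ a ≐ a ∶ A
    ≐-sym   : Γ ⊢ a ≐ b ∶ A → Γ ⊢ b ≐ a ∶ A
    ≐-trans : Γ ⊢ a ≐ b ∶ A → Γ ⊢ b ≐ c ∶ A → Γ ⊢ a ≐ c ∶ A

    conv   : Γ ⊢ a ∶ A → Γ ⊢ A ≐ B ∶ U i → Γ ⊢ a ∶ B
    conv-≐ : Γ ⊢ a ≐ b ∶ A → Γ ⊢ A ≐ B ∶ U i → Γ ⊢ a ≐ b ∶ B

    -- Weakening and substitution; these would be admissible if omitted.
    subst   : {Γ : Ctx n} {Δ : Ctx m} →
              Γ ⊢ a ∶ A → Δ ctx →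
              (∀ x → Δ ⊢ σ x ∶ sub σ (lookup Γ x)) →
              Δ ⊢ sub σ a ∶ sub σ A
    subst-≐ : {Γ : Ctx n} {Δ : Ctx m} →
              Γ ⊢ a ≐ b ∶ A → Δ ctx →
              (∀ x → Δ ⊢ σ x ∶ sub σ (lookup Γ x)) →
              (∀ x → Δ ⊢ σ x ≐ σ′ x ∶ sub σ (lookup Γ x)) →
              Δ ⊢ sub σ a ≐ sub σ′ b ∶ sub σ A

    U-form  : Γ ctx → Γ ⊢ U i ∶ U (suc i)
    cumul   : Γ ⊢ A ∶ U i → Γ ⊢ A ∶ U (suc i)
    cumul-≐ : Γ ⊢ A ≐ B ∶ U i → Γ ⊢ A ≐ B ∶ U (suc i)

    Π-form   : Γ ⊢ A ∶ U i → Γ ▸ A ⊢ B ∶ U i → Γ ⊢ Π A B ∶ U i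
    Π-cong   : Γ ⊢ A ≐ A′ ∶ U i → Γ ▸ A ⊢ B ≐ B′ ∶ U i →
               Γ ⊢ Π A B ≐ Π A′ B′ ∶ U i
    lam-∶    : Γ ▸ A ⊢ b ∶ B → Γ ⊢ lam b ∶ Π A B
    lam-cong : Γ ▸ A ⊢ b ≐ b′ ∶ B → Γ ⊢ lam b ≐ lam b′ ∶ Π A B
    app-∶    : Γ ⊢ f ∶ Π A B → Γ ⊢ a ∶ A → Γ ⊢ f · a ∶ B [ a ]
    app-cong : Γ ⊢ f ≐ f′ ∶ Π A B → Γ ⊢ a ≐ a′ ∶ A →
               Γ ⊢ f · a ≐ f′ · a′ ∶ B [ a ]
    Π-β      : Γ ▸ A ⊢ b ∶ B → Γ ⊢ a ∶ A → Γ ⊢ lam b · a ≐ b [ a ] ∶ B [ a ]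
    Π-η      : Γ ⊢ f ∶ Π A B → Γ ⊢ f ≐ lam (wk f · #0) ∶ Π A B

    Σ-form    : Γ ⊢ A ∶ U i → Γ ▸ A ⊢ B ∶ U i → Γ ⊢ Σ A B ∶ U i
    Σ-cong    : Γ ⊢ A ≐ A′ ∶ U i → Γ ▸ A ⊢ B ≐ B′ ∶ U i →
                Γ ⊢ Σ A B ≐ Σ A′ B′ ∶ U i
    pair-∶    : Γ ▸ A ⊢ B ∶ U i → Γ ⊢ a ∶ A → Γ ⊢ b ∶ B [ a ] →
                Γ ⊢ pair a b ∶ Σ A B
    pair-cong : Γ ▸ A ⊢ B ∶ U i → Γ ⊢ a ≐ a′ ∶ A → Γ ⊢ b ≐ b′ ∶ B [ a ] →
                Γ ⊢ pair a b ≐ pair a′ b′ ∶ Σ A B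
    indΣ-∶    : Γ ▸ Σ A B ⊢ C ∶ U i →
                Γ ⊢ e ∶ Σ A B → Γ ▸ A ▸ B ⊢ c ∶ C ↑ 2 [ pair #1 #0 ] →
                Γ ⊢ indΣ e c ∶ C [ e ]
    indΣ-cong : Γ ▸ Σ A B ⊢ C ∶ U i →
                Γ ⊢ e ≐ e′ ∶ Σ A B → Γ ▸ A ▸ B ⊢ c ≐ c′ ∶ C ↑ 2 [ pair #1 #0 ] →
                Γ ⊢ indΣ e c ≐ indΣ e′ c′ ∶ C [ e ]
    Σ-β       : Γ ▸ Σ A B ⊢ C ∶ U i →
                Γ ⊢ a ∶ A → Γ ⊢ b ∶ B [ a ] →
                Γ ▸ A ▸ B ⊢ c ∶ C ↑ 2 [ pair #1 #0 ] →
                Γ ⊢ indΣ (pair a b) c ≐ c [ a ⨾ b ] ∶ C [ pair a b ]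

    𝟎-form    : Γ ctx → Γ ⊢ 𝟎 ∶ U i
    ind𝟎-∶    : Γ ▸ 𝟎 ⊢ C ∶ U i → Γ ⊢ e ∶ 𝟎 → Γ ⊢ ind𝟎 e ∶ C [ e ]
    ind𝟎-cong : Γ ▸ 𝟎 ⊢ C ∶ U i → Γ ⊢ e ≐ e′ ∶ 𝟎 →
                Γ ⊢ ind𝟎 e ≐ ind𝟎 e′ ∶ C [ e ]

    𝟏-form    : Γ ctx → Γ ⊢ 𝟏 ∶ U i
    ⋆-∶       : Γ ctx → Γ ⊢ ⋆ ∶ 𝟏
    ind𝟏-∶    : Γ ▸ 𝟏 ⊢ C ∶ U i → Γ ⊢ e ∶ 𝟏 → Γ ⊢ c ∶ C [ ⋆ ] →
                Γ ⊢ ind𝟏 e c ∶ C [ e ]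
    ind𝟏-cong : Γ ▸ 𝟏 ⊢ C ∶ U i → Γ ⊢ e ≐ e′ ∶ 𝟏 → Γ ⊢ c ≐ c′ ∶ C [ ⋆ ] →
                Γ ⊢ ind𝟏 e c ≐ ind𝟏 e′ c′ ∶ C [ e ]
    𝟏-β       : Γ ▸ 𝟏 ⊢ C ∶ U i → Γ ⊢ c ∶ C [ ⋆ ] →
                Γ ⊢ ind𝟏 ⋆ c ≐ c ∶ C [ ⋆ ]

    Nat-form    : Γ ctx → Γ ⊢ Nat ∶ U i
    zero-∶      : Γ ctx → Γ ⊢ zeroᴺ ∶ Nat
    succ-∶      : Γ ⊢ a ∶ Nat → Γ ⊢ succ a ∶ Nat
    succ-cong   : Γ ⊢ a ≐ a′ ∶ Nat → Γ ⊢ succ a ≐ succ a′ ∶ Nat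
    indNat-∶    : Γ ▸ Nat ⊢ C ∶ U i →
                  Γ ⊢ e ∶ Nat → Γ ⊢ c ∶ C [ zeroᴺ ] →
                  Γ ▸ Nat ▸ C ⊢ d ∶ C ↑ 2 [ succ #1 ] →
                  Γ ⊢ indNat e c d ∶ C [ e ]
    indNat-cong : Γ ▸ Nat ⊢ C ∶ U i →
                  Γ ⊢ e ≐ e′ ∶ Nat → Γ ⊢ c ≐ c′ ∶ C [ zeroᴺ ] →
                  Γ ▸ Nat ▸ C ⊢ d ≐ d′ ∶ C ↑ 2 [ succ #1 ] →
                  Γ ⊢ indNat e c d ≐ indNat e′ c′ d′ ∶ C [ e ]
    Nat-βzero   : Γ ▸ Nat ⊢ C ∶ U i →
                  Γ ⊢ c ∶ C [ zeroᴺ ] →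
                  Γ ▸ Nat ▸ C ⊢ d ∶ C ↑ 2 [ succ #1 ] →
                  Γ ⊢ indNat zeroᴺ c d ≐ c ∶ C [ zeroᴺ ]
    Nat-βsucc   : Γ ▸ Nat ⊢ C ∶ U i →
                  Γ ⊢ a ∶ Nat → Γ ⊢ c ∶ C [ zeroᴺ ] →
                  Γ ▸ Nat ▸ C ⊢ d ∶ C ↑ 2 [ succ #1 ] →
                  Γ ⊢ indNat (succ a) c d ≐ d [ a ⨾ indNat a c d ] ∶ C [ succ a ]

    +-form    : Γ ⊢ A ∶ U i → Γ ⊢ B ∶ U i → Γ ⊢ A + B ∶ U i
    +-cong    : Γ ⊢ A ≐ A′ ∶ U i → Γ ⊢ B ≐ B′ ∶ U i → Γ ⊢ A + B ≐ A′ + B′ ∶ U i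
    inl-∶     : Γ ⊢ A ∶ U i → Γ ⊢ B ∶ U i → Γ ⊢ a ∶ A → Γ ⊢ inl a ∶ A + B
    inl-cong  : Γ ⊢ A ∶ U i → Γ ⊢ B ∶ U i → Γ ⊢ a ≐ a′ ∶ A →
                Γ ⊢ inl a ≐ inl a′ ∶ A + B
    inr-∶     : Γ ⊢ A ∶ U i → Γ ⊢ B ∶ U i → Γ ⊢ b ∶ B → Γ ⊢ inr b ∶ A + B
    inr-cong  : Γ ⊢ A ∶ U i → Γ ⊢ B ∶ U i → Γ ⊢ b ≐ b′ ∶ B →
                Γ ⊢ inr b ≐ inr b′ ∶ A + B
    ind+-∶    : Γ ▸ A + B ⊢ C ∶ U i → Γ ⊢ e ∶ A + B →
                Γ ▸ A ⊢ c ∶ C ↑ 1 [ inl #0 ] → Γ ▸ B ⊢ d ∶ C ↑ 1 [ inr #0 ] →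
                Γ ⊢ ind+ e c d ∶ C [ e ]
    ind+-cong : Γ ▸ A + B ⊢ C ∶ U i → Γ ⊢ e ≐ e′ ∶ A + B →
                Γ ▸ A ⊢ c ≐ c′ ∶ C ↑ 1 [ inl #0 ] →
                Γ ▸ B ⊢ d ≐ d′ ∶ C ↑ 1 [ inr #0 ] →
                Γ ⊢ ind+ e c d ≐ ind+ e′ c′ d′ ∶ C [ e ]
    +-βinl    : Γ ▸ A + B ⊢ C ∶ U i → Γ ⊢ a ∶ A →
                Γ ▸ A ⊢ c ∶ C ↑ 1 [ inl #0 ] → Γ ▸ B ⊢ d ∶ C ↑ 1 [ inr #0 ] →
                Γ ⊢ ind+ (inl a) c d ≐ c [ a ] ∶ C [ inl a ]
    +-βinr    : Γ ▸ A + B ⊢ C ∶ U i → Γ ⊢ b ∶ B →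
                Γ ▸ A ⊢ c ∶ C ↑ 1 [ inl #0 ] → Γ ▸ B ⊢ d ∶ C ↑ 1 [ inr #0 ] →
                Γ ⊢ ind+ (inr b) c d ≐ d [ b ] ∶ C [ inr b ]

    List-form    : Γ ⊢ A ∶ U i → Γ ⊢ List A ∶ U i
    List-cong    : Γ ⊢ A ≐ A′ ∶ U i → Γ ⊢ List A ≐ List A′ ∶ U i
    nil-∶        : Γ ⊢ A ∶ U i → Γ ⊢ nil ∶ List A
    cons-∶       : Γ ⊢ l ∶ List A → Γ ⊢ a ∶ A → Γ ⊢ cons l a ∶ List A
    cons-cong    : Γ ⊢ l ≐ l′ ∶ List A → Γ ⊢ a ≐ a′ ∶ A →
                   Γ ⊢ cons l a ≐ cons l′ a′ ∶ List A
    indList-∶    : Γ ▸ List A ⊢ C ∶ U i → Γ ⊢ l ∶ List A → Γ ⊢ c ∶ C [ nil ] →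
                   Γ ▸ List A ▸ wk A ▸ C ↑ 2 [ #1 ] ⊢ d ∶ C ↑ 3 [ cons #2 #1 ] →
                   Γ ⊢ indList l c d ∶ C [ l ]
    indList-cong : Γ ▸ List A ⊢ C ∶ U i →
                   Γ ⊢ l ≐ l′ ∶ List A → Γ ⊢ c ≐ c′ ∶ C [ nil ] →
                   Γ ▸ List A ▸ wk A ▸ C ↑ 2 [ #1 ]
                     ⊢ d ≐ d′ ∶ C ↑ 3 [ cons #2 #1 ] →
                   Γ ⊢ indList l c d ≐ indList l′ c′ d′ ∶ C [ l ]
    List-βnil    : Γ ▸ List A ⊢ C ∶ U i → Γ ⊢ c ∶ C [ nil ] →
                   Γ ▸ List A ▸ wk A ▸ C ↑ 2 [ #1 ] ⊢ d ∶ C ↑ 3 [ cons #2 #1 ] →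
                   Γ ⊢ indList nil c d ≐ c ∶ C [ nil ]
    List-βcons   : Γ ▸ List A ⊢ C ∶ U i → Γ ⊢ l ∶ List A → Γ ⊢ a ∶ A →
                   Γ ⊢ c ∶ C [ nil ] →
                   Γ ▸ List A ▸ wk A ▸ C ↑ 2 [ #1 ] ⊢ d ∶ C ↑ 3 [ cons #2 #1 ] →
                   Γ ⊢ indList (cons l a) c d
                     ≐ sub (var ▹ l ▹ a ▹ indList l c d) d ∶ C [ cons l a ]

    Id-form    : Γ ⊢ A ∶ U i → Γ ⊢ a ∶ A → Γ ⊢ b ∶ A → Γ ⊢ Id A a b ∶ U i
    Id-cong    : Γ ⊢ A ≐ A′ ∶ U i → Γ ⊢ a ≐ a′ ∶ A → Γ ⊢ b ≐ b′ ∶ A →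
                 Γ ⊢ Id A a b ≐ Id A′ a′ b′ ∶ U i
    refl-∶     : Γ ⊢ a ∶ A → Γ ⊢ refl a ∶ Id A a a
    refl-cong  : Γ ⊢ a ≐ a′ ∶ A → Γ ⊢ refl a ≐ refl a′ ∶ Id A a a
    indId-∶    : Γ ▸ A ▸ wk A ▸ Id (wk (wk A)) #1 #0 ⊢ C ∶ U i →
                 Γ ⊢ a ∶ A → Γ ⊢ b ∶ A → Γ ⊢ p ∶ Id A a b →
                 Γ ▸ A ⊢ c ∶ sub ((λ x → var (suc x)) ▹ #0 ▹ #0 ▹ refl #0) C →
                 Γ ⊢ indId p c ∶ sub (var ▹ a ▹ b ▹ p) C
    indId-cong : Γ ▸ A ▸ wk A ▸ Id (wk (wk A)) #1 #0 ⊢ C ∶ U i →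
                 Γ ⊢ a ∶ A → Γ ⊢ b ∶ A → Γ ⊢ p ≐ p′ ∶ Id A a b →
                 Γ ▸ A ⊢ c ≐ c′ ∶ sub ((λ x → var (suc x)) ▹ #0 ▹ #0 ▹ refl #0) C →
                 Γ ⊢ indId p c ≐ indId p′ c′ ∶ sub (var ▹ a ▹ b ▹ p) C
    Id-β       : Γ ▸ A ▸ wk A ▸ Id (wk (wk A)) #1 #0 ⊢ C ∶ U i →
                 Γ ⊢ a ∶ A →
                 Γ ▸ A ⊢ c ∶ sub ((λ x → var (suc x)) ▹ #0 ▹ #0 ▹ refl #0) C →
                 Γ ⊢ indId (refl a) c ≐ c [ a ] ∶ sub (var ▹ a ▹ a ▹ refl a) C

    ∥∥-form    : Γ ⊢ A ∶ U i → Γ ⊢ ∥ A ∥ ∶ U i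
    ∥∥-cong    : Γ ⊢ A ≐ A′ ∶ U i → Γ ⊢ ∥ A ∥ ≐ ∥ A′ ∥ ∶ U i
    ∣∣-∶       : Γ ⊢ a ∶ A → Γ ⊢ ∣ a ∣ ∶ ∥ A ∥
    ∣∣-cong    : Γ ⊢ a ≐ a′ ∶ A → Γ ⊢ ∣ a ∣ ≐ ∣ a′ ∣ ∶ ∥ A ∥
    sq-∶       : Γ ⊢ A ∶ U i → Γ ⊢ sq A ∶ isProp ∥ A ∥
    sq-cong    : Γ ⊢ A ≐ A′ ∶ U i → Γ ⊢ sq A ≐ sq A′ ∶ isProp ∥ A ∥
    ind∥∥-∶    : Γ ⊢ C ∶ U i → Γ ⊢ e ∶ ∥ A ∥ → Γ ▸ A ⊢ c ∶ wk C →
                 Γ ⊢ s ∶ isProp C → Γ ⊢ ind∥∥ e c s ∶ C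
    ind∥∥-cong : Γ ⊢ C ∶ U i → Γ ⊢ e ≐ e′ ∶ ∥ A ∥ → Γ ▸ A ⊢ c ≐ c′ ∶ wk C →
                 Γ ⊢ s ≐ s′ ∶ isProp C → Γ ⊢ ind∥∥ e c s ≐ ind∥∥ e′ c′ s′ ∶ C
    ∥∥-β       : Γ ⊢ C ∶ U i → Γ ⊢ a ∶ A → Γ ▸ A ⊢ c ∶ wk C →
                 Γ ⊢ s ∶ isProp C → Γ ⊢ ind∥∥ ∣ a ∣ c s ≐ c [ a ] ∶ C

    ua-∶ : Γ ctx → Γ ⊢ ua i ∶ univalence i

    con-∶ : (k : Const) → ∅ ⊢ type k ∶ U i → Γ ctx → Γ ⊢ con k ∶ ⌜ type k ⌝
    eqn-≐ : (k : Eqn) → ∅ ⊢ lhs k ∶ typ k → ∅ ⊢ rhs k ∶ typ k → Γ ctx →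
            Γ ⊢ ⌜ lhs k ⌝ ≐ ⌜ rhs k ⌝ ∶ ⌜ typ k ⌝

-- By cumulativity the terms for U 1 apply to small and to large types alike.
-- The interpretation has to use one term for both, as a raw expression does not
-- determine which of the two is meant.

record ProofTerms (H : HITs) : Set where
  open HoTT H
  field
    𝔭₀ 𝔭→ 𝔭× 𝔭Π 𝔭∨ 𝔭∃ 𝔭Id                 : Tm 0
    𝔰coe 𝔰₀ 𝔰₁ 𝔰Π 𝔰Σ 𝔰+ 𝔰List 𝔰Prop₀       : Tm 0

    ⊢𝔭₀  : ∅ ⊢ 𝔭₀ ∶ isProp 𝟎
    ⊢𝔭→  : ∅ ⊢ 𝔭→ ∶ Π (U 1) (Π (U 1) (Π (isProp #0) (isProp (#2 ⟶ #1))))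
    ⊢𝔭×  : ∅ ⊢ 𝔭× ∶ Π (U 1) (Π (U 1) (Π (isProp #1) (Π (isProp #1)
                       (isProp (#3 × #2)))))
    ⊢𝔭Π  : ∅ ⊢ 𝔭Π ∶ Π (U 1) (Π (#0 ⟶ U 1) (Π (Π #1 (isProp (#1 · #0)))
                       (isProp (Π #2 (#2 · #0)))))
    ⊢𝔭∨  : ∅ ⊢ 𝔭∨ ∶ Π (U 1) (Π (U 1) (isProp (#1 ∨ #0)))
    ⊢𝔭∃  : ∅ ⊢ 𝔭∃ ∶ Π (U 1) (Π (#0 ⟶ U 1) (isProp (Exists #1 (#1 · #0))))
    ⊢𝔭Id : ∅ ⊢ 𝔭Id ∶ Π (U 1) (Π (isSet #0) (Π #1 (Π #2 (isProp (Id #3 #1 #0)))))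

    ⊢𝔰coe   : ∅ ⊢ 𝔰coe ∶ Π (U 1) (isProp #0 ⟶ isSet #0)
    ⊢𝔰₀     : ∅ ⊢ 𝔰₀ ∶ isSet 𝟎
    ⊢𝔰₁     : ∅ ⊢ 𝔰₁ ∶ isSet 𝟏
    ⊢𝔰Π     : ∅ ⊢ 𝔰Π ∶ Π (U 1) (Π (#0 ⟶ U 1) (Π (Π #1 (isSet (#1 · #0)))
                          (isSet (Π #2 (#2 · #0)))))
    ⊢𝔰Σ     : ∅ ⊢ 𝔰Σ ∶ Π (U 1) (Π (#0 ⟶ U 1) (Π (isSet #1)
                          (Π (Π #2 (isSet (#2 · #0)))
                             (isSet (Σ #3 (#3 · #0))))))
    ⊢𝔰+     : ∅ ⊢ 𝔰+ ∶ Π (U 1) (Π (U 1) (Π (isSet #1) (Π (isSet #1)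
                          (isSet (#3 + #2)))))
    ⊢𝔰List  : ∅ ⊢ 𝔰List ∶ Π (U 1) (Π (isSet #0) (isSet (List #1)))
    ⊢𝔰Prop₀ : ∅ ⊢ 𝔰Prop₀ ∶ isSet (PropU 0)

module Interpretation (H : HITs) (𝔠 : ProofTerms H) where

  open HoTT H
  open ProofTerms 𝔠
  private module M = MTT

  private variable
    n : ℕ
    s : M.Sort

  ⟦_⟧ : M.Expr s n → Maybe (Tm n)
  prP : M.Ty n → Maybe (Tm n)
  prS : M.Ty n → Maybe (Tm n)

  ⟦ M.var x ⟧ = just (var x)

  ⟦ M.N₀ ⟧ = just 𝟎
  ⟦ M.N₁ ⟧ = just 𝟏
  ⟦ M.List A ⟧ = do A ← ⟦ A ⟧; just (List A)
  ⟦ A M.+ B ⟧ = do A ← ⟦ A ⟧; B ← ⟦ B ⟧; just (A + B)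
  ⟦ M.Σ A B ⟧ = do A ← ⟦ A ⟧; B ← ⟦ B ⟧; just (Σ A B)
  ⟦ M.Π A B ⟧ = do A ← ⟦ A ⟧; B ← ⟦ B ⟧; just (Π A B)
  ⟦ M.Propₛ ⟧ = just (PropU 0)
  ⟦ A M.→Propₛ ⟧ = do A ← ⟦ A ⟧; just (A ⟶ PropU 0)
  ⟦ M.⊥ ⟧ = just 𝟎
  ⟦ A M.∨ B ⟧ = do A ← ⟦ A ⟧; B ← ⟦ B ⟧; just (A ∨ B)
  ⟦ A M.∧ B ⟧ = do A ← ⟦ A ⟧; B ← ⟦ B ⟧; just (A × B)
  ⟦ A M.⇒ B ⟧ = do A ← ⟦ A ⟧; B ← ⟦ B ⟧; just (A ⟶ B)
  ⟦ M.Exists A B ⟧ = do A ← ⟦ A ⟧; B ← ⟦ B ⟧; just (Exists A B)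
  ⟦ M.Forall A B ⟧ = do A ← ⟦ A ⟧; B ← ⟦ B ⟧; just (Π A B)
  ⟦ M.Id A a b ⟧ = do A ← ⟦ A ⟧; a ← ⟦ a ⟧; b ← ⟦ b ⟧; just (Id A a b)
  ⟦ M.τ p ⟧ = do p ← ⟦ p ⟧; just (pr₁ p)

  ⟦ M.emp₀ e ⟧ = do e ← ⟦ e ⟧; just (ind𝟎 e)
  ⟦ M.⋆ ⟧ = just ⋆
  ⟦ M.elN₁ e c ⟧ = do e ← ⟦ e ⟧; c ← ⟦ c ⟧; just (ind𝟏 e c)
  ⟦ M.ε ⟧ = just nil
  ⟦ M.cons l a ⟧ = do l ← ⟦ l ⟧; a ← ⟦ a ⟧; just (cons l a)
  ⟦ M.elList l c d ⟧ = do l ← ⟦ l ⟧; c ← ⟦ c ⟧; d ← ⟦ d ⟧; just (indList l c d)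
  ⟦ M.inl a ⟧ = do a ← ⟦ a ⟧; just (inl a)
  ⟦ M.inr b ⟧ = do b ← ⟦ b ⟧; just (inr b)
  ⟦ M.el+ e c d ⟧ = do e ← ⟦ e ⟧; c ← ⟦ c ⟧; d ← ⟦ d ⟧; just (ind+ e c d)
  ⟦ M.pair a b ⟧ = do a ← ⟦ a ⟧; b ← ⟦ b ⟧; just (pair a b)
  ⟦ M.elΣ e c ⟧ = do e ← ⟦ e ⟧; c ← ⟦ c ⟧; just (indΣ e c)
  ⟦ M.lam b ⟧ = do b ← ⟦ b ⟧; just (lam b)
  ⟦ M.Ap f a ⟧ = do f ← ⟦ f ⟧; a ← ⟦ a ⟧; just (f · a)

  ⟦ M.r₀ e ⟧ = do e ← ⟦ e ⟧; just (ind𝟎 e)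
  ⟦ M.inl∨ a ⟧ = do a ← ⟦ a ⟧; just (inl∨ a)
  ⟦ M.inr∨ b ⟧ = do b ← ⟦ b ⟧; just (inr∨ b)
  ⟦ M.el∨ C e c d ⟧ = do
    e ← ⟦ e ⟧; c ← ⟦ c ⟧; d ← ⟦ d ⟧; s ← prP C; just (ind∨ e c d s)
  ⟦ M.pair∧ a b ⟧ = do a ← ⟦ a ⟧; b ← ⟦ b ⟧; just (pair a b)
  ⟦ M.π₁ e ⟧ = do e ← ⟦ e ⟧; just (pr₁ e)
  ⟦ M.π₂ e ⟧ = do e ← ⟦ e ⟧; just (pr₂ e)
  ⟦ M.lam⇒ b ⟧ = do b ← ⟦ b ⟧; just (lam b)
  ⟦ M.Ap⇒ f a ⟧ = do f ← ⟦ f ⟧; a ← ⟦ a ⟧; just (f · a)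
  ⟦ M.pair∃ a b ⟧ = do a ← ⟦ a ⟧; b ← ⟦ b ⟧; just (pair∃ a b)
  ⟦ M.el∃ C e c ⟧ = do e ← ⟦ e ⟧; c ← ⟦ c ⟧; s ← prP C; just (ind∃ e c s)
  ⟦ M.lam∀ b ⟧ = do b ← ⟦ b ⟧; just (lam b)
  ⟦ M.Ap∀ f a ⟧ = do f ← ⟦ f ⟧; a ← ⟦ a ⟧; just (f · a)
  ⟦ M.id A a ⟧ = do a ← ⟦ a ⟧; just (refl a)
  ⟦ M.elId p c ⟧ = do p ← ⟦ p ⟧; c ← ⟦ c ⟧; just (indId p c)

  ⟦ M.⊥ᶜ ⟧ = just (pair 𝟎 ⌜ 𝔭₀ ⌝)
  ⟦ p M.∨ᶜ q ⟧ = do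
    p ← ⟦ p ⟧; q ← ⟦ q ⟧
    just (pair (pr₁ p ∨ pr₁ q) (⌜ 𝔭∨ ⌝ · pr₁ p · pr₁ q))
  ⟦ p M.∧ᶜ q ⟧ = do
    p ← ⟦ p ⟧; q ← ⟦ q ⟧
    just (pair (pr₁ p × pr₁ q) (⌜ 𝔭× ⌝ · pr₁ p · pr₁ q · pr₂ p · pr₂ q))
  ⟦ p M.⇒ᶜ q ⟧ = do
    p ← ⟦ p ⟧; q ← ⟦ q ⟧
    just (pair (pr₁ p ⟶ pr₁ q) (⌜ 𝔭→ ⌝ · pr₁ p · pr₁ q · pr₂ q))
  ⟦ M.Existsᶜ A p ⟧ = do
    A ← ⟦ A ⟧; p ← ⟦ p ⟧
    just (pair (Exists A (pr₁ p)) (⌜ 𝔭∃ ⌝ · A · lam (pr₁ p)))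
  ⟦ M.Forallᶜ A p ⟧ = do
    A ← ⟦ A ⟧; p ← ⟦ p ⟧
    just (pair (Π A (pr₁ p)) (⌜ 𝔭Π ⌝ · A · lam (pr₁ p) · lam (pr₂ p)))
  ⟦ M.Idᶜ A a b ⟧ = do
    A′ ← ⟦ A ⟧; s ← prS A; a ← ⟦ a ⟧; b ← ⟦ b ⟧
    just (pair (Id A′ a b) (⌜ 𝔭Id ⌝ · A′ · s · a · b))

  prP M.⊥ = just ⌜ 𝔭₀ ⌝
  prP (A M.∨ B) = do A ← ⟦ A ⟧; B ← ⟦ B ⟧; just (⌜ 𝔭∨ ⌝ · A · B)
  prP (A M.∧ B) = do
    A′ ← ⟦ A ⟧; B′ ← ⟦ B ⟧; p ← prP A; q ← prP B
    just (⌜ 𝔭× ⌝ · A′ · B′ · p · q)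
  prP (A M.⇒ B) = do
    A ← ⟦ A ⟧; B′ ← ⟦ B ⟧; q ← prP B; just (⌜ 𝔭→ ⌝ · A · B′ · q)
  prP (M.Exists A B) = do A ← ⟦ A ⟧; B ← ⟦ B ⟧; just (⌜ 𝔭∃ ⌝ · A · lam B)
  prP (M.Forall A B) = do
    A ← ⟦ A ⟧; B′ ← ⟦ B ⟧; q ← prP B; just (⌜ 𝔭Π ⌝ · A · lam B′ · lam q)
  prP (M.Id A a b) = do
    A′ ← ⟦ A ⟧; s ← prS A; a ← ⟦ a ⟧; b ← ⟦ b ⟧
    just (⌜ 𝔭Id ⌝ · A′ · s · a · b)
  prP (M.τ p) = do p ← ⟦ p ⟧; just (pr₂ p)
  prP _ = nothing

  prS M.N₀ = just ⌜ 𝔰₀ ⌝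
  prS M.N₁ = just ⌜ 𝔰₁ ⌝
  prS (M.List A) = do A′ ← ⟦ A ⟧; s ← prS A; just (⌜ 𝔰List ⌝ · A′ · s)
  prS (A M.+ B) = do
    A′ ← ⟦ A ⟧; B′ ← ⟦ B ⟧; s ← prS A; t ← prS B
    just (⌜ 𝔰+ ⌝ · A′ · B′ · s · t)
  prS (M.Σ A B) = do
    A′ ← ⟦ A ⟧; B′ ← ⟦ B ⟧; s ← prS A; t ← prS B
    just (⌜ 𝔰Σ ⌝ · A′ · lam B′ · s · lam t)
  prS (M.Π A B) = do
    A ← ⟦ A ⟧; B′ ← ⟦ B ⟧; t ← prS B
    just (⌜ 𝔰Π ⌝ · A · lam B′ · lam t)
  prS M.Propₛ = just ⌜ 𝔰Prop₀ ⌝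
  prS (A M.→Propₛ) = do
    A ← ⟦ A ⟧; just (⌜ 𝔰Π ⌝ · A · lam (PropU 0) · lam ⌜ 𝔰Prop₀ ⌝)
  -- the remaining type formers are the propositional ones
  prS P = do P′ ← ⟦ P ⟧; p ← prP P; just (⌜ 𝔰coe ⌝ · P′ · p)

  ⟦_⟧ᶜ : M.Ctx n → Maybe (Ctx n)
  ⟦ M.∅ ⟧ᶜ = just ∅
  ⟦ Γ M.▸ A ⟧ᶜ = do Γ ← ⟦ Γ ⟧ᶜ; A ← ⟦ A ⟧; just (Γ ▸ A)

  level : M.Size → ℕ
  level M.small = 0
  level M.large = 1

  ⟦_⟧ᴶ : M.Judgement n → Maybe (List.List (Judgement n))
  ⟦ A M.is M.type z ⟧ᴶ = do
    A′ ← ⟦ A ⟧; s ← prS A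
    just ((A′ ∶ U (level z)) ∷ (s ∶ isSet A′) ∷ [])
  ⟦ P M.is M.prop′ z ⟧ᴶ = do
    P′ ← ⟦ P ⟧; p ← prP P
    just ((P′ ∶ U (level z)) ∷ (p ∶ isProp P′) ∷ [])
  ⟦ A M.≐ B is M.type z ⟧ᴶ = do
    A′ ← ⟦ A ⟧; s ← prS A; B′ ← ⟦ B ⟧; t ← prS B
    just ((pair A′ s ≐ pair B′ t ∶ SetU (level z)) ∷ [])
  ⟦ P M.≐ Q is M.prop′ z ⟧ᴶ = do
    P′ ← ⟦ P ⟧; p ← prP P; Q′ ← ⟦ Q ⟧; q ← prP Q
    just ((pair P′ p ≐ pair Q′ q ∶ PropU (level z)) ∷ [])
  ⟦ a M.∈ A ⟧ᴶ = do a ← ⟦ a ⟧; A ← ⟦ A ⟧; just ((a ∶ A) ∷ [])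
  ⟦ a M.≐ b ∈ A ⟧ᴶ = do
    a ← ⟦ a ⟧; b ← ⟦ b ⟧; A ← ⟦ A ⟧
    just ((a ≐ b ∶ A) ∷ [])

  -- prS(P•) : isSet(P•) for a proposition P, with prS(P•) written out.
  isSet-via-coe : M.Ty n → Maybe (List.List (Judgement n))
  isSet-via-coe P = do
    P′ ← ⟦ P ⟧; p ← prP P
    just ((⌜ 𝔰coe ⌝ · P′ · p ∶ isSet P′) ∷ [])

  -- The interpretation of Γ is defined, so is Js, and each of the judgements
  -- in Js is derivable in the former.
  record Holds (Γ : M.Ctx n) (Js : Maybe (List.List (Judgement n))) : Set where
    field
      {context}    : Ctx n
      {judgements} : List.List (Judgement n)
      context-def    : ⟦ Γ ⟧ᶜ ≡ just context
      judgements-def : Js ≡ just judgements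
      derivable      : All (context ⊢_) judgements

{-# OPTIONS --safe #-}
module Submission where

open import Defs
open import Data.Bool.Base using (Bool; true; false; T)
open import Data.Empty using (⊥)
open import Data.Fin.Base using (Fin; zero; suc; lift; _↑ʳ_)
open import Data.List.Base as List using ([]; _∷_)
open import Data.List.Relation.Unary.All using (All; []; _∷_)
open import Data.Maybe.Base using (just)
open import Data.Nat.Base as ℕ using (ℕ; zero; suc)
open import Data.Product.Base as Prod using (_×_; _,_; proj₁; proj₂; ∃)
open import Data.Sum.Base using (_⊎_; inj₁; inj₂)
open import Data.Unit.Base using (⊤; tt)
open import Relation.Binary.PropositionalEquality
  using (_≡_; refl; sym; trans; cong; cong₂; subst; subst₂)

-- The interpretation is partial only because prP is undefined on types that are
-- not propositional.  Replacing it by a total map makes it commute with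
-- substitution on all raw expressions, and derivable judgements only mention
-- expressions on which the two maps agree.  For the total map, soundness is shown
-- by induction on derivations, for a strengthening of the interpreted judgements
-- in which every type and both sides of every equality are well-formed.  A type
-- equality is an equality of pairs because prP and prS are built from the parts of
-- a type by applying fixed closed terms, and application is a congruence.

-- An equality of types becomes a definitional equality of pairs, so the truncation proofs on its
-- two sides must agree definitionally; that `isProp` is itself an h-proposition would give only an
-- identification. Hence the witnesses are computed from raw expressions. Two coincidences carry the
-- rules that relate different expressions. The second component of an interpreted code is literally
-- the proof attached to the decoded proposition, so the equations for `τ` reduce to the β-rules of
-- the projections. And `prS` of a proposition is `𝔰coe` applied to its `prP`, so equalities of
-- propositions carry over to sets and collections. Definedness is settled separately and
-- syntactically: type expressions are never variables, and subsumption never leads from a set or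
-- collection to a proposition, so a propositional kind fixes the head symbol and with it the clause
-- of `prP`. Replacement of equals needs a typed right-hand substitution, but the induction types
-- its entries only at the left-hand types; this shapes the treatment of contexts.

-- Laws of renaming and substitution on raw expressions.

module SyntaxProperties {Sort : Set} (ty tm : Sort)
                        (Op : Sort → List.List (ℕ × Sort) → Set) where

  open Syntax ty tm Op

  private variable
    s         : Sort
    ar        : List.List (ℕ × Sort)
    l m n     : ℕ

  lift-var : ∀ k {ρ : Fin n → Fin m} {σ : Sub n m} →
             (∀ x → var (ρ x) ≡ σ x) → ∀ x → var (lift k ρ x) ≡ liftˢ k σ x
  lift-var zero    h x       = h x
  lift-var (suc k) h zero    = refl
  lift-var (suc k) h (suc x) = cong wk (lift-var k h x)

  -- Function extensionality is not assumed, so each law takes a pointwise hypothesis and leaves the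
  -- resulting renaming or substitution free. A use picks the shape it needs, and the hypothesis is
  -- then mostly `refl` on the constructors of `Fin`.
  ren-as-sub     : {ρ : Fin n → Fin m} {σ : Sub n m} →
                   (∀ x → var (ρ x) ≡ σ x) → (e : Expr s n) → ren ρ e ≡ sub σ e
  renArgs-as-sub : {ρ : Fin n → Fin m} {σ : Sub n m} →
                   (∀ x → var (ρ x) ≡ σ x) → (es : Args ar n) →
                   renArgs ρ es ≡ subArgs σ es
  ren-as-sub h (var x)   = h x
  ren-as-sub h (op o es) = cong (op o) (renArgs-as-sub h es)
  renArgs-as-sub h []                 = refl
  renArgs-as-sub h (_∷_ {k = k} e es) =
    cong₂ _∷_ (ren-as-sub (lift-var k h) e) (renArgs-as-sub h es)

  liftˢ-id : ∀ k {σ : Sub n n} → (∀ x → σ x ≡ var x) → ∀ x → liftˢ k σ x ≡ var x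
  liftˢ-id zero    h x       = h x
  liftˢ-id (suc k) h zero    = refl
  liftˢ-id (suc k) h (suc x) = cong wk (liftˢ-id k h x)

  sub-id     : {σ : Sub n n} → (∀ x → σ x ≡ var x) → (e : Expr s n) → sub σ e ≡ e
  subArgs-id : {σ : Sub n n} → (∀ x → σ x ≡ var x) → (es : Args ar n) →
               subArgs σ es ≡ es
  sub-id h (var x)   = h x
  sub-id h (op o es) = cong (op o) (subArgs-id h es)
  subArgs-id h []                 = refl
  subArgs-id h (_∷_ {k = k} e es) =
    cong₂ _∷_ (sub-id (liftˢ-id k h) e) (subArgs-id h es)

  lift-lift : ∀ k {ρ : Fin m → Fin l} {ρ′ : Fin n → Fin m} {ρ″ : Fin n → Fin l} →
              (∀ x → ρ (ρ′ x) ≡ ρ″ x) → ∀ x → lift k ρ (lift k ρ′ x) ≡ lift k ρ″ x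
  lift-lift zero    h x       = h x
  lift-lift (suc k) h zero    = refl
  lift-lift (suc k) h (suc x) = cong suc (lift-lift k h x)

  ren-ren     : {ρ : Fin m → Fin l} {ρ′ : Fin n → Fin m} {ρ″ : Fin n → Fin l} →
                (∀ x → ρ (ρ′ x) ≡ ρ″ x) → (e : Expr s n) →
                ren ρ (ren ρ′ e) ≡ ren ρ″ e
  renArgs-ren : {ρ : Fin m → Fin l} {ρ′ : Fin n → Fin m} {ρ″ : Fin n → Fin l} →
                (∀ x → ρ (ρ′ x) ≡ ρ″ x) → (es : Args ar n) →
                renArgs ρ (renArgs ρ′ es) ≡ renArgs ρ″ es
  ren-ren h (var x)   = cong var (h x)
  ren-ren h (op o es) = cong (op o) (renArgs-ren h es)
  renArgs-ren h []                 = refl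
  renArgs-ren h (_∷_ {k = k} e es) =
    cong₂ _∷_ (ren-ren (lift-lift k h) e) (renArgs-ren h es)

  liftˢ-lift : ∀ k {σ : Sub m l} {ρ : Fin n → Fin m} {τ : Sub n l} →
               (∀ x → σ (ρ x) ≡ τ x) → ∀ x → liftˢ k σ (lift k ρ x) ≡ liftˢ k τ x
  liftˢ-lift zero    h x       = h x
  liftˢ-lift (suc k) h zero    = refl
  liftˢ-lift (suc k) h (suc x) = cong wk (liftˢ-lift k h x)

  sub-ren     : {σ : Sub m l} {ρ : Fin n → Fin m} {τ : Sub n l} →
                (∀ x → σ (ρ x) ≡ τ x) → (e : Expr s n) →
                sub σ (ren ρ e) ≡ sub τ e
  subArgs-ren : {σ : Sub m l} {ρ : Fin n → Fin m} {τ : Sub n l} →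
                (∀ x → σ (ρ x) ≡ τ x) → (es : Args ar n) →
                subArgs σ (renArgs ρ es) ≡ subArgs τ es
  sub-ren h (var x)   = h x
  sub-ren h (op o es) = cong (op o) (subArgs-ren h es)
  subArgs-ren h []                 = refl
  subArgs-ren h (_∷_ {k = k} e es) =
    cong₂ _∷_ (sub-ren (liftˢ-lift k h) e) (subArgs-ren h es)

  wk-ren : {ρ : Fin n → Fin m} {ρ′ : Fin (suc n) → Fin (suc m)} →
           (∀ x → ρ′ (suc x) ≡ suc (ρ x)) → (e : Expr s n) →
           ren ρ′ (wk e) ≡ wk (ren ρ e)
  wk-ren h e = trans (ren-ren h e) (sym (ren-ren (λ _ → refl) e))

  lift-liftˢ : ∀ k {ρ : Fin m → Fin l} {σ : Sub n m} {τ : Sub n l} →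
               (∀ x → ren ρ (σ x) ≡ τ x) →
               ∀ x → ren (lift k ρ) (liftˢ k σ x) ≡ liftˢ k τ x
  lift-liftˢ zero    h x       = h x
  lift-liftˢ (suc k) h zero    = refl
  lift-liftˢ (suc k) {σ = σ} h (suc x) =
    trans (wk-ren (λ _ → refl) (liftˢ k σ x)) (cong wk (lift-liftˢ k h x))

  ren-sub     : {ρ : Fin m → Fin l} {σ : Sub n m} {τ : Sub n l} →
                (∀ x → ren ρ (σ x) ≡ τ x) → (e : Expr s n) →
                ren ρ (sub σ e) ≡ sub τ e
  renArgs-sub : {ρ : Fin m → Fin l} {σ : Sub n m} {τ : Sub n l} →
                (∀ x → ren ρ (σ x) ≡ τ x) → (es : Args ar n) →
                renArgs ρ (subArgs σ es) ≡ subArgs τ es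
  ren-sub h (var x)   = h x
  ren-sub h (op o es) = cong (op o) (renArgs-sub h es)
  renArgs-sub h []                 = refl
  renArgs-sub h (_∷_ {k = k} e es) =
    cong₂ _∷_ (ren-sub (lift-liftˢ k h) e) (renArgs-sub h es)

  wk-sub : {σ : Sub n m} (e : Expr s n) → sub (liftˢ 1 σ) (wk e) ≡ wk (sub σ e)
  wk-sub e = trans (sub-ren (λ _ → refl) e) (sym (ren-sub (λ _ → refl) e))

  liftˢ-liftˢ : ∀ k {σ : Sub m l} {σ′ : Sub n m} {τ : Sub n l} →
                (∀ x → sub σ (σ′ x) ≡ τ x) →
                ∀ x → sub (liftˢ k σ) (liftˢ k σ′ x) ≡ liftˢ k τ x
  liftˢ-liftˢ zero    h x       = h x
  liftˢ-liftˢ (suc k) h zero    = refl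
  liftˢ-liftˢ (suc k) {σ′ = σ′} h (suc x) =
    trans (wk-sub (liftˢ k σ′ x)) (cong wk (liftˢ-liftˢ k h x))

  -- Under a binder both substitutions are lifted. Lifting weakens, so this case rests on commuting
  -- a substitution with a renaming, in both orders; those laws therefore come first.
  sub-sub     : {σ : Sub m l} {σ′ : Sub n m} {τ : Sub n l} →
                (∀ x → sub σ (σ′ x) ≡ τ x) → (e : Expr s n) →
                sub σ (sub σ′ e) ≡ sub τ e
  subArgs-sub : {σ : Sub m l} {σ′ : Sub n m} {τ : Sub n l} →
                (∀ x → sub σ (σ′ x) ≡ τ x) → (es : Args ar n) →
                subArgs σ (subArgs σ′ es) ≡ subArgs τ es
  sub-sub h (var x)   = h x
  sub-sub h (op o es) = cong (op o) (subArgs-sub h es)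
  subArgs-sub h []                 = refl
  subArgs-sub h (_∷_ {k = k} e es) =
    cong₂ _∷_ (sub-sub (liftˢ-liftˢ k h) e) (subArgs-sub h es)

  sub-▹-wk : {σ : Sub n m} {a : Expr tm m} (e : Expr s n) →
             sub (σ ▹ a) (wk e) ≡ sub σ e
  sub-▹-wk e = sub-ren (λ _ → refl) e

  wk-[] : {a : Expr tm n} (e : Expr s n) → wk e [ a ] ≡ e
  wk-[] e = trans (sub-▹-wk e) (sub-id (λ _ → refl) e)

  lift-[] : {σ : Sub n m} {a : Expr tm m} (e : Expr s (suc n)) →
            sub (liftˢ 1 σ) e [ a ] ≡ sub (σ ▹ a) e
  lift-[] {σ = σ} e = sub-sub (λ where
    zero    → refl
    (suc x) → wk-[] (σ x)) e

-- Presuppositions and admissible rules of HoTT.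

module Admissible (H : HITs) where

  open HoTT H renaming (_×_ to _⊗_; refl to reflᵗ; subst to sub-∶; subst-≐ to sub-≐)
  open SyntaxProperties tt tt Op

  private variable
    m n i j           : ℕ
    Γ Δ               : Ctx n
    J                 : Judgement n
    A A′ B B′ C D     : Tm n
    a a′ b b′ c d e e′ f f′ p q : Tm n
    ρ                 : Fin n → Fin m

  -- Unlike _ctx, this keeps the derivations for the initial segments of Γ.
  data WF : Ctx n → Set where
    wf-∅ : WF ∅
    wf-▸ : WF Γ → Γ ⊢ A ∶ U i → WF (Γ ▸ A)

  wf-tail : WF (Γ ▸ A) → WF Γ
  wf-tail (wf-▸ w _) = w

  wf⇒ctx : WF Γ → Γ ctx
  wf⇒ctx wf-∅       = ctx-∅
  wf⇒ctx (wf-▸ w d) = ctx-▸ d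

  -- Nearly every rule has a premise over the context of its conclusion, which is followed down to a
  -- context derivation. Only `lam-∶` and `lam-cong` have none; there the last entry is dropped from
  -- the `WF` of the extended context, which is possible because `WF` stores its initial segments.
  ctx⇒wf : Γ ctx → WF Γ
  ⊢⇒wf   : Γ ⊢ J → WF Γ
  ctx⇒wf ctx-∅     = wf-∅
  ctx⇒wf (ctx-▸ d) = wf-▸ (⊢⇒wf d) d
  ⊢⇒wf (var-∶ γ _) = ctx⇒wf γ
  ⊢⇒wf (≐-refl d) = ⊢⇒wf d
  ⊢⇒wf (≐-sym d) = ⊢⇒wf d
  ⊢⇒wf (≐-trans d _) = ⊢⇒wf d
  ⊢⇒wf (conv d _) = ⊢⇒wf d
  ⊢⇒wf (conv-≐ d _) = ⊢⇒wf d
  ⊢⇒wf (sub-∶ _ γ _) = ctx⇒wf γ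
  ⊢⇒wf (sub-≐ _ γ _ _) = ctx⇒wf γ
  ⊢⇒wf (U-form γ) = ctx⇒wf γ
  ⊢⇒wf (cumul d) = ⊢⇒wf d
  ⊢⇒wf (cumul-≐ d) = ⊢⇒wf d
  ⊢⇒wf (Π-form d _) = ⊢⇒wf d
  ⊢⇒wf (Π-cong d _) = ⊢⇒wf d
  ⊢⇒wf (lam-∶ d) = wf-tail (⊢⇒wf d)
  ⊢⇒wf (lam-cong d) = wf-tail (⊢⇒wf d)
  ⊢⇒wf (app-∶ d _) = ⊢⇒wf d
  ⊢⇒wf (app-cong d _) = ⊢⇒wf d
  ⊢⇒wf (Π-β _ d) = ⊢⇒wf d
  ⊢⇒wf (Π-η d) = ⊢⇒wf d
  ⊢⇒wf (Σ-form d _) = ⊢⇒wf d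
  ⊢⇒wf (Σ-cong d _) = ⊢⇒wf d
  ⊢⇒wf (pair-∶ _ d _) = ⊢⇒wf d
  ⊢⇒wf (pair-cong _ d _) = ⊢⇒wf d
  ⊢⇒wf (indΣ-∶ _ d _) = ⊢⇒wf d
  ⊢⇒wf (indΣ-cong _ d _) = ⊢⇒wf d
  ⊢⇒wf (Σ-β _ d _ _) = ⊢⇒wf d
  ⊢⇒wf (𝟎-form γ) = ctx⇒wf γ
  ⊢⇒wf (ind𝟎-∶ _ d) = ⊢⇒wf d
  ⊢⇒wf (ind𝟎-cong _ d) = ⊢⇒wf d
  ⊢⇒wf (𝟏-form γ) = ctx⇒wf γ
  ⊢⇒wf (⋆-∶ γ) = ctx⇒wf γ
  ⊢⇒wf (ind𝟏-∶ _ d _) = ⊢⇒wf d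
  ⊢⇒wf (ind𝟏-cong _ d _) = ⊢⇒wf d
  ⊢⇒wf (𝟏-β _ d) = ⊢⇒wf d
  ⊢⇒wf (Nat-form γ) = ctx⇒wf γ
  ⊢⇒wf (zero-∶ γ) = ctx⇒wf γ
  ⊢⇒wf (succ-∶ d) = ⊢⇒wf d
  ⊢⇒wf (succ-cong d) = ⊢⇒wf d
  ⊢⇒wf (indNat-∶ _ d _ _) = ⊢⇒wf d
  ⊢⇒wf (indNat-cong _ d _ _) = ⊢⇒wf d
  ⊢⇒wf (Nat-βzero _ d _) = ⊢⇒wf d
  ⊢⇒wf (Nat-βsucc _ d _ _) = ⊢⇒wf d
  ⊢⇒wf (+-form d _) = ⊢⇒wf d
  ⊢⇒wf (+-cong d _) = ⊢⇒wf d
  ⊢⇒wf (inl-∶ d _ _) = ⊢⇒wf d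
  ⊢⇒wf (inl-cong d _ _) = ⊢⇒wf d
  ⊢⇒wf (inr-∶ d _ _) = ⊢⇒wf d
  ⊢⇒wf (inr-cong d _ _) = ⊢⇒wf d
  ⊢⇒wf (ind+-∶ _ d _ _) = ⊢⇒wf d
  ⊢⇒wf (ind+-cong _ d _ _) = ⊢⇒wf d
  ⊢⇒wf (+-βinl _ d _ _) = ⊢⇒wf d
  ⊢⇒wf (+-βinr _ d _ _) = ⊢⇒wf d
  ⊢⇒wf (List-form d) = ⊢⇒wf d
  ⊢⇒wf (List-cong d) = ⊢⇒wf d
  ⊢⇒wf (nil-∶ d) = ⊢⇒wf d
  ⊢⇒wf (cons-∶ d _) = ⊢⇒wf d
  ⊢⇒wf (cons-cong d _) = ⊢⇒wf d
  ⊢⇒wf (indList-∶ _ d _ _) = ⊢⇒wf d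
  ⊢⇒wf (indList-cong _ d _ _) = ⊢⇒wf d
  ⊢⇒wf (List-βnil _ d _) = ⊢⇒wf d
  ⊢⇒wf (List-βcons _ d _ _ _) = ⊢⇒wf d
  ⊢⇒wf (Id-form d _ _) = ⊢⇒wf d
  ⊢⇒wf (Id-cong d _ _) = ⊢⇒wf d
  ⊢⇒wf (refl-∶ d) = ⊢⇒wf d
  ⊢⇒wf (refl-cong d) = ⊢⇒wf d
  ⊢⇒wf (indId-∶ _ d _ _ _) = ⊢⇒wf d
  ⊢⇒wf (indId-cong _ d _ _ _) = ⊢⇒wf d
  ⊢⇒wf (Id-β _ d _) = ⊢⇒wf d
  ⊢⇒wf (∥∥-form d) = ⊢⇒wf d
  ⊢⇒wf (∥∥-cong d) = ⊢⇒wf d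
  ⊢⇒wf (∣∣-∶ d) = ⊢⇒wf d
  ⊢⇒wf (∣∣-cong d) = ⊢⇒wf d
  ⊢⇒wf (sq-∶ d) = ⊢⇒wf d
  ⊢⇒wf (sq-cong d) = ⊢⇒wf d
  ⊢⇒wf (ind∥∥-∶ d _ _ _) = ⊢⇒wf d
  ⊢⇒wf (ind∥∥-cong d _ _ _) = ⊢⇒wf d
  ⊢⇒wf (∥∥-β d _ _ _) = ⊢⇒wf d
  ⊢⇒wf (ua-∶ γ) = ctx⇒wf γ
  ⊢⇒wf (con-∶ _ _ γ) = ctx⇒wf γ
  ⊢⇒wf (eqn-≐ _ _ _ γ) = ctx⇒wf γ

  ⊢⇒ctx : Γ ⊢ J → Γ ctx
  ⊢⇒ctx d = wf⇒ctx (⊢⇒wf d)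

  head-type : Γ ▸ A ctx → ∃ λ i → Γ ⊢ A ∶ U i
  head-type (ctx-▸ d) = _ , d

  cast : A ≡ B → Γ ⊢ a ∶ A → Γ ⊢ a ∶ B
  cast refl d = d

  cast-≐ : A ≡ B → Γ ⊢ a ≐ b ∶ A → Γ ⊢ a ≐ b ∶ B
  cast-≐ refl d = d

  infix 4 _⊢_≈_∶_ _⊢ˢ_∶_ _⊢ˢ_≈_∶_ _⊢ʳ_∶_

  -- The calculus does not yield Γ ⊢ a ∶ A from Γ ⊢ a ≐ b ∶ A directly, hence
  -- the typing of the left-hand side is carried along.
  _⊢_≈_∶_ : Ctx n → Tm n → Tm n → Tm n → Set
  Γ ⊢ a ≈ b ∶ A = (Γ ⊢ a ∶ A) × (Γ ⊢ a ≐ b ∶ A)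

  ≈-refl : Γ ⊢ a ∶ A → Γ ⊢ a ≈ a ∶ A
  ≈-refl d = d , ≐-refl d

  cast-≈ : A ≡ B → Γ ⊢ a ≈ b ∶ A → Γ ⊢ a ≈ b ∶ B
  cast-≈ refl d = d

  conv-≈ : Γ ⊢ a ≈ b ∶ A → Γ ⊢ A ≐ B ∶ U i → Γ ⊢ a ≈ b ∶ B
  conv-≈ (d , e) q = conv d q , conv-≐ e q

  cumul-≈ : Γ ⊢ A ≈ B ∶ U i → Γ ⊢ A ≈ B ∶ U (suc i)
  cumul-≈ (d , e) = cumul d , cumul-≐ e

  _⊢ˢ_∶_ : Ctx m → Sub n m → Ctx n → Set
  Δ ⊢ˢ σ ∶ Γ = ∀ x → Δ ⊢ σ x ∶ sub σ (lookup Γ x)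

  _⊢ˢ_≈_∶_ : Ctx m → Sub n m → Sub n m → Ctx n → Set
  Δ ⊢ˢ σ ≈ σ′ ∶ Γ = ∀ x → Δ ⊢ σ x ≈ σ′ x ∶ sub σ (lookup Γ x)

  _⊢ʳ_∶_ : Ctx m → (Fin n → Fin m) → Ctx n → Set
  Δ ⊢ʳ ρ ∶ Γ = ∀ x → Δ ⊢ var (ρ x) ∶ ren ρ (lookup Γ x)

  sub-≈ : {Γ : Ctx n} {Δ : Ctx m} {σ σ′ : Sub n m} →
          Γ ⊢ a ≈ b ∶ A → Δ ctx → Δ ⊢ˢ σ ≈ σ′ ∶ Γ →
          Δ ⊢ sub σ a ≈ sub σ′ b ∶ sub σ A
  sub-≈ (d , e) δ s =
    sub-∶ d δ (λ x → proj₁ (s x)) , sub-≐ e δ (λ x → proj₁ (s x)) (λ x → proj₂ (s x))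

  ⊢ˢ-id : {Γ : Ctx n} → Γ ctx → Γ ⊢ˢ var ∶ Γ
  ⊢ˢ-id {Γ = Γ} γ x = cast (sym (sub-id (λ _ → refl) (lookup Γ x))) (var-∶ γ x)

  ⊢ˢ-▹ : {Γ : Ctx n} {Δ : Ctx m} {σ : Sub n m} →
         Δ ⊢ˢ σ ∶ Γ → Δ ⊢ a ∶ sub σ A → Δ ⊢ˢ σ ▹ a ∶ Γ ▸ A
  ⊢ˢ-▹ {A = A} s d zero    = cast (sym (sub-▹-wk A)) d
  ⊢ˢ-▹ {Γ = Γ} s d (suc x) = cast (sym (sub-▹-wk (lookup Γ x))) (s x)

  ≈ˢ-▹ : {Γ : Ctx n} {Δ : Ctx m} {σ σ′ : Sub n m} →
         Δ ⊢ˢ σ ≈ σ′ ∶ Γ → Δ ⊢ a ≈ a′ ∶ sub σ A → Δ ⊢ˢ σ ▹ a ≈ σ′ ▹ a′ ∶ Γ ▸ A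
  ≈ˢ-▹ {A = A} s d zero    = cast-≈ (sym (sub-▹-wk A)) d
  ≈ˢ-▹ {Γ = Γ} s d (suc x) = cast-≈ (sym (sub-▹-wk (lookup Γ x))) (s x)

  ren-∶ : {Γ : Ctx n} {Δ : Ctx m} {ρ : Fin n → Fin m} →
          Γ ⊢ a ∶ A → Δ ctx → Δ ⊢ʳ ρ ∶ Γ → Δ ⊢ ren ρ a ∶ ren ρ A
  ren-∶ {a = a} {A = A} {Γ = Γ} {Δ} {ρ} d δ r =
    subst₂ (λ b B → Δ ⊢ b ∶ B) (sym (as-sub a)) (sym (as-sub A))
      (sub-∶ d δ λ x → cast (as-sub (lookup Γ x)) (r x))
    where
    as-sub : (e : Tm _) → ren ρ e ≡ sub (λ x → var (ρ x)) e
    as-sub = ren-as-sub (λ _ → refl)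

  ⊢ʳ-wk : {Γ : Ctx n} → Γ ▸ D ctx → Γ ▸ D ⊢ʳ suc ∶ Γ
  ⊢ʳ-wk γ x = var-∶ γ (suc x)

  wk-∶ : Γ ⊢ D ∶ U i → Γ ⊢ a ∶ A → Γ ▸ D ⊢ wk a ∶ wk A
  wk-∶ D d = ren-∶ d (ctx-▸ D) (⊢ʳ-wk (ctx-▸ D))

  wk-as-sub : (e : Tm n) → wk e ≡ sub (λ x → var (suc x)) e
  wk-as-sub = ren-as-sub (λ _ → refl)

  ⊢ˢ-wk : {Γ : Ctx n} → Γ ⊢ D ∶ U i → Γ ▸ D ⊢ˢ (λ x → var (suc x)) ∶ Γ
  ⊢ˢ-wk {Γ = Γ} ⊢D x = cast (wk-as-sub (lookup Γ x)) (var-∶ (ctx-▸ ⊢D) (suc x))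

  wk-≐ : Γ ⊢ D ∶ U i → Γ ⊢ a ≐ b ∶ A → Γ ▸ D ⊢ wk a ≐ wk b ∶ wk A
  wk-≐ {Γ = Γ} {D} {a = a} {b} {A} ⊢D e =
    subst₂ (λ x y → Γ ▸ D ⊢ x ≐ y ∶ wk A) (sym (wk-as-sub a)) (sym (wk-as-sub b))
      (cast-≐ (sym (wk-as-sub A))
        (sub-≐ e (ctx-▸ ⊢D) (⊢ˢ-wk ⊢D) (λ x → ≐-refl (⊢ˢ-wk ⊢D x))))

  wk-≈ : Γ ⊢ D ∶ U i → Γ ⊢ a ≈ b ∶ A → Γ ▸ D ⊢ wk a ≈ wk b ∶ wk A
  wk-≈ ⊢D (d , e) = wk-∶ ⊢D d , wk-≐ ⊢D e

  -- `ρ′` is specified by its values instead of being `lift 1 ρ`: the renamings `lift 2 suc` and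
  -- `lift 1 (lift 1 suc)` agree pointwise but not definitionally, and iterating the lemma has to
  -- produce the former.
  ⊢ʳ-▸ : {Γ : Ctx n} {Δ : Ctx m} {ρ : Fin n → Fin m} {ρ′ : Fin (suc n) → Fin (suc m)} →
         Δ ⊢ʳ ρ ∶ Γ → (ρ′ zero ≡ zero) → (∀ x → ρ′ (suc x) ≡ suc (ρ x)) →
         Γ ⊢ A ∶ U i → Δ ctx → Δ ▸ ren ρ A ⊢ʳ ρ′ ∶ Γ ▸ A
  ⊢ʳ-▸ {A = A} {Γ = Γ} {Δ} {ρ} r z s d δ = λ where
      zero    → subst₂ (λ x B → _ ⊢ var x ∶ B) (sym z) (sym (wk-ren s A)) (var-∶ (ctx-▸ ⊢A′) zero)
      (suc x) → subst₂ (λ x B → _ ⊢ var x ∶ B) (sym (s x)) (sym (wk-ren s (lookup Γ x)))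
                  (wk-∶ ⊢A′ (r x))
    where
    ⊢A′ : Δ ⊢ ren ρ A ∶ U _
    ⊢A′ = ren-∶ d δ r

  -- Inserts `D` below the last entry of the context. `ind∨` weakens its branches in this way, to
  -- make room for the variable of the sum under the truncation.
  wk₁-∶ : Γ ⊢ D ∶ U i → Γ ▸ A ⊢ b ∶ B →
          Γ ▸ D ▸ wk A ⊢ ren (lift 1 suc) b ∶ ren (lift 1 suc) B
  wk₁-∶ ⊢D d =
    ren-∶ d (ctx-▸ (wk-∶ ⊢D ⊢A))
      (⊢ʳ-▸ (⊢ʳ-wk (ctx-▸ ⊢D)) refl (λ _ → refl) ⊢A (ctx-▸ ⊢D))
    where ⊢A = proj₂ (head-type (⊢⇒ctx d))

  wk₂-∶ : Γ ⊢ D ∶ U i → Γ ▸ A ▸ B ⊢ c ∶ C →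
          Γ ▸ D ▸ wk A ▸ ren (lift 1 suc) B ⊢ ren (lift 2 suc) c ∶ ren (lift 2 suc) C
  wk₂-∶ ⊢D d =
    ren-∶ d (ctx-▸ (wk₁-∶ ⊢D ⊢B))
      (⊢ʳ-▸ (⊢ʳ-▸ (⊢ʳ-wk (ctx-▸ ⊢D)) refl (λ _ → refl) ⊢A (ctx-▸ ⊢D))
            refl (λ _ → refl) ⊢B (ctx-▸ (wk-∶ ⊢D ⊢A)))
    where
    ⊢B = proj₂ (head-type (⊢⇒ctx d))
    ⊢A = proj₂ (head-type (⊢⇒ctx ⊢B))

  sub₁-∶ : Γ ▸ A ⊢ c ∶ C → Γ ⊢ a ∶ A → Γ ⊢ c [ a ] ∶ C [ a ]
  sub₁-∶ {A = A} d a =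
    sub-∶ d (⊢⇒ctx a) (⊢ˢ-▹ (⊢ˢ-id (⊢⇒ctx a)) (cast (sym (sub-id (λ _ → refl) A)) a))

  sub₂-∶ : Γ ▸ A ▸ B ⊢ c ∶ C → Γ ⊢ a ∶ A → Γ ⊢ b ∶ B [ a ] → Γ ⊢ c [ a ⨾ b ] ∶ C [ a ⨾ b ]
  sub₂-∶ {A = A} d a b =
    sub-∶ d (⊢⇒ctx a)
      (⊢ˢ-▹ (⊢ˢ-▹ (⊢ˢ-id (⊢⇒ctx a)) (cast (sym (sub-id (λ _ → refl) A)) a)) b)

  sub₃-∶ : Γ ▸ A ▸ B ▸ C ⊢ d ∶ D →
           Γ ⊢ a ∶ A → Γ ⊢ b ∶ B [ a ] → Γ ⊢ c ∶ C [ a ⨾ b ] →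
           Γ ⊢ sub (var ▹ a ▹ b ▹ c) d ∶ sub (var ▹ a ▹ b ▹ c) D
  sub₃-∶ {A = A} d a b c =
    sub-∶ d (⊢⇒ctx a)
      (⊢ˢ-▹ (⊢ˢ-▹ (⊢ˢ-▹ (⊢ˢ-id (⊢⇒ctx a)) (cast (sym (sub-id (λ _ → refl) A)) a)) b) c)

  -- The identity substitution can be typed from `Γ ▸ A′` to `Γ ▸ A`: only the last variable changes
  -- its type, and it is converted along the weakened equality.
  ctx-conv : Γ ▸ A ⊢ b ∶ B → Γ ⊢ A′ ∶ U i → Γ ⊢ A ≐ A′ ∶ U j → Γ ▸ A′ ⊢ b ∶ B
  ctx-conv {Γ = Γ} {A} {b} {B} {A′} d ⊢A′ q =
    subst₂ (λ x X → Γ ▸ A′ ⊢ x ∶ X) (sub-id (λ _ → refl) b) (sub-id (λ _ → refl) B)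
      (sub-∶ d γ s)
    where
    γ : Γ ▸ A′ ctx
    γ = ctx-▸ ⊢A′
    s : Γ ▸ A′ ⊢ˢ var ∶ Γ ▸ A
    s zero    = cast (sym (sub-id (λ _ → refl) (wk A)))
                  (conv (var-∶ γ zero) (≐-sym (wk-≐ ⊢A′ q)))
    s (suc x) = cast (sym (sub-id (λ _ → refl) (lookup (Γ ▸ A) (suc x)))) (var-∶ γ (suc x))

  -- The substitution that takes the right-hand sides is typed by conversion along
  -- the context, one variable after the other.
  ⊢ˢ-right : {Γ : Ctx n} {Δ : Ctx m} {σ σ′ : Sub n m} → WF Γ → Δ ctx →
             Δ ⊢ˢ σ ≈ σ′ ∶ Γ → (∀ x → Δ ⊢ σ′ x ∶ sub σ (lookup Γ x)) → Δ ⊢ˢ σ′ ∶ Γ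
  ⊢ˢ-right {σ = σ} {σ′} (wf-▸ {Γ = Γ} {A = A} w ⊢A) δ s r = λ where
      zero    → cast (sym (sub-ren (λ _ → refl) A))
                  (conv (cast (sub-ren (λ _ → refl) A) (r zero))
                    (proj₂ (sub-≈ (≈-refl ⊢A) δ s-tail)))
      (suc x) → cast (sym (sub-ren (λ _ → refl) (lookup Γ x)))
                  (⊢ˢ-right w δ s-tail (λ y → cast (sub-ren (λ _ → refl) (lookup Γ y)) (r (suc y))) x)
    where
    s-tail : _ ⊢ˢ (λ x → σ (suc x)) ≈ (λ x → σ′ (suc x)) ∶ Γ
    s-tail x = cast-≈ (sub-ren (λ _ → refl) (lookup Γ x)) (s (suc x))

  Π-≈ : Γ ⊢ A ≈ A′ ∶ U i → Γ ▸ A ⊢ B ≈ B′ ∶ U i → Γ ⊢ Π A B ≈ Π A′ B′ ∶ U i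
  Π-≈ (A , A≐) (B , B≐) = Π-form A B , Π-cong A≐ B≐

  Σ-≈ : Γ ⊢ A ≈ A′ ∶ U i → Γ ▸ A ⊢ B ≈ B′ ∶ U i → Γ ⊢ Σ A B ≈ Σ A′ B′ ∶ U i
  Σ-≈ (A , A≐) (B , B≐) = Σ-form A B , Σ-cong A≐ B≐

  +-≈ : Γ ⊢ A ≈ A′ ∶ U i → Γ ⊢ B ≈ B′ ∶ U i → Γ ⊢ A + B ≈ A′ + B′ ∶ U i
  +-≈ (A , A≐) (B , B≐) = +-form A B , +-cong A≐ B≐

  List-≈ : Γ ⊢ A ≈ A′ ∶ U i → Γ ⊢ List A ≈ List A′ ∶ U i
  List-≈ (A , A≐) = List-form A , List-cong A≐

  ∥∥-≈ : Γ ⊢ A ≈ A′ ∶ U i → Γ ⊢ ∥ A ∥ ≈ ∥ A′ ∥ ∶ U i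
  ∥∥-≈ (A , A≐) = ∥∥-form A , ∥∥-cong A≐

  Id-≈ : Γ ⊢ A ≈ A′ ∶ U i → Γ ⊢ a ≈ a′ ∶ A → Γ ⊢ b ≈ b′ ∶ A →
         Γ ⊢ Id A a b ≈ Id A′ a′ b′ ∶ U i
  Id-≈ (A , A≐) (a , a≐) (b , b≐) = Id-form A a b , Id-cong A≐ a≐ b≐

  lam-≈ : Γ ▸ A ⊢ b ≈ b′ ∶ B → Γ ⊢ lam b ≈ lam b′ ∶ Π A B
  lam-≈ (b , b≐) = lam-∶ b , lam-cong b≐

  ⟶-≈ : Γ ⊢ A ≈ A′ ∶ U i → Γ ⊢ B ≈ B′ ∶ U i → Γ ⊢ A ⟶ B ≈ A′ ⟶ B′ ∶ U i
  ⟶-≈ A B = Π-≈ A (wk-≈ (proj₁ A) B)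

  ⊗-≈ : Γ ⊢ A ≈ A′ ∶ U i → Γ ⊢ B ≈ B′ ∶ U i → Γ ⊢ A ⊗ B ≈ A′ ⊗ B′ ∶ U i
  ⊗-≈ A B = Σ-≈ A (wk-≈ (proj₁ A) B)

  ∅ˢ : Sub 0 n
  ∅ˢ ()

  -- `isProp A` is, by computation, the generic `isProp #0` instantiated at `A`. One fusion of
  -- substitutions thus replaces commuting `σ` with each weakening inside the formula.
  isProp-sub : {σ : Sub n m} (A : Tm n) → sub σ (isProp A) ≡ isProp (sub σ A)
  isProp-sub {σ = σ} A =
    sub-sub {σ = σ} {σ′ = ∅ˢ ▹ A} {τ = ∅ˢ ▹ sub σ A} (λ { zero → refl }) (isProp #0)

  isSet-sub : {σ : Sub n m} (A : Tm n) → sub σ (isSet A) ≡ isSet (sub σ A)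
  isSet-sub {σ = σ} A =
    sub-sub {σ = σ} {σ′ = ∅ˢ ▹ A} {τ = ∅ˢ ▹ sub σ A} (λ { zero → refl }) (isSet #0)

  -- The formula is typed once, over the context `∅ ▸ U i`; congruence is then replacement of equals
  -- for its single variable.
  isProp-≈ : Γ ⊢ A ≈ A′ ∶ U i → Γ ⊢ isProp A ≈ isProp A′ ∶ U i
  isProp-≈ {i = i} A =
    sub-≈ {Γ = ∅ ▸ U i} (≈-refl generic) (⊢⇒ctx (proj₁ A)) (≈ˢ-▹ {σ = ∅ˢ} {∅ˢ} (λ ()) A)
    where
    A₀ : ∅ ▸ U i ctx
    A₀ = ctx-▸ (U-form ctx-∅)
    A₁ : ∅ ▸ U i ▸ #0 ctx
    A₁ = ctx-▸ (var-∶ A₀ zero)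
    A₂ : ∅ ▸ U i ▸ #0 ▸ #1 ctx
    A₂ = ctx-▸ (var-∶ A₁ (suc zero))
    generic : ∅ ▸ U i ⊢ isProp #0 ∶ U i
    generic =
      Π-form (var-∶ A₀ zero) (Π-form (var-∶ A₁ (suc zero))
        (Id-form (var-∶ A₂ (suc (suc zero))) (var-∶ A₂ (suc zero)) (var-∶ A₂ zero)))

  isSet-≈ : Γ ⊢ A ≈ A′ ∶ U i → Γ ⊢ isSet A ≈ isSet A′ ∶ U i
  isSet-≈ {i = i} A =
    sub-≈ {Γ = ∅ ▸ U i} (≈-refl generic) (⊢⇒ctx (proj₁ A)) (≈ˢ-▹ {σ = ∅ˢ} {∅ˢ} (λ ()) A)
    where
    A₀ : ∅ ▸ U i ctx
    A₀ = ctx-▸ (U-form ctx-∅)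
    A₁ : ∅ ▸ U i ▸ #0 ctx
    A₁ = ctx-▸ (var-∶ A₀ zero)
    A₂ : ∅ ▸ U i ▸ #0 ▸ #1 ctx
    A₂ = ctx-▸ (var-∶ A₁ (suc zero))
    I₂ : ∅ ▸ U i ▸ #0 ▸ #1 ⊢ Id #2 #1 #0 ∶ U i
    I₂ = Id-form (var-∶ A₂ (suc (suc zero))) (var-∶ A₂ (suc zero)) (var-∶ A₂ zero)
    A₃ : ∅ ▸ U i ▸ #0 ▸ #1 ▸ Id #2 #1 #0 ctx
    A₃ = ctx-▸ I₂
    I₃ : ∅ ▸ U i ▸ #0 ▸ #1 ▸ Id #2 #1 #0 ⊢ Id #3 #2 #1 ∶ U i
    I₃ = Id-form (var-∶ A₃ (suc (suc (suc zero)))) (var-∶ A₃ (suc (suc zero))) (var-∶ A₃ (suc zero))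
    A₄ : ∅ ▸ U i ▸ #0 ▸ #1 ▸ Id #2 #1 #0 ▸ Id #3 #2 #1 ctx
    A₄ = ctx-▸ I₃
    generic : ∅ ▸ U i ⊢ isSet #0 ∶ U i
    generic =
      Π-form (var-∶ A₀ zero) (Π-form (var-∶ A₁ (suc zero)) (Π-form I₂ (Π-form I₃
        (Id-form (Id-form (var-∶ A₄ (suc (suc (suc (suc zero))))) (var-∶ A₄ (suc (suc (suc zero))))
                          (var-∶ A₄ (suc (suc zero))))
                 (var-∶ A₄ (suc zero)) (var-∶ A₄ zero)))))

  wk-#0 : (B : Tm (suc n)) → ren (lift 1 suc) B [ #0 ] ≡ B
  wk-#0 B = trans (sub-ren {τ = var} (λ { zero → refl ; (suc x) → refl }) B) (sub-id (λ _ → refl) B)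

  lam-wk-β : Γ ▸ A ⊢ b ∶ B → Γ ▸ A ⊢ wk (lam b) · #0 ≐ b ∶ B
  lam-wk-β {b = b} {B = B} d =
    subst₂ (λ x X → _ ⊢ wk (lam b) · #0 ≐ x ∶ X) (wk-#0 b) (wk-#0 B)
      (Π-β (wk₁-∶ (proj₂ (head-type (⊢⇒ctx d))) d) (var-∶ (⊢⇒ctx d) zero))

  -- A closed proof term partially applied: `σ` lists the left-hand arguments supplied so far, and
  -- `A` is what remains of its closed type. Both are parameters because `sub σ A` computes and
  -- would not let them be inferred; each further argument then merely extends `σ`.
  record Spine (Γ : Ctx n) (f f′ : Tm n) {k : ℕ} (σ : Sub k n) (A : Tm k) : Set where
    constructor spine
    field typed : Γ ⊢ f ≈ f′ ∶ sub σ A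

  open Spine public

  closed : {c : Tm 0} {C : Tm 0} → Γ ctx → ∅ ⊢ c ∶ C → Spine Γ ⌜ c ⌝ ⌜ c ⌝ ∅ˢ C
  closed {Γ = Γ} {c} {C} γ d = spine (≈-refl
    (subst (λ x → Γ ⊢ x ∶ sub ∅ˢ C) (sym (ren-as-sub {σ = ∅ˢ} (λ ()) c)) (sub-∶ d γ (λ ()))))

  infixl 7 _∙_

  _∙_ : ∀ {k} {σ : Sub k n} {A : Tm k} {B : Tm (suc k)} →
        Spine Γ f f′ σ (Π A B) → Γ ⊢ a ≈ a′ ∶ sub σ A →
        Spine Γ (f · a) (f′ · a′) (σ ▹ a) B
  _∙_ {B = B} (spine (f , f≐)) (a , a≐) =
    spine (cast (lift-[] B) (app-∶ f a) , cast-≐ (lift-[] B) (app-cong f≐ a≐))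

-- Derived rules for projections, disjunction, existence and transport.

module DerivedRules (H : HITs) where

  open HoTT H renaming (_×_ to _⊗_; refl to reflᵗ; subst to sub-∶; subst-≐ to sub-≐)
  open SyntaxProperties tt tt Op
  open Admissible H

  private variable
    n i j             : ℕ
    Γ                 : Ctx n
    A A′ B B′ C       : Tm n
    a a′ b b′ c d e e′ p s : Tm n

  wk-↑ : ∀ k {a : Tm (k ℕ.+ n)} (C : Tm n) → wk C ↑ k [ a ] ≡ ren (k ↑ʳ_) C
  wk-↑ k C = trans (sub-▹-wk C) (sym (ren-as-sub (λ _ → refl) C))

  wk-↑₁ : {a : Tm (suc n)} (C : Tm n) → wk C ↑ 1 [ a ] ≡ wk C
  wk-↑₁ C = wk-↑ 1 C

  wk-↑₂ : {a : Tm (suc (suc n))} (C : Tm n) → wk C ↑ 2 [ a ] ≡ wk (wk C)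
  wk-↑₂ C = trans (wk-↑ 2 C) (sym (ren-ren (λ _ → refl) C))

  #1-∶ : Γ ▸ A ⊢ B ∶ U i → Γ ▸ A ▸ B ⊢ #1 ∶ wk (wk A)
  #1-∶ ⊢B = var-∶ (ctx-▸ ⊢B) (suc zero)

  pr₁-branch : Γ ▸ A ⊢ B ∶ U i → Γ ▸ A ▸ B ⊢ #1 ∶ wk A ↑ 2 [ pair #1 #0 ]
  pr₁-branch {A = A} ⊢B = cast (sym (wk-↑₂ A)) (#1-∶ ⊢B)

  pr₁-≈ : Γ ⊢ A ∶ U i → Γ ▸ A ⊢ B ∶ U i →
          Γ ⊢ e ≈ e′ ∶ Σ A B → Γ ⊢ pr₁ e ≈ pr₁ e′ ∶ A
  pr₁-≈ {A = A} ⊢A ⊢B (e , e≐) =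
    let motive = wk-∶ (Σ-form ⊢A ⊢B) ⊢A in
    cast-≈ (wk-[] A)
      (indΣ-∶ motive e (pr₁-branch ⊢B) , indΣ-cong motive e≐ (≐-refl (pr₁-branch ⊢B)))

  pr₁-β : Γ ⊢ A ∶ U i → Γ ▸ A ⊢ B ∶ U i →
          Γ ⊢ a ∶ A → Γ ⊢ b ∶ B [ a ] → Γ ⊢ pr₁ (pair a b) ≈ a ∶ A
  pr₁-β {A = A} ⊢A ⊢B a b =
    proj₁ (pr₁-≈ ⊢A ⊢B (≈-refl (pair-∶ ⊢B a b))) ,
    cast-≐ (wk-[] A) (Σ-β (wk-∶ (Σ-form ⊢A ⊢B) ⊢A) a b (pr₁-branch ⊢B))

  pr₂-motive : Tm (suc n) → Tm (suc n)
  pr₂-motive B = sub ((λ x → var (suc x)) ▹ pr₁ #0) B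

  pr₂-motive-∶ : Γ ⊢ A ∶ U i → Γ ▸ A ⊢ B ∶ U i → Γ ▸ Σ A B ⊢ pr₂-motive B ∶ U i
  pr₂-motive-∶ {A = A} ⊢A ⊢B =
    let ΣAB = Σ-form ⊢A ⊢B in
    sub-∶ ⊢B (ctx-▸ ΣAB)
      (⊢ˢ-▹ (⊢ˢ-wk ΣAB)
        (cast (wk-as-sub A)
          (proj₁ (pr₁-≈ (wk-∶ ΣAB ⊢A) (wk₁-∶ ΣAB ⊢B) (≈-refl (var-∶ (ctx-▸ ΣAB) zero))))))

  pr₂-motive-[] : (B : Tm (suc n)) → pr₂-motive B [ e ] ≡ B [ pr₁ e ]
  pr₂-motive-[] B = sub-sub (λ { zero → refl ; (suc x) → refl }) B

  -- The variable `#0` has type `B` at `#1`, but the motive asks for `B` at `pr₁ (pair #1 #0)`. The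
  -- β-rule of `pr₁`, substituted into `B`, converts the one into the other.
  pr₂-branch : Γ ⊢ A ∶ U i → Γ ▸ A ⊢ B ∶ U i →
               Γ ▸ A ▸ B ⊢ #0 ∶ pr₂-motive B ↑ 2 [ pair #1 #0 ]
  pr₂-branch {Γ = Γ} {A = A} {B = B} ⊢A ⊢B =
    cast (sym (sub-sub (λ { zero → refl ; (suc x) → refl }) B))
      (conv (cast B-#1 #0-∶) (≐-sym (proj₂ (sub-≈ (≈-refl ⊢B) (ctx-▸ ⊢B) β))))
    where
    #0-∶ : Γ ▸ A ▸ B ⊢ #0 ∶ wk B
    #0-∶ = var-∶ (ctx-▸ ⊢B) zero
    B-#1 : wk B ≡ sub ((λ x → var (suc (suc x))) ▹ #1) B
    B-#1 = ren-as-sub (λ { zero → refl ; (suc x) → refl }) B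
    wk²-A : wk (wk A) ≡ sub (λ x → var (suc (suc x))) A
    wk²-A = trans (ren-ren (λ _ → refl) A) (ren-as-sub (λ _ → refl) A)
    wk²ˢ : Γ ▸ A ▸ B ⊢ˢ (λ x → var (suc (suc x))) ≈ (λ x → var (suc (suc x))) ∶ Γ
    wk²ˢ x = ≈-refl (cast (trans (ren-ren (λ _ → refl) (lookup Γ x))
                                 (ren-as-sub (λ _ → refl) (lookup Γ x)))
                          (var-∶ (ctx-▸ ⊢B) (suc (suc x))))
    -- The family of the `Σ` moved into this context, taken at the first component `#1`, is `wk B`;
    -- so `#0` is admissible as second component.
    wk²-B-[] : ren (lift 1 suc) (ren (lift 1 suc) B) [ #1 ] ≡ wk B
    wk²-B-[] = trans (sub-ren {τ = #1-for-#0} (λ { zero → refl ; (suc x) → refl })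
                       (ren (lift 1 suc) B))
                     (trans (sub-ren (λ { zero → refl ; (suc x) → refl }) B) (sym B-#1))
      where
      #1-for-#0 : Sub _ _
      #1-for-#0 = (λ x → var (suc x)) ▹ #1
    β : Γ ▸ A ▸ B ⊢ˢ (λ x → var (suc (suc x))) ▹ pr₁ (pair #1 #0)
                   ≈ (λ x → var (suc (suc x))) ▹ #1 ∶ Γ ▸ A
    β = ≈ˢ-▹ wk²ˢ (cast-≈ wk²-A
          (pr₁-β (wk-∶ ⊢B (wk-∶ ⊢A ⊢A)) (wk₁-∶ ⊢B (wk₁-∶ ⊢A ⊢B)) (#1-∶ ⊢B)
                 (cast (sym wk²-B-[]) #0-∶)))

  pr₂-≈ : Γ ⊢ A ∶ U i → Γ ▸ A ⊢ B ∶ U i →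
          Γ ⊢ e ≈ e′ ∶ Σ A B → Γ ⊢ pr₂ e ≈ pr₂ e′ ∶ B [ pr₁ e ]
  pr₂-≈ {B = B} ⊢A ⊢B (e , e≐) =
    let motive = pr₂-motive-∶ ⊢A ⊢B ; branch = pr₂-branch ⊢A ⊢B in
    cast-≈ (pr₂-motive-[] B) (indΣ-∶ motive e branch , indΣ-cong motive e≐ (≐-refl branch))

  pr₂-β : Γ ⊢ A ∶ U i → Γ ▸ A ⊢ B ∶ U i → Γ ⊢ a ∶ A → Γ ⊢ b ∶ B [ a ] →
          Γ ⊢ pr₂ (pair a b) ≈ b ∶ B [ pr₁ (pair a b) ]
  pr₂-β {B = B} ⊢A ⊢B a b =
    proj₁ (pr₂-≈ ⊢A ⊢B (≈-refl (pair-∶ ⊢B a b))) ,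
    cast-≐ (pr₂-motive-[] B) (Σ-β (pr₂-motive-∶ ⊢A ⊢B) a b (pr₂-branch ⊢A ⊢B))

  ind∨-branches-∶ : Γ ⊢ A ∶ U i → Γ ⊢ B ∶ U i → Γ ⊢ C ∶ U j →
                    Γ ▸ A ⊢ c ∶ wk C → Γ ▸ B ⊢ d ∶ wk C →
                    Γ ▸ A + B ⊢ ind+ #0 (ren (lift 1 suc) c) (ren (lift 1 suc) d) ∶ wk C
  ind∨-branches-∶ {A = A} {B = B} {C = C} ⊢A ⊢B ⊢C c d =
    let ⊢A+B = +-form ⊢A ⊢B in
    cast (wk-[] (wk C))
      (ind+-∶ (wk-∶ (wk-∶ ⊢A+B ⊢A+B) (wk-∶ ⊢A+B ⊢C)) (var-∶ (ctx-▸ ⊢A+B) zero)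
        (cast under (wk₁-∶ ⊢A+B c)) (cast under (wk₁-∶ ⊢A+B d)))
    where
    under : {a : Tm _} → ren (lift 1 suc) (wk C) ≡ wk (wk C) ↑ 1 [ a ]
    under = trans (wk-ren (λ _ → refl) C) (sym (wk-↑₁ (wk C)))

  ind∨-∶ : Γ ⊢ A ∶ U i → Γ ⊢ B ∶ U i → Γ ⊢ C ∶ U j → Γ ⊢ e ∶ A ∨ B →
           Γ ▸ A ⊢ c ∶ wk C → Γ ▸ B ⊢ d ∶ wk C → Γ ⊢ s ∶ isProp C →
           Γ ⊢ ind∨ e c d s ∶ C
  ind∨-∶ ⊢A ⊢B ⊢C e c d s = ind∥∥-∶ ⊢C e (ind∨-branches-∶ ⊢A ⊢B ⊢C c d) s

  -- In `ind∨` the truncation computes first and substitutes for the variable of the sum. The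
  -- branches were weakened past that variable, so they come back unchanged and the β-rule of the
  -- sum applies to the original ones.
  sub-under-▹ : {a : Tm n} (c : Tm (suc n)) →
                sub (liftˢ 1 (var ▹ a)) (ren (lift 1 suc) c) ≡ c
  sub-under-▹ c =
    trans (sub-ren {τ = var} (λ { zero → refl ; (suc x) → refl }) c) (sub-id (λ _ → refl) c)

  ind∨-βinl : Γ ⊢ A ∶ U i → Γ ⊢ B ∶ U i → Γ ⊢ C ∶ U j → Γ ⊢ a ∶ A →
              Γ ▸ A ⊢ c ∶ wk C → Γ ▸ B ⊢ d ∶ wk C → Γ ⊢ s ∶ isProp C →
              Γ ⊢ ind∨ (inl∨ a) c d s ≈ c [ a ] ∶ C
  ind∨-βinl {Γ = Γ} {A = A} {B = B} {C = C} {a = a} {c} {d} ⊢A ⊢B ⊢C a-∶ c-∶ d-∶ s =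
    ind∨-∶ ⊢A ⊢B ⊢C (∣∣-∶ inl-a) c-∶ d-∶ s ,
    ≐-trans (∥∥-β ⊢C inl-a (ind∨-branches-∶ ⊢A ⊢B ⊢C c-∶ d-∶) s)
      (subst₂ (λ x y → Γ ⊢ ind+ (inl a) x y ≐ c [ a ] ∶ C)
        (sym (sub-under-▹ c)) (sym (sub-under-▹ d))
        (cast-≐ (wk-[] C)
          (+-βinl (wk-∶ (+-form ⊢A ⊢B) ⊢C) a-∶
            (cast (sym (wk-↑₁ C)) c-∶) (cast (sym (wk-↑₁ C)) d-∶))))
    where
    inl-a : Γ ⊢ inl a ∶ A + B
    inl-a = inl-∶ ⊢A ⊢B a-∶

  ind∨-βinr : Γ ⊢ A ∶ U i → Γ ⊢ B ∶ U i → Γ ⊢ C ∶ U j → Γ ⊢ b ∶ B →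
              Γ ▸ A ⊢ c ∶ wk C → Γ ▸ B ⊢ d ∶ wk C → Γ ⊢ s ∶ isProp C →
              Γ ⊢ ind∨ (inr∨ b) c d s ≈ d [ b ] ∶ C
  ind∨-βinr {Γ = Γ} {A = A} {B = B} {C = C} {b = b} {c} {d} ⊢A ⊢B ⊢C b-∶ c-∶ d-∶ s =
    ind∨-∶ ⊢A ⊢B ⊢C (∣∣-∶ inr-b) c-∶ d-∶ s ,
    ≐-trans (∥∥-β ⊢C inr-b (ind∨-branches-∶ ⊢A ⊢B ⊢C c-∶ d-∶) s)
      (subst₂ (λ x y → Γ ⊢ ind+ (inr b) x y ≐ d [ b ] ∶ C)
        (sym (sub-under-▹ c)) (sym (sub-under-▹ d))
        (cast-≐ (wk-[] C)
          (+-βinr (wk-∶ (+-form ⊢A ⊢B) ⊢C) b-∶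
            (cast (sym (wk-↑₁ C)) c-∶) (cast (sym (wk-↑₁ C)) d-∶))))
    where
    inr-b : Γ ⊢ inr b ∶ A + B
    inr-b = inr-∶ ⊢A ⊢B b-∶

  ind∃-branch-∶ : Γ ⊢ A ∶ U i → Γ ▸ A ⊢ B ∶ U i → Γ ⊢ C ∶ U j →
                  Γ ▸ A ▸ B ⊢ c ∶ wk (wk C) →
                  Γ ▸ Σ A B ⊢ indΣ #0 (ren (lift 2 suc) c) ∶ wk C
  ind∃-branch-∶ {C = C} ⊢A ⊢B ⊢C c =
    let ΣAB = Σ-form ⊢A ⊢B in
    cast (wk-[] (wk C))
      (indΣ-∶ (wk-∶ (wk-∶ ΣAB ΣAB) (wk-∶ ΣAB ⊢C)) (var-∶ (ctx-▸ ΣAB) zero)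
        (cast under (wk₂-∶ ΣAB c)))
    where
    under : {a : Tm _} → ren (lift 2 suc) (wk (wk C)) ≡ wk (wk C) ↑ 2 [ a ]
    under = trans (wk-ren (λ _ → refl) (wk C))
              (trans (cong wk (wk-ren {ρ′ = lift 1 suc} (λ _ → refl) C)) (sym (wk-↑₂ (wk C))))

  ind∃-∶ : Γ ⊢ A ∶ U i → Γ ▸ A ⊢ B ∶ U i → Γ ⊢ C ∶ U j → Γ ⊢ e ∶ Exists A B →
           Γ ▸ A ▸ B ⊢ c ∶ wk (wk C) → Γ ⊢ s ∶ isProp C → Γ ⊢ ind∃ e c s ∶ C
  ind∃-∶ ⊢A ⊢B ⊢C e c s = ind∥∥-∶ ⊢C e (ind∃-branch-∶ ⊢A ⊢B ⊢C c) s

  ind∃-β : Γ ⊢ A ∶ U i → Γ ▸ A ⊢ B ∶ U i → Γ ⊢ C ∶ U j → Γ ⊢ a ∶ A → Γ ⊢ b ∶ B [ a ] →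
           Γ ▸ A ▸ B ⊢ c ∶ wk (wk C) → Γ ⊢ s ∶ isProp C →
           Γ ⊢ ind∃ (pair∃ a b) c s ≈ c [ a ⨾ b ] ∶ C
  ind∃-β {Γ = Γ} {A = A} {B = B} {C = C} {a = a} {b} {c} ⊢A ⊢B ⊢C a-∶ b-∶ c-∶ s =
    ind∃-∶ ⊢A ⊢B ⊢C (∣∣-∶ a,b) c-∶ s ,
    ≐-trans (∥∥-β ⊢C a,b (ind∃-branch-∶ ⊢A ⊢B ⊢C c-∶) s)
      (subst (λ x → Γ ⊢ indΣ (pair a b) x ≐ c [ a ⨾ b ] ∶ C) (sym under)
        (cast-≐ (wk-[] C)
          (Σ-β (wk-∶ (Σ-form ⊢A ⊢B) ⊢C) a-∶ b-∶ (cast (sym (wk-↑₂ C)) c-∶))))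
    where
    a,b : Γ ⊢ pair a b ∶ Σ A B
    a,b = pair-∶ ⊢B a-∶ b-∶
    under : sub (liftˢ 2 (var ▹ pair a b)) (ren (lift 2 suc) c) ≡ c
    under = trans (sub-ren {τ = var} (λ { zero → refl ; (suc zero) → refl ; (suc (suc x)) → refl }) c)
                  (sub-id (λ _ → refl) c)

  ⊢Id-#1-#0 : Γ ⊢ A ∶ U i → Γ ▸ A ▸ wk A ⊢ Id (wk (wk A)) #1 #0 ∶ U i
  ⊢Id-#1-#0 ⊢A =
    let γ = ctx-▸ (wk-∶ ⊢A ⊢A) in
    Id-form (wk-∶ (wk-∶ ⊢A ⊢A) (wk-∶ ⊢A ⊢A)) (var-∶ γ (suc zero)) (var-∶ γ zero)

  diagonal : Tm (suc (suc n)) → Tm (suc n)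
  diagonal = sub ((λ x → var (suc x)) ▹ #0 ▹ #0)

  -- Path induction with a motive that does not depend on the path.
  transport-∶ : Γ ⊢ A ∶ U i → Γ ▸ A ▸ wk A ⊢ C ∶ U j →
                Γ ⊢ a ∶ A → Γ ⊢ b ∶ A → Γ ⊢ p ∶ Id A a b → Γ ▸ A ⊢ c ∶ diagonal C →
                Γ ⊢ indId p c ∶ C [ a ⨾ b ]
  transport-∶ {C = C} ⊢A ⊢C a b p c =
    cast (sub-▹-wk C)
      (indId-∶ (wk-∶ (⊢Id-#1-#0 ⊢A) ⊢C) a b p (cast (sym (sub-▹-wk C)) c))

  transport-β : Γ ⊢ A ∶ U i → Γ ▸ A ▸ wk A ⊢ C ∶ U j → Γ ⊢ a ∶ A → Γ ▸ A ⊢ c ∶ diagonal C →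
                Γ ⊢ indId (reflᵗ a) c ≈ c [ a ] ∶ C [ a ⨾ a ]
  transport-β {C = C} ⊢A ⊢C a c =
    transport-∶ ⊢A ⊢C a a (refl-∶ a) c ,
    cast-≐ (sub-▹-wk C)
      (Id-β (wk-∶ (⊢Id-#1-#0 ⊢A) ⊢C) a (cast (sym (sub-▹-wk C)) c))

-- The interpretation made total by giving prP a junk value on the type formers
-- that are not propositional.  The equations for renaming and substitution then
-- hold for all raw expressions.

module TotalInterpretation (H : HITs) (𝔠 : ProofTerms H) where

  open HoTT H renaming (_×_ to _⊗_; refl to reflᵗ; subst to sub-∶; subst-≐ to sub-≐)
  open ProofTerms 𝔠
  open SyntaxProperties tt tt Op
  private module M = MTT

  private variable
    s   : M.Sort
    ar  : List.List (ℕ × M.Sort)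
    m n : ℕ

  -- An argument of sort ty is interpreted by A•, prP(A•) and prS(A•).
  arity : List.List (ℕ × M.Sort) → List.List (ℕ × ⊤)
  arity []                = []
  arity ((k , M.ty) ∷ ar) = (k , tt) ∷ (k , tt) ∷ (k , tt) ∷ arity ar
  arity ((k , M.tm) ∷ ar) = (k , tt) ∷ arity ar

  -- The action of each operator is kept apart from the recursion over expressions, as a function of
  -- arbitrary HoTT arguments. Naturality under substitution can then be checked operator by
  -- operator, without induction.
  valᵒ : M.Op s ar → Args (arity ar) n → Tm n
  valᵒ M.N₀ᵒ      []                              = 𝟎
  valᵒ M.N₁ᵒ      []                              = 𝟏
  valᵒ M.Listᵒ    (A ∷ _ ∷ _ ∷ [])                = List A
  valᵒ M.+ᵒ       (A ∷ _ ∷ _ ∷ B ∷ _ ∷ _ ∷ [])    = A + B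
  valᵒ M.Σᵒ       (A ∷ _ ∷ _ ∷ B ∷ _ ∷ _ ∷ [])    = Σ A B
  valᵒ M.Πᵒ       (A ∷ _ ∷ _ ∷ B ∷ _ ∷ _ ∷ [])    = Π A B
  valᵒ M.Propₛᵒ   []                              = PropU 0
  valᵒ M.→Propₛᵒ  (A ∷ _ ∷ _ ∷ [])                = A ⟶ PropU 0
  valᵒ M.⊥ᵒ       []                              = 𝟎
  valᵒ M.∨ᵒ       (A ∷ _ ∷ _ ∷ B ∷ _ ∷ _ ∷ [])    = A ∨ B
  valᵒ M.∧ᵒ       (A ∷ _ ∷ _ ∷ B ∷ _ ∷ _ ∷ [])    = A ⊗ B
  valᵒ M.⇒ᵒ       (A ∷ _ ∷ _ ∷ B ∷ _ ∷ _ ∷ [])    = A ⟶ B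
  valᵒ M.∃ᵒ       (A ∷ _ ∷ _ ∷ B ∷ _ ∷ _ ∷ [])    = Exists A B
  valᵒ M.∀ᵒ       (A ∷ _ ∷ _ ∷ B ∷ _ ∷ _ ∷ [])    = Π A B
  valᵒ M.Idᵒ      (A ∷ _ ∷ _ ∷ a ∷ b ∷ [])        = Id A a b
  valᵒ M.τᵒ       (p ∷ [])                        = pr₁ p
  valᵒ M.emp₀ᵒ    (e ∷ [])                        = ind𝟎 e
  valᵒ M.⋆ᵒ       []                              = ⋆
  valᵒ M.elN₁ᵒ    (e ∷ c ∷ [])                    = ind𝟏 e c
  valᵒ M.εᵒ       []                              = nil
  valᵒ M.consᵒ    (l ∷ a ∷ [])                    = cons l a
  valᵒ M.elListᵒ  (l ∷ c ∷ d ∷ [])                = indList l c d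
  valᵒ M.inlᵒ     (a ∷ [])                        = inl a
  valᵒ M.inrᵒ     (b ∷ [])                        = inr b
  valᵒ M.el+ᵒ     (e ∷ c ∷ d ∷ [])                = ind+ e c d
  valᵒ M.pairᵒ    (a ∷ b ∷ [])                    = pair a b
  valᵒ M.elΣᵒ     (e ∷ c ∷ [])                    = indΣ e c
  valᵒ M.lamᵒ     (b ∷ [])                        = lam b
  valᵒ M.Apᵒ      (f ∷ a ∷ [])                    = f · a
  valᵒ M.r₀ᵒ      (e ∷ [])                        = ind𝟎 e
  valᵒ M.inl∨ᵒ    (a ∷ [])                        = inl∨ a
  valᵒ M.inr∨ᵒ    (b ∷ [])                        = inr∨ b
  valᵒ M.el∨ᵒ     (_ ∷ s ∷ _ ∷ e ∷ c ∷ d ∷ [])    = ind∨ e c d s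
  valᵒ M.pair∧ᵒ   (a ∷ b ∷ [])                    = pair a b
  valᵒ M.π₁ᵒ      (e ∷ [])                        = pr₁ e
  valᵒ M.π₂ᵒ      (e ∷ [])                        = pr₂ e
  valᵒ M.lam⇒ᵒ    (b ∷ [])                        = lam b
  valᵒ M.Ap⇒ᵒ     (f ∷ a ∷ [])                    = f · a
  valᵒ M.pair∃ᵒ   (a ∷ b ∷ [])                    = pair∃ a b
  valᵒ M.el∃ᵒ     (_ ∷ s ∷ _ ∷ e ∷ c ∷ [])        = ind∃ e c s
  valᵒ M.lam∀ᵒ    (b ∷ [])                        = lam b
  valᵒ M.Ap∀ᵒ     (f ∷ a ∷ [])                    = f · a
  valᵒ M.idᵒ      (_ ∷ _ ∷ _ ∷ a ∷ [])            = reflᵗ a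
  valᵒ M.elIdᵒ    (p ∷ c ∷ [])                    = indId p c
  valᵒ M.⊥ᶜᵒ      []                              = pair 𝟎 ⌜ 𝔭₀ ⌝
  valᵒ M.∨ᶜᵒ      (p ∷ q ∷ [])                    =
    pair (pr₁ p ∨ pr₁ q) (⌜ 𝔭∨ ⌝ · pr₁ p · pr₁ q)
  valᵒ M.∧ᶜᵒ      (p ∷ q ∷ [])                    =
    pair (pr₁ p ⊗ pr₁ q) (⌜ 𝔭× ⌝ · pr₁ p · pr₁ q · pr₂ p · pr₂ q)
  valᵒ M.⇒ᶜᵒ      (p ∷ q ∷ [])                    =
    pair (pr₁ p ⟶ pr₁ q) (⌜ 𝔭→ ⌝ · pr₁ p · pr₁ q · pr₂ q)
  valᵒ M.∃ᶜᵒ      (A ∷ _ ∷ _ ∷ p ∷ [])            =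
    pair (Exists A (pr₁ p)) (⌜ 𝔭∃ ⌝ · A · lam (pr₁ p))
  valᵒ M.∀ᶜᵒ      (A ∷ _ ∷ _ ∷ p ∷ [])            =
    pair (Π A (pr₁ p)) (⌜ 𝔭Π ⌝ · A · lam (pr₁ p) · lam (pr₂ p))
  valᵒ M.Idᶜᵒ     (A ∷ _ ∷ s ∷ a ∷ b ∷ [])        =
    pair (Id A a b) (⌜ 𝔭Id ⌝ · A · s · a · b)

  prPᵒ : M.Op M.ty ar → Args (arity ar) n → Tm n
  prPᵒ M.⊥ᵒ  []                           = ⌜ 𝔭₀ ⌝
  prPᵒ M.∨ᵒ  (A ∷ _ ∷ _ ∷ B ∷ _ ∷ _ ∷ []) = ⌜ 𝔭∨ ⌝ · A · B
  prPᵒ M.∧ᵒ  (A ∷ p ∷ _ ∷ B ∷ q ∷ _ ∷ []) = ⌜ 𝔭× ⌝ · A · B · p · q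
  prPᵒ M.⇒ᵒ  (A ∷ _ ∷ _ ∷ B ∷ q ∷ _ ∷ []) = ⌜ 𝔭→ ⌝ · A · B · q
  prPᵒ M.∃ᵒ  (A ∷ _ ∷ _ ∷ B ∷ _ ∷ _ ∷ []) = ⌜ 𝔭∃ ⌝ · A · lam B
  prPᵒ M.∀ᵒ  (A ∷ _ ∷ _ ∷ B ∷ q ∷ _ ∷ []) = ⌜ 𝔭Π ⌝ · A · lam B · lam q
  prPᵒ M.Idᵒ (A ∷ _ ∷ s ∷ a ∷ b ∷ [])     = ⌜ 𝔭Id ⌝ · A · s · a · b
  prPᵒ M.τᵒ  (p ∷ [])                     = pr₂ p
  -- The junk value is a closed constant, hence stable under substitution.
  prPᵒ _     _                            = ⋆

  prSᵒ : M.Op M.ty ar → Args (arity ar) n → Tm n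
  prSᵒ M.N₀ᵒ     []                           = ⌜ 𝔰₀ ⌝
  prSᵒ M.N₁ᵒ     []                           = ⌜ 𝔰₁ ⌝
  prSᵒ M.Listᵒ   (A ∷ _ ∷ s ∷ [])             = ⌜ 𝔰List ⌝ · A · s
  prSᵒ M.+ᵒ      (A ∷ _ ∷ s ∷ B ∷ _ ∷ t ∷ []) = ⌜ 𝔰+ ⌝ · A · B · s · t
  prSᵒ M.Σᵒ      (A ∷ _ ∷ s ∷ B ∷ _ ∷ t ∷ []) = ⌜ 𝔰Σ ⌝ · A · lam B · s · lam t
  prSᵒ M.Πᵒ      (A ∷ _ ∷ _ ∷ B ∷ _ ∷ t ∷ []) = ⌜ 𝔰Π ⌝ · A · lam B · lam t
  prSᵒ M.Propₛᵒ  []                           = ⌜ 𝔰Prop₀ ⌝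
  prSᵒ M.→Propₛᵒ (A ∷ _ ∷ _ ∷ [])             =
    ⌜ 𝔰Π ⌝ · A · lam (PropU 0) · lam ⌜ 𝔰Prop₀ ⌝
  -- Exactly the propositional formers remain, so `prPᵒ o` is not the junk value here.
  prSᵒ o         as                           = ⌜ 𝔰coe ⌝ · valᵒ o as · prPᵒ o as

  ∣_∣ᵛ  : M.Expr s n → Tm n
  ∣_∣ᵖ  : M.Ty n → Tm n
  ∣_∣ˢ  : M.Ty n → Tm n
  ∣_∣ᵃ  : M.Args ar n → Args (arity ar) n
  ∣ M.var x ∣ᵛ   = var x
  ∣ M.op o as ∣ᵛ = valᵒ o ∣ as ∣ᵃ
  ∣ M.op o as ∣ᵖ = prPᵒ o ∣ as ∣ᵃ
  ∣ M.op o as ∣ˢ = prSᵒ o ∣ as ∣ᵃ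
  ∣ M.[] ∣ᵃ                     = []
  ∣ M._∷_ {s = M.ty} A as ∣ᵃ    = ∣ A ∣ᵛ ∷ ∣ A ∣ᵖ ∷ ∣ A ∣ˢ ∷ ∣ as ∣ᵃ
  ∣ M._∷_ {s = M.tm} a as ∣ᵃ    = ∣ a ∣ᵛ ∷ ∣ as ∣ᵃ

  sub-⌜⌝ : {σ : Sub n m} (a : Tm 0) → sub σ ⌜ a ⌝ ≡ ⌜ a ⌝
  sub-⌜⌝ a = trans (sub-ren {τ = λ ()} (λ ()) a) (sym (ren-as-sub (λ ()) a))

  sub-⊗ : {σ : Sub n m} (A B : Tm n) → sub σ (A ⊗ B) ≡ sub σ A ⊗ sub σ B
  sub-⊗ A B = cong (Σ _) (wk-sub B)

  sub-⟶ : {σ : Sub n m} (A B : Tm n) → sub σ (A ⟶ B) ≡ sub σ A ⟶ sub σ B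
  sub-⟶ A B = cong (Π _) (wk-sub B)

  sub-under : {σ : Sub n m} (k : ℕ) (c : Tm (k ℕ.+ n)) →
              sub (liftˢ k (liftˢ 1 σ)) (ren (lift k suc) c) ≡ ren (lift k suc) (sub (liftˢ k σ) c)
  sub-under k c =
    trans (sub-ren (liftˢ-lift k (λ _ → refl)) c) (sym (ren-sub (lift-liftˢ k (λ _ → refl)) c))

  -- Substitution computes through an operator unless its interpretation weakens an argument, as
  -- `⊗`, `⟶`, `ind∨` and `ind∃` do, or contains a closed proof term, as the codes do.
  valᵒ-sub : {σ : Sub n m} (o : M.Op s ar) (as : Args (arity ar) n) →
             sub σ (valᵒ o as) ≡ valᵒ o (subArgs σ as)
  valᵒ-sub M.N₀ᵒ      []                           = refl
  valᵒ-sub M.N₁ᵒ      []                           = refl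
  valᵒ-sub M.Listᵒ    (A ∷ _ ∷ _ ∷ [])             = refl
  valᵒ-sub M.+ᵒ       (A ∷ _ ∷ _ ∷ B ∷ _ ∷ _ ∷ []) = refl
  valᵒ-sub M.Σᵒ       (A ∷ _ ∷ _ ∷ B ∷ _ ∷ _ ∷ []) = refl
  valᵒ-sub M.Πᵒ       (A ∷ _ ∷ _ ∷ B ∷ _ ∷ _ ∷ []) = refl
  valᵒ-sub M.Propₛᵒ   []                           = refl
  valᵒ-sub M.→Propₛᵒ  (A ∷ _ ∷ _ ∷ [])             = refl
  valᵒ-sub M.⊥ᵒ       []                           = refl
  valᵒ-sub M.∨ᵒ       (A ∷ _ ∷ _ ∷ B ∷ _ ∷ _ ∷ []) = refl
  valᵒ-sub M.∧ᵒ       (A ∷ _ ∷ _ ∷ B ∷ _ ∷ _ ∷ []) = sub-⊗ A B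
  valᵒ-sub M.⇒ᵒ       (A ∷ _ ∷ _ ∷ B ∷ _ ∷ _ ∷ []) = sub-⟶ A B
  valᵒ-sub M.∃ᵒ       (A ∷ _ ∷ _ ∷ B ∷ _ ∷ _ ∷ []) = refl
  valᵒ-sub M.∀ᵒ       (A ∷ _ ∷ _ ∷ B ∷ _ ∷ _ ∷ []) = refl
  valᵒ-sub M.Idᵒ      (A ∷ _ ∷ _ ∷ a ∷ b ∷ [])     = refl
  valᵒ-sub M.τᵒ       (p ∷ [])                     = refl
  valᵒ-sub M.emp₀ᵒ    (e ∷ [])                     = refl
  valᵒ-sub M.⋆ᵒ       []                           = refl
  valᵒ-sub M.elN₁ᵒ    (e ∷ c ∷ [])                 = refl
  valᵒ-sub M.εᵒ       []                           = refl
  valᵒ-sub M.consᵒ    (l ∷ a ∷ [])                 = refl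
  valᵒ-sub M.elListᵒ  (l ∷ c ∷ d ∷ [])             = refl
  valᵒ-sub M.inlᵒ     (a ∷ [])                     = refl
  valᵒ-sub M.inrᵒ     (b ∷ [])                     = refl
  valᵒ-sub M.el+ᵒ     (e ∷ c ∷ d ∷ [])             = refl
  valᵒ-sub M.pairᵒ    (a ∷ b ∷ [])                 = refl
  valᵒ-sub M.elΣᵒ     (e ∷ c ∷ [])                 = refl
  valᵒ-sub M.lamᵒ     (b ∷ [])                     = refl
  valᵒ-sub M.Apᵒ      (f ∷ a ∷ [])                 = refl
  valᵒ-sub M.r₀ᵒ      (e ∷ [])                     = refl
  valᵒ-sub M.inl∨ᵒ    (a ∷ [])                     = refl
  valᵒ-sub M.inr∨ᵒ    (b ∷ [])                     = refl
  valᵒ-sub M.el∨ᵒ     (_ ∷ s ∷ _ ∷ e ∷ c ∷ d ∷ []) =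
    cong₂ (λ c d → ind∥∥ _ (ind+ #0 c d) _) (sub-under 1 c) (sub-under 1 d)
  valᵒ-sub M.pair∧ᵒ   (a ∷ b ∷ [])                 = refl
  valᵒ-sub M.π₁ᵒ      (e ∷ [])                     = refl
  valᵒ-sub M.π₂ᵒ      (e ∷ [])                     = refl
  valᵒ-sub M.lam⇒ᵒ    (b ∷ [])                     = refl
  valᵒ-sub M.Ap⇒ᵒ     (f ∷ a ∷ [])                 = refl
  valᵒ-sub M.pair∃ᵒ   (a ∷ b ∷ [])                 = refl
  valᵒ-sub M.el∃ᵒ     (_ ∷ s ∷ _ ∷ e ∷ c ∷ [])     =
    cong (λ c → ind∥∥ _ (indΣ #0 c) _) (sub-under 2 c)
  valᵒ-sub M.lam∀ᵒ    (b ∷ [])                     = refl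
  valᵒ-sub M.Ap∀ᵒ     (f ∷ a ∷ [])                 = refl
  valᵒ-sub M.idᵒ      (_ ∷ _ ∷ _ ∷ a ∷ [])         = refl
  valᵒ-sub M.elIdᵒ    (p ∷ c ∷ [])                 = refl
  valᵒ-sub M.⊥ᶜᵒ      []                           = cong (pair _) (sub-⌜⌝ 𝔭₀)
  valᵒ-sub M.∨ᶜᵒ      (p ∷ q ∷ [])                 =
    cong (λ x → pair _ (x · _ · _)) (sub-⌜⌝ 𝔭∨)
  valᵒ-sub {σ = σ} M.∧ᶜᵒ (p ∷ q ∷ [])              =
    let p′ = sub σ p; q′ = sub σ q in
    cong₂ (λ A x → pair A (x · pr₁ p′ · pr₁ q′ · pr₂ p′ · pr₂ q′)) (sub-⊗ (pr₁ p) (pr₁ q)) (sub-⌜⌝ 𝔭×)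
  valᵒ-sub {σ = σ} M.⇒ᶜᵒ (p ∷ q ∷ [])              =
    let p′ = sub σ p; q′ = sub σ q in
    cong₂ (λ A x → pair A (x · pr₁ p′ · pr₁ q′ · pr₂ q′)) (sub-⟶ (pr₁ p) (pr₁ q)) (sub-⌜⌝ 𝔭→)
  valᵒ-sub M.∃ᶜᵒ      (A ∷ _ ∷ _ ∷ p ∷ [])         =
    cong (λ x → pair _ (x · _ · _)) (sub-⌜⌝ 𝔭∃)
  valᵒ-sub M.∀ᶜᵒ      (A ∷ _ ∷ _ ∷ p ∷ [])         =
    cong (λ x → pair _ (x · _ · _ · _)) (sub-⌜⌝ 𝔭Π)
  valᵒ-sub M.Idᶜᵒ     (A ∷ _ ∷ s ∷ a ∷ b ∷ [])     =
    cong (λ x → pair _ (x · _ · _ · _ · _)) (sub-⌜⌝ 𝔭Id)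

  prPᵒ-sub : {σ : Sub n m} (o : M.Op M.ty ar) (as : Args (arity ar) n) →
             sub σ (prPᵒ o as) ≡ prPᵒ o (subArgs σ as)
  prPᵒ-sub M.⊥ᵒ       []                           = sub-⌜⌝ 𝔭₀
  prPᵒ-sub M.∨ᵒ       (A ∷ _ ∷ _ ∷ B ∷ _ ∷ _ ∷ []) = cong (λ x → x · _ · _) (sub-⌜⌝ 𝔭∨)
  prPᵒ-sub M.∧ᵒ       (A ∷ p ∷ _ ∷ B ∷ q ∷ _ ∷ []) = cong (λ x → x · _ · _ · _ · _) (sub-⌜⌝ 𝔭×)
  prPᵒ-sub M.⇒ᵒ       (A ∷ _ ∷ _ ∷ B ∷ q ∷ _ ∷ []) = cong (λ x → x · _ · _ · _) (sub-⌜⌝ 𝔭→)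
  prPᵒ-sub M.∃ᵒ       (A ∷ _ ∷ _ ∷ B ∷ _ ∷ _ ∷ []) = cong (λ x → x · _ · _) (sub-⌜⌝ 𝔭∃)
  prPᵒ-sub M.∀ᵒ       (A ∷ _ ∷ _ ∷ B ∷ q ∷ _ ∷ []) = cong (λ x → x · _ · _ · _) (sub-⌜⌝ 𝔭Π)
  prPᵒ-sub M.Idᵒ      (A ∷ _ ∷ s ∷ a ∷ b ∷ [])     = cong (λ x → x · _ · _ · _ · _) (sub-⌜⌝ 𝔭Id)
  prPᵒ-sub M.τᵒ       (p ∷ [])                     = refl
  prPᵒ-sub M.N₀ᵒ      as                           = refl
  prPᵒ-sub M.N₁ᵒ      as                           = refl
  prPᵒ-sub M.Listᵒ    as                           = refl
  prPᵒ-sub M.+ᵒ       as                           = refl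
  prPᵒ-sub M.Σᵒ       as                           = refl
  prPᵒ-sub M.Πᵒ       as                           = refl
  prPᵒ-sub M.Propₛᵒ   as                           = refl
  prPᵒ-sub M.→Propₛᵒ  as                           = refl

  𝔰coe-sub : {σ : Sub n m} (o : M.Op M.ty ar) (as : Args (arity ar) n) →
             sub σ (⌜ 𝔰coe ⌝ · valᵒ o as · prPᵒ o as)
               ≡ ⌜ 𝔰coe ⌝ · valᵒ o (subArgs σ as) · prPᵒ o (subArgs σ as)
  𝔰coe-sub o as =
    cong₂ _·′_ (cong₂ _·′_ (sub-⌜⌝ 𝔰coe) (valᵒ-sub o as)) (prPᵒ-sub o as)
    where
    _·′_ : Tm n → Tm n → Tm n
    f ·′ a = f · a

  prSᵒ-sub : {σ : Sub n m} (o : M.Op M.ty ar) (as : Args (arity ar) n) →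
             sub σ (prSᵒ o as) ≡ prSᵒ o (subArgs σ as)
  prSᵒ-sub M.N₀ᵒ      []                           = sub-⌜⌝ 𝔰₀
  prSᵒ-sub M.N₁ᵒ      []                           = sub-⌜⌝ 𝔰₁
  prSᵒ-sub M.Listᵒ    (A ∷ _ ∷ s ∷ [])             = cong (λ x → x · _ · _) (sub-⌜⌝ 𝔰List)
  prSᵒ-sub M.+ᵒ       (A ∷ _ ∷ s ∷ B ∷ _ ∷ t ∷ []) = cong (λ x → x · _ · _ · _ · _) (sub-⌜⌝ 𝔰+)
  prSᵒ-sub M.Σᵒ       (A ∷ _ ∷ s ∷ B ∷ _ ∷ t ∷ []) = cong (λ x → x · _ · _ · _ · _) (sub-⌜⌝ 𝔰Σ)
  prSᵒ-sub M.Πᵒ       (A ∷ _ ∷ _ ∷ B ∷ _ ∷ t ∷ []) = cong (λ x → x · _ · _ · _) (sub-⌜⌝ 𝔰Π)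
  prSᵒ-sub M.Propₛᵒ   []                           = sub-⌜⌝ 𝔰Prop₀
  prSᵒ-sub M.→Propₛᵒ  (A ∷ _ ∷ _ ∷ [])             =
    cong₂ (λ x y → x · _ · _ · lam y) (sub-⌜⌝ 𝔰Π) (sub-⌜⌝ 𝔰Prop₀)
  prSᵒ-sub M.⊥ᵒ       as                           = 𝔰coe-sub M.⊥ᵒ as
  prSᵒ-sub M.∨ᵒ       as                           = 𝔰coe-sub M.∨ᵒ as
  prSᵒ-sub M.∧ᵒ       as                           = 𝔰coe-sub M.∧ᵒ as
  prSᵒ-sub M.⇒ᵒ       as                           = 𝔰coe-sub M.⇒ᵒ as
  prSᵒ-sub M.∃ᵒ       as                           = 𝔰coe-sub M.∃ᵒ as
  prSᵒ-sub M.∀ᵒ       as                           = 𝔰coe-sub M.∀ᵒ as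
  prSᵒ-sub M.Idᵒ      as                           = 𝔰coe-sub M.Idᵒ as
  prSᵒ-sub M.τᵒ       as                           = 𝔰coe-sub M.τᵒ as

  -- A renaming is a substitution by variables, so naturality under substitution already yields it,
  -- with no second case analysis over the operators.
  ren-natural : ∀ {ar} (F : ∀ {n} → Args ar n → Tm n) →
                (∀ {n m} {σ : Sub n m} (as : Args ar n) → sub σ (F as) ≡ F (subArgs σ as)) →
                {ρ : Fin n → Fin m} (as : Args ar n) → ren ρ (F as) ≡ F (renArgs ρ as)
  ren-natural F F-sub as =
    trans (ren-as-sub (λ _ → refl) (F as))
          (trans (F-sub as) (cong F (sym (renArgs-as-sub (λ _ → refl) as))))

  ∣∣ᵛ-ren : {ρ : Fin n → Fin m} (e : M.Expr s n) → ∣ M.ren ρ e ∣ᵛ ≡ ren ρ ∣ e ∣ᵛ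
  ∣∣ᵖ-ren : {ρ : Fin n → Fin m} (A : M.Ty n) → ∣ M.ren ρ A ∣ᵖ ≡ ren ρ ∣ A ∣ᵖ
  ∣∣ˢ-ren : {ρ : Fin n → Fin m} (A : M.Ty n) → ∣ M.ren ρ A ∣ˢ ≡ ren ρ ∣ A ∣ˢ
  ∣∣ᵃ-ren : {ρ : Fin n → Fin m} (as : M.Args ar n) →
            ∣ M.renArgs ρ as ∣ᵃ ≡ renArgs ρ ∣ as ∣ᵃ
  ∣∣ᵛ-ren (M.var x)   = refl
  ∣∣ᵛ-ren (M.op o as) =
    trans (cong (valᵒ o) (∣∣ᵃ-ren as)) (sym (ren-natural (valᵒ o) (valᵒ-sub o) ∣ as ∣ᵃ))
  ∣∣ᵖ-ren (M.op o as) =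
    trans (cong (prPᵒ o) (∣∣ᵃ-ren as)) (sym (ren-natural (prPᵒ o) (prPᵒ-sub o) ∣ as ∣ᵃ))
  ∣∣ˢ-ren (M.op o as) =
    trans (cong (prSᵒ o) (∣∣ᵃ-ren as)) (sym (ren-natural (prSᵒ o) (prSᵒ-sub o) ∣ as ∣ᵃ))
  ∣∣ᵃ-ren M.[] = refl
  ∣∣ᵃ-ren (M._∷_ {s = M.ty} A as) =
    cong₂ _∷_ (∣∣ᵛ-ren A) (cong₂ _∷_ (∣∣ᵖ-ren A) (cong₂ _∷_ (∣∣ˢ-ren A) (∣∣ᵃ-ren as)))
  ∣∣ᵃ-ren (M._∷_ {s = M.tm} a as) = cong₂ _∷_ (∣∣ᵛ-ren a) (∣∣ᵃ-ren as)

  infix 4 _≗ˢ_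

  _≗ˢ_ : M.Sub n m → Sub n m → Set
  σ ≗ˢ τ = ∀ x → ∣ σ x ∣ᵛ ≡ τ x

  ≗ˢ-lift : ∀ k {σ : M.Sub n m} {τ : Sub n m} → σ ≗ˢ τ → M.liftˢ k σ ≗ˢ liftˢ k τ
  ≗ˢ-lift zero    h x       = h x
  ≗ˢ-lift (suc k) h zero    = refl
  ≗ˢ-lift (suc k) {σ} h (suc x) =
    trans (∣∣ᵛ-ren (M.liftˢ k σ x)) (cong wk (≗ˢ-lift k h x))

  -- The HoTT substitution `τ` is only required to agree pointwise with the interpreted one. Hence
  -- `var ▹ a`, `↑ k` and the longer substitutions in the typing rules are all instances, with
  -- hypotheses proved by `refl`. The renaming case comes first because lifting weakens.
  ∣∣ᵛ-sub : {σ : M.Sub n m} {τ : Sub n m} → σ ≗ˢ τ →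
            (e : M.Expr s n) → ∣ M.sub σ e ∣ᵛ ≡ sub τ ∣ e ∣ᵛ
  ∣∣ᵖ-sub : {σ : M.Sub n m} {τ : Sub n m} → σ ≗ˢ τ →
            (A : M.Ty n) → ∣ M.sub σ A ∣ᵖ ≡ sub τ ∣ A ∣ᵖ
  ∣∣ˢ-sub : {σ : M.Sub n m} {τ : Sub n m} → σ ≗ˢ τ →
            (A : M.Ty n) → ∣ M.sub σ A ∣ˢ ≡ sub τ ∣ A ∣ˢ
  ∣∣ᵃ-sub : {σ : M.Sub n m} {τ : Sub n m} → σ ≗ˢ τ →
            (as : M.Args ar n) → ∣ M.subArgs σ as ∣ᵃ ≡ subArgs τ ∣ as ∣ᵃ
  ∣∣ᵛ-sub h (M.var x)   = h x
  ∣∣ᵛ-sub h (M.op o as) = trans (cong (valᵒ o) (∣∣ᵃ-sub h as)) (sym (valᵒ-sub o ∣ as ∣ᵃ))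
  ∣∣ᵖ-sub h (M.op o as) = trans (cong (prPᵒ o) (∣∣ᵃ-sub h as)) (sym (prPᵒ-sub o ∣ as ∣ᵃ))
  ∣∣ˢ-sub h (M.op o as) = trans (cong (prSᵒ o) (∣∣ᵃ-sub h as)) (sym (prSᵒ-sub o ∣ as ∣ᵃ))
  ∣∣ᵃ-sub h M.[] = refl
  ∣∣ᵃ-sub h (M._∷_ {s = M.ty} {k = k} A as) =
    cong₂ _∷_ (∣∣ᵛ-sub (≗ˢ-lift k h) A) (cong₂ _∷_ (∣∣ᵖ-sub (≗ˢ-lift k h) A)
      (cong₂ _∷_ (∣∣ˢ-sub (≗ˢ-lift k h) A) (∣∣ᵃ-sub h as)))
  ∣∣ᵃ-sub h (M._∷_ {s = M.tm} {k = k} a as) =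
    cong₂ _∷_ (∣∣ᵛ-sub (≗ˢ-lift k h) a) (∣∣ᵃ-sub h as)

  ∣_∣ᶜ : M.Ctx n → Ctx n
  ∣ M.∅ ∣ᶜ     = ∅
  ∣ Γ M.▸ A ∣ᶜ = ∣ Γ ∣ᶜ ▸ ∣ A ∣ᵛ

  ∣∣-lookup : (Γ : M.Ctx n) (x : Fin n) → ∣ M.lookup Γ x ∣ᵛ ≡ lookup ∣ Γ ∣ᶜ x
  ∣∣-lookup (Γ M.▸ A) zero    = ∣∣ᵛ-ren A
  ∣∣-lookup (Γ M.▸ A) (suc x) = trans (∣∣ᵛ-ren (M.lookup Γ x)) (cong wk (∣∣-lookup Γ x))

  -- The syntactic domain of the partial interpretation.

  propᵒ : M.Op s ar → Bool
  propᵒ M.⊥ᵒ  = true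
  propᵒ M.∨ᵒ  = true
  propᵒ M.∧ᵒ  = true
  propᵒ M.⇒ᵒ  = true
  propᵒ M.∃ᵒ  = true
  propᵒ M.∀ᵒ  = true
  propᵒ M.Idᵒ = true
  propᵒ M.τᵒ  = true
  propᵒ _     = false

  -- A condition on the head symbol alone. Since a type expression is never a variable, renaming and
  -- substitution cannot change it.
  IsProposition : M.Expr s n → Set
  IsProposition (M.var x)   = ⊥
  IsProposition (M.op o as) = T (propᵒ o)

  -- Marks arguments by position; missing entries count as false.
  needsPrP : M.Op s ar → List.List Bool
  needsPrP M.∧ᵒ   = true ∷ true ∷ []
  needsPrP M.⇒ᵒ   = false ∷ true ∷ []
  needsPrP M.∀ᵒ   = false ∷ true ∷ []
  needsPrP M.el∨ᵒ = true ∷ []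
  needsPrP M.el∃ᵒ = true ∷ []
  needsPrP _      = []

  -- A sufficient condition for the partial maps to be defined: every argument whose `prP` may be
  -- consumed has a propositional head. It asks nothing about typing, so it passes to all
  -- substitution instances by entries that are `Ok`.
  Ok     : M.Expr s n → Set
  OkArgs : List.List Bool → M.Args ar n → Set
  Ok (M.var x)   = ⊤
  Ok (M.op o as) = OkArgs (needsPrP o) as
  OkArgs bs           M.[]       = ⊤
  OkArgs []           (a M.∷ as) = Ok a × OkArgs [] as
  OkArgs (false ∷ bs) (a M.∷ as) = Ok a × OkArgs bs as
  OkArgs (true ∷ bs)  (a M.∷ as) = (Ok a × IsProposition a) × OkArgs bs as

  IsProposition-ren : {ρ : Fin n → Fin m} (e : M.Expr s n) →
                      IsProposition e → IsProposition (M.ren ρ e)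
  IsProposition-ren (M.op o as) p = p

  IsProposition-sub : {σ : M.Sub n m} (e : M.Expr s n) →
                      IsProposition e → IsProposition (M.sub σ e)
  IsProposition-sub (M.op o as) p = p

  Ok-ren     : {ρ : Fin n → Fin m} (e : M.Expr s n) → Ok e → Ok (M.ren ρ e)
  OkArgs-ren : {ρ : Fin n → Fin m} (bs : List.List Bool) (as : M.Args ar n) →
               OkArgs bs as → OkArgs bs (M.renArgs ρ as)
  Ok-ren (M.var x)   _ = tt
  Ok-ren (M.op o as) h = OkArgs-ren (needsPrP o) as h
  OkArgs-ren bs           M.[]       _             = tt
  OkArgs-ren []           (a M.∷ as) (h , hs)      = Ok-ren a h , OkArgs-ren [] as hs
  OkArgs-ren (false ∷ bs) (a M.∷ as) (h , hs)      = Ok-ren a h , OkArgs-ren bs as hs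
  OkArgs-ren (true ∷ bs)  (a M.∷ as) ((h , p) , hs) =
    (Ok-ren a h , IsProposition-ren a p) , OkArgs-ren bs as hs

  Ok-liftˢ : ∀ k {σ : M.Sub n m} → (∀ x → Ok (σ x)) → ∀ x → Ok (M.liftˢ k σ x)
  Ok-liftˢ zero    h x       = h x
  Ok-liftˢ (suc k) h zero    = tt
  Ok-liftˢ (suc k) {σ} h (suc x) = Ok-ren (M.liftˢ k σ x) (Ok-liftˢ k h x)

  Ok-sub     : {σ : M.Sub n m} → (∀ x → Ok (σ x)) →
               (e : M.Expr s n) → Ok e → Ok (M.sub σ e)
  OkArgs-sub : {σ : M.Sub n m} → (∀ x → Ok (σ x)) →
               (bs : List.List Bool) (as : M.Args ar n) →
               OkArgs bs as → OkArgs bs (M.subArgs σ as)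
  Ok-sub σ (M.var x)   _ = σ x
  Ok-sub σ (M.op o as) h = OkArgs-sub σ (needsPrP o) as h
  OkArgs-sub σ bs           M.[]       _        = tt
  OkArgs-sub σ []           (M._∷_ {k = k} a as) (h , hs) =
    Ok-sub (Ok-liftˢ k σ) a h , OkArgs-sub σ [] as hs
  OkArgs-sub σ (false ∷ bs) (M._∷_ {k = k} a as) (h , hs) =
    Ok-sub (Ok-liftˢ k σ) a h , OkArgs-sub σ bs as hs
  OkArgs-sub σ (true ∷ bs)  (M._∷_ {k = k} a as) ((h , p) , hs) =
    (Ok-sub (Ok-liftˢ k σ) a h , IsProposition-sub a p) , OkArgs-sub σ bs as hs

  prS-proposition : (A : M.Ty n) → IsProposition A →
                    ∣ A ∣ˢ ≡ ⌜ 𝔰coe ⌝ · ∣ A ∣ᵛ · ∣ A ∣ᵖ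
  prS-proposition (M.op M.⊥ᵒ _)  _ = refl
  prS-proposition (M.op M.∨ᵒ _)  _ = refl
  prS-proposition (M.op M.∧ᵒ _)  _ = refl
  prS-proposition (M.op M.⇒ᵒ _)  _ = refl
  prS-proposition (M.op M.∃ᵒ _)  _ = refl
  prS-proposition (M.op M.∀ᵒ _)  _ = refl
  prS-proposition (M.op M.Idᵒ _) _ = refl
  prS-proposition (M.op M.τᵒ _)  _ = refl

  open Interpretation H 𝔠 using (⟦_⟧; prP; prS; ⟦_⟧ᶜ)

  -- The three inductions are mutual because terms call back into the proofs: `el∨` and `el∃` into
  -- `prP`, and `Idᶜ` into `prS`.
  ⟦⟧-def : (e : M.Expr s n) → Ok e → ⟦ e ⟧ ≡ just ∣ e ∣ᵛ
  prP-def : (A : M.Ty n) → Ok A → IsProposition A → prP A ≡ just ∣ A ∣ᵖ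
  prS-def : (A : M.Ty n) → Ok A → prS A ≡ just ∣ A ∣ˢ
  ⟦⟧-def (M.var x) _ = refl
  ⟦⟧-def M.N₀ _ = refl
  ⟦⟧-def M.N₁ _ = refl
  ⟦⟧-def (M.List A) (h , _) rewrite ⟦⟧-def A h = refl
  ⟦⟧-def (A M.+ B) (h , i , _) rewrite ⟦⟧-def A h | ⟦⟧-def B i = refl
  ⟦⟧-def (M.Σ A B) (h , i , _) rewrite ⟦⟧-def A h | ⟦⟧-def B i = refl
  ⟦⟧-def (M.Π A B) (h , i , _) rewrite ⟦⟧-def A h | ⟦⟧-def B i = refl
  ⟦⟧-def M.Propₛ _ = refl
  ⟦⟧-def (A M.→Propₛ) (h , _) rewrite ⟦⟧-def A h = refl
  ⟦⟧-def M.⊥ _ = refl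
  ⟦⟧-def (A M.∨ B) (h , i , _) rewrite ⟦⟧-def A h | ⟦⟧-def B i = refl
  ⟦⟧-def (A M.∧ B) ((h , _) , (i , _) , _) rewrite ⟦⟧-def A h | ⟦⟧-def B i = refl
  ⟦⟧-def (A M.⇒ B) (h , (i , _) , _) rewrite ⟦⟧-def A h | ⟦⟧-def B i = refl
  ⟦⟧-def (M.Exists A B) (h , i , _) rewrite ⟦⟧-def A h | ⟦⟧-def B i = refl
  ⟦⟧-def (M.Forall A B) (h , (i , _) , _) rewrite ⟦⟧-def A h | ⟦⟧-def B i = refl
  ⟦⟧-def (M.Id A a b) (h , i , j , _)
    rewrite ⟦⟧-def A h | ⟦⟧-def a i | ⟦⟧-def b j = refl
  ⟦⟧-def (M.τ p) (h , _) rewrite ⟦⟧-def p h = refl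
  ⟦⟧-def (M.emp₀ e) (h , _) rewrite ⟦⟧-def e h = refl
  ⟦⟧-def M.⋆ _ = refl
  ⟦⟧-def (M.elN₁ e c) (h , i , _) rewrite ⟦⟧-def e h | ⟦⟧-def c i = refl
  ⟦⟧-def M.ε _ = refl
  ⟦⟧-def (M.cons l a) (h , i , _) rewrite ⟦⟧-def l h | ⟦⟧-def a i = refl
  ⟦⟧-def (M.elList l c d) (h , i , j , _)
    rewrite ⟦⟧-def l h | ⟦⟧-def c i | ⟦⟧-def d j = refl
  ⟦⟧-def (M.inl a) (h , _) rewrite ⟦⟧-def a h = refl
  ⟦⟧-def (M.inr a) (h , _) rewrite ⟦⟧-def a h = refl
  ⟦⟧-def (M.el+ e c d) (h , i , j , _)
    rewrite ⟦⟧-def e h | ⟦⟧-def c i | ⟦⟧-def d j = refl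
  ⟦⟧-def (M.pair a b) (h , i , _) rewrite ⟦⟧-def a h | ⟦⟧-def b i = refl
  ⟦⟧-def (M.elΣ e c) (h , i , _) rewrite ⟦⟧-def e h | ⟦⟧-def c i = refl
  ⟦⟧-def (M.lam b) (h , _) rewrite ⟦⟧-def b h = refl
  ⟦⟧-def (M.Ap f a) (h , i , _) rewrite ⟦⟧-def f h | ⟦⟧-def a i = refl
  ⟦⟧-def (M.r₀ e) (h , _) rewrite ⟦⟧-def e h = refl
  ⟦⟧-def (M.inl∨ a) (h , _) rewrite ⟦⟧-def a h = refl
  ⟦⟧-def (M.inr∨ a) (h , _) rewrite ⟦⟧-def a h = refl
  ⟦⟧-def (M.el∨ C e c d) ((g , p) , h , i , j , _)
    rewrite ⟦⟧-def e h | ⟦⟧-def c i | ⟦⟧-def d j | prP-def C g p = refl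
  ⟦⟧-def (M.pair∧ a b) (h , i , _) rewrite ⟦⟧-def a h | ⟦⟧-def b i = refl
  ⟦⟧-def (M.π₁ e) (h , _) rewrite ⟦⟧-def e h = refl
  ⟦⟧-def (M.π₂ e) (h , _) rewrite ⟦⟧-def e h = refl
  ⟦⟧-def (M.lam⇒ b) (h , _) rewrite ⟦⟧-def b h = refl
  ⟦⟧-def (M.Ap⇒ f a) (h , i , _) rewrite ⟦⟧-def f h | ⟦⟧-def a i = refl
  ⟦⟧-def (M.pair∃ a b) (h , i , _) rewrite ⟦⟧-def a h | ⟦⟧-def b i = refl
  ⟦⟧-def (M.el∃ C e c) ((g , p) , h , i , _)
    rewrite ⟦⟧-def e h | ⟦⟧-def c i | prP-def C g p = refl
  ⟦⟧-def (M.lam∀ b) (h , _) rewrite ⟦⟧-def b h = refl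
  ⟦⟧-def (M.Ap∀ f a) (h , i , _) rewrite ⟦⟧-def f h | ⟦⟧-def a i = refl
  ⟦⟧-def (M.id A a) (_ , h , _) rewrite ⟦⟧-def a h = refl
  ⟦⟧-def (M.elId p c) (h , i , _) rewrite ⟦⟧-def p h | ⟦⟧-def c i = refl
  ⟦⟧-def M.⊥ᶜ _ = refl
  ⟦⟧-def (p M.∨ᶜ q) (h , i , _) rewrite ⟦⟧-def p h | ⟦⟧-def q i = refl
  ⟦⟧-def (p M.∧ᶜ q) (h , i , _) rewrite ⟦⟧-def p h | ⟦⟧-def q i = refl
  ⟦⟧-def (p M.⇒ᶜ q) (h , i , _) rewrite ⟦⟧-def p h | ⟦⟧-def q i = refl
  ⟦⟧-def (M.Existsᶜ A p) (h , i , _) rewrite ⟦⟧-def A h | ⟦⟧-def p i = refl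
  ⟦⟧-def (M.Forallᶜ A p) (h , i , _) rewrite ⟦⟧-def A h | ⟦⟧-def p i = refl
  ⟦⟧-def (M.Idᶜ A a b) (h , i , j , _)
    rewrite ⟦⟧-def A h | prS-def A h | ⟦⟧-def a i | ⟦⟧-def b j = refl

  prP-def M.⊥ _ _ = refl
  prP-def (A M.∨ B) (h , i , _) _ rewrite ⟦⟧-def A h | ⟦⟧-def B i = refl
  prP-def (A M.∧ B) ((h , p) , (i , q) , _) _
    rewrite ⟦⟧-def A h | ⟦⟧-def B i | prP-def A h p | prP-def B i q = refl
  prP-def (A M.⇒ B) (h , (i , q) , _) _
    rewrite ⟦⟧-def A h | ⟦⟧-def B i | prP-def B i q = refl
  prP-def (M.Exists A B) (h , i , _) _ rewrite ⟦⟧-def A h | ⟦⟧-def B i = refl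
  prP-def (M.Forall A B) (h , (i , q) , _) _
    rewrite ⟦⟧-def A h | ⟦⟧-def B i | prP-def B i q = refl
  prP-def (M.Id A a b) (h , i , j , _) _
    rewrite ⟦⟧-def A h | prS-def A h | ⟦⟧-def a i | ⟦⟧-def b j = refl
  prP-def (M.τ p) (h , _) _ rewrite ⟦⟧-def p h = refl

  prS-def M.N₀ _ = refl
  prS-def M.N₁ _ = refl
  prS-def (M.List A) (h , _) rewrite ⟦⟧-def A h | prS-def A h = refl
  prS-def (A M.+ B) (h , i , _)
    rewrite ⟦⟧-def A h | ⟦⟧-def B i | prS-def A h | prS-def B i = refl
  prS-def (M.Σ A B) (h , i , _)
    rewrite ⟦⟧-def A h | ⟦⟧-def B i | prS-def A h | prS-def B i = refl
  prS-def (M.Π A B) (h , i , _) rewrite ⟦⟧-def A h | ⟦⟧-def B i | prS-def B i = refl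
  prS-def M.Propₛ _ = refl
  prS-def (A M.→Propₛ) (h , _) rewrite ⟦⟧-def A h = refl
  prS-def M.⊥ _ = refl
  prS-def (A M.∨ B) (h , i , _) rewrite ⟦⟧-def A h | ⟦⟧-def B i = refl
  prS-def (A M.∧ B) ((h , p) , (i , q) , _)
    rewrite ⟦⟧-def A h | ⟦⟧-def B i | prP-def A h p | prP-def B i q = refl
  prS-def (A M.⇒ B) (h , (i , q) , _)
    rewrite ⟦⟧-def A h | ⟦⟧-def B i | prP-def B i q = refl
  prS-def (M.Exists A B) (h , i , _) rewrite ⟦⟧-def A h | ⟦⟧-def B i = refl
  prS-def (M.Forall A B) (h , (i , q) , _)
    rewrite ⟦⟧-def A h | ⟦⟧-def B i | prP-def B i q = refl
  prS-def (M.Id A a b) (h , i , j , _)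
    rewrite ⟦⟧-def A h | prS-def A h | ⟦⟧-def a i | ⟦⟧-def b j = refl
  prS-def (M.τ p) (h , _) rewrite ⟦⟧-def p h = refl

  OkCtx : M.Ctx n → Set
  OkCtx M.∅       = ⊤
  OkCtx (Γ M.▸ A) = OkCtx Γ × Ok A

  OkCtx-lookup : (Γ : M.Ctx n) → OkCtx Γ → ∀ x → Ok (M.lookup Γ x)
  OkCtx-lookup (Γ M.▸ A) (γ , h) zero    = Ok-ren A h
  OkCtx-lookup (Γ M.▸ A) (γ , h) (suc x) = Ok-ren (M.lookup Γ x) (OkCtx-lookup Γ γ x)

  ⟦⟧ᶜ-def : (Γ : M.Ctx n) → OkCtx Γ → ⟦ Γ ⟧ᶜ ≡ just ∣ Γ ∣ᶜ
  ⟦⟧ᶜ-def M.∅       _       = refl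
  ⟦⟧ᶜ-def (Γ M.▸ A) (γ , h) rewrite ⟦⟧ᶜ-def Γ γ | ⟦⟧-def A h = refl

-- Derivable judgements lie in the domain of the interpretation.

module Definedness (H : HITs) (𝔠 : ProofTerms H) where

  open TotalInterpretation H 𝔠
  private module M = MTT

  private variable
    m n : ℕ
    s   : M.Sort
    Γ   : M.Ctx n
    J   : M.Judgement n
    k   : M.Kind

  KindOk : M.Kind → M.Ty n → Set
  KindOk (M.type z)  A = ⊤
  KindOk (M.prop′ z) A = IsProposition A

  OkJudgement : M.Judgement n → Set
  OkJudgement (A M.is k)     = Ok A × KindOk k A
  OkJudgement (A M.≐ B is k) = (Ok A × KindOk k A) × (Ok B × KindOk k B)
  OkJudgement (a M.∈ A)      = Ok a × Ok A
  OkJudgement (a M.≐ b ∈ A)  = Ok a × Ok b × Ok A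

  KindOk-⊑ : ∀ {k k′} → k M.⊑ k′ → (A : M.Ty n) → KindOk k A → KindOk k′ A
  KindOk-⊑ M.propₛ⊑set  A _ = tt
  KindOk-⊑ M.propₛ⊑prop A p = p
  KindOk-⊑ M.set⊑col    A _ = tt
  KindOk-⊑ M.prop⊑col   A _ = tt

  KindOk-sub : ∀ k {σ : M.Sub n m} (A : M.Ty n) → KindOk k A → KindOk k (M.sub σ A)
  KindOk-sub (M.type z)  A _ = tt
  KindOk-sub (M.prop′ z) A p = IsProposition-sub A p

  Ok-[] : (e : M.Expr s (suc n)) {a : M.Tm n} → Ok e → Ok a → Ok (e M.[ a ])
  Ok-[] e h i = Ok-sub (λ { zero → i ; (suc x) → tt }) e h

  Ok-[⨾] : (e : M.Expr s (suc (suc n))) {a b : M.Tm n} → Ok e → Ok a → Ok b → Ok (e M.[ a ⨾ b ])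
  Ok-[⨾] e h i j = Ok-sub (λ { zero → j ; (suc zero) → i ; (suc (suc x)) → tt }) e h

  -- Wherever `prP` of a part may be consumed, the rule has a premise giving that part a
  -- propositional kind, and such a kind forces the head. Equalities carry the condition for both
  -- sides, and `subsume` can only forget it.
  okCtx : Γ M.ctx → OkCtx Γ
  okΓ   : Γ M.⊢ J → OkCtx Γ
  okJ   : Γ M.⊢ J → OkJudgement J

  ok₁ : ∀ {A} → Γ M.⊢ A M.is k → Ok A
  ok₁ d = proj₁ (okJ d)

  okᵗ : ∀ {a A} → Γ M.⊢ a M.∈ A → Ok a
  okᵗ d = proj₁ (okJ d)

  okCtx M.ctx-∅     = tt
  okCtx (M.ctx-▸ d) = okΓ d , ok₁ d

  okΓ (M.var-∈ γ _) = okCtx γ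
  okΓ (M.ty-refl d) = okΓ d
  okΓ (M.ty-sym d) = okΓ d
  okΓ (M.ty-trans d _) = okΓ d
  okΓ (M.tm-refl d) = okΓ d
  okΓ (M.tm-sym d) = okΓ d
  okΓ (M.tm-trans d _) = okΓ d
  okΓ (M.conv d _) = okΓ d
  okΓ (M.conv-≐ d _) = okΓ d
  okΓ (M.subsume _ d) = okΓ d
  okΓ (M.subsume-≐ _ d) = okΓ d
  okΓ (M.repl-ty _ γ _) = okCtx γ
  okΓ (M.repl-tm _ γ _) = okCtx γ
  okΓ (M.N₀-form γ) = okCtx γ
  okΓ (M.N₀-elim _ d) = okΓ d
  okΓ (M.N₁-form γ) = okCtx γ
  okΓ (M.N₁-intro γ) = okCtx γ
  okΓ (M.N₁-elim _ d _) = okΓ d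
  okΓ (M.N₁-β _ d) = okΓ d
  okΓ (M.List-form d) = okΓ d
  okΓ (M.List-cong d) = okΓ d
  okΓ (M.List-ε d) = okΓ d
  okΓ (M.List-cons d _ _) = okΓ d
  okΓ (M.List-elim d _ _ _ _) = okΓ d
  okΓ (M.List-βε d _ _ _) = okΓ d
  okΓ (M.List-βcons d _ _ _ _ _) = okΓ d
  okΓ (M.+-form d _) = okΓ d
  okΓ (M.+-cong d _) = okΓ d
  okΓ (M.+-inl d _ _) = okΓ d
  okΓ (M.+-inr d _ _) = okΓ d
  okΓ (M.+-elim d _ _ _ _ _) = okΓ d
  okΓ (M.+-βinl d _ _ _ _ _) = okΓ d
  okΓ (M.+-βinr d _ _ _ _ _) = okΓ d
  okΓ (M.Σ-form d _) = okΓ d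
  okΓ (M.Σ-cong d _) = okΓ d
  okΓ (M.Σ-intro d _ _ _) = okΓ d
  okΓ (M.Σ-elim d _ _ _ _) = okΓ d
  okΓ (M.Σ-β d _ _ _ _ _) = okΓ d
  okΓ (M.Π-form d _) = okΓ d
  okΓ (M.Π-cong d _) = okΓ d
  okΓ (M.Π-intro d _ _) = okΓ d
  okΓ (M.Π-elim d _ _ _) = okΓ d
  okΓ (M.Π-β d _ _ _) = okΓ d
  okΓ (M.Propₛ-form γ) = okCtx γ
  okΓ (M.→Propₛ-form d) = okΓ d
  okΓ (M.→Propₛ-cong d) = okΓ d
  okΓ (M.→Propₛ-intro d _) = okΓ d
  okΓ (M.→Propₛ-elim d _ _) = okΓ d
  okΓ (M.→Propₛ-β d _ _) = okΓ d
  okΓ (M.⊥-form γ) = okCtx γ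
  okΓ (M.⊥-elim d _) = okΓ d
  okΓ (M.∨-form d _) = okΓ d
  okΓ (M.∨-cong d _) = okΓ d
  okΓ (M.∨-inl d _ _) = okΓ d
  okΓ (M.∨-inr d _ _) = okΓ d
  okΓ (M.∨-elim d _ _ _ _ _) = okΓ d
  okΓ (M.∨-βinl d _ _ _ _ _) = okΓ d
  okΓ (M.∨-βinr d _ _ _ _ _) = okΓ d
  okΓ (M.∧-form d _) = okΓ d
  okΓ (M.∧-cong d _) = okΓ d
  okΓ (M.∧-intro d _ _ _) = okΓ d
  okΓ (M.∧-π₁ d _ _) = okΓ d
  okΓ (M.∧-π₂ d _ _) = okΓ d
  okΓ (M.∧-β₁ d _ _ _) = okΓ d
  okΓ (M.∧-β₂ d _ _ _) = okΓ d
  okΓ (M.⇒-form d _) = okΓ d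
  okΓ (M.⇒-cong d _) = okΓ d
  okΓ (M.⇒-intro d _ _) = okΓ d
  okΓ (M.⇒-elim d _ _ _) = okΓ d
  okΓ (M.⇒-β d _ _ _) = okΓ d
  okΓ (M.∃-form d _) = okΓ d
  okΓ (M.∃-cong d _) = okΓ d
  okΓ (M.∃-intro d _ _ _) = okΓ d
  okΓ (M.∃-elim d _ _ _ _) = okΓ d
  okΓ (M.∃-β d _ _ _ _ _) = okΓ d
  okΓ (M.∀-form d _) = okΓ d
  okΓ (M.∀-cong d _) = okΓ d
  okΓ (M.∀-intro d _ _) = okΓ d
  okΓ (M.∀-elim d _ _ _) = okΓ d
  okΓ (M.∀-β d _ _ _) = okΓ d
  okΓ (M.Id-form d _ _) = okΓ d
  okΓ (M.Id-cong d _ _) = okΓ d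
  okΓ (M.Id-intro d _) = okΓ d
  okΓ (M.Id-elim d _ _ _ _ _) = okΓ d
  okΓ (M.Id-β d _ _ _) = okΓ d
  okΓ (M.⊥ᶜ-intro γ) = okCtx γ
  okΓ (M.∨ᶜ-intro d _) = okΓ d
  okΓ (M.∧ᶜ-intro d _) = okΓ d
  okΓ (M.⇒ᶜ-intro d _) = okΓ d
  okΓ (M.∃ᶜ-intro d _) = okΓ d
  okΓ (M.∀ᶜ-intro d _) = okΓ d
  okΓ (M.Idᶜ-intro d _ _) = okΓ d
  okΓ (M.τ-form d) = okΓ d
  okΓ (M.τ-cong d) = okΓ d
  okΓ (M.τ-⊥ᶜ γ) = okCtx γ
  okΓ (M.τ-∨ᶜ d _) = okΓ d
  okΓ (M.τ-∧ᶜ d _) = okΓ d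
  okΓ (M.τ-⇒ᶜ d _) = okΓ d
  okΓ (M.τ-∃ᶜ d _) = okΓ d
  okΓ (M.τ-∀ᶜ d _) = okΓ d
  okΓ (M.τ-Idᶜ d _ _) = okΓ d

  okJ (M.var-∈ {Γ = Γ} γ x) = tt , OkCtx-lookup Γ (okCtx γ) x
  okJ (M.ty-refl d) = okJ d , okJ d
  okJ (M.ty-sym d) = let A , B = okJ d in B , A
  okJ (M.ty-trans d e) = proj₁ (okJ d) , proj₂ (okJ e)
  okJ (M.tm-refl d) = let a , A = okJ d in a , a , A
  okJ (M.tm-sym d) = let a , b , A = okJ d in b , a , A
  okJ (M.tm-trans d e) = let a , _ , A = okJ d ; _ , c , _ = okJ e in a , c , A
  okJ (M.conv d e) = okᵗ d , proj₁ (proj₂ (okJ e))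
  okJ (M.conv-≐ d e) = let a , b , _ = okJ d in a , b , proj₁ (proj₂ (okJ e))
  okJ (M.subsume {A = A} i d) = let h , p = okJ d in h , KindOk-⊑ i A p
  okJ (M.subsume-≐ {A = A} {B} i d) =
    let (h , p) , (h′ , p′) = okJ d in (h , KindOk-⊑ i A p) , (h′ , KindOk-⊑ i B p′)
  okJ (M.repl-ty {C = C} {k = k} d δ s) =
    let h , p = okJ d in
    (Ok-sub (λ x → proj₁ (okJ (s x))) C h , KindOk-sub k C p) ,
    (Ok-sub (λ x → proj₁ (proj₂ (okJ (s x)))) C h , KindOk-sub k C p)
  okJ (M.repl-tm {c = c} {C = C} d δ s) =
    let h , H = okJ d in
    Ok-sub (λ x → proj₁ (okJ (s x))) c h ,
    Ok-sub (λ x → proj₁ (proj₂ (okJ (s x)))) c h ,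
    Ok-sub (λ x → proj₁ (okJ (s x))) C H

  okJ (M.N₀-form γ) = tt , tt
  okJ (M.N₀-elim {C = C} c e) = (okᵗ e , tt) , Ok-[] C (ok₁ c) (okᵗ e)
  okJ (M.N₁-form γ) = tt , tt
  okJ (M.N₁-intro γ) = tt , tt
  okJ (M.N₁-elim {C = C} c e d) = (okᵗ e , okᵗ d , tt) , Ok-[] C (ok₁ c) (okᵗ e)
  okJ (M.N₁-β {C = C} c d) = (tt , okᵗ d , tt) , okᵗ d , proj₂ (okJ d)

  okJ (M.List-form a) = (ok₁ a , tt) , tt
  okJ (M.List-cong a) =
    let (A , _) , (A′ , _) = okJ a in ((A , tt) , tt) , ((A′ , tt) , tt)
  okJ (M.List-ε a) = tt , ok₁ a , tt
  okJ (M.List-cons a l b) = (okᵗ l , okᵗ b , tt) , ok₁ a , tt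
  okJ (M.List-elim {C = C} _ C-ok l c d) =
    (okᵗ l , okᵗ c , okᵗ d , tt) , Ok-[] C (ok₁ C-ok) (okᵗ l)
  okJ (M.List-βε _ _ c d) = (tt , okᵗ c , okᵗ d , tt) , okᵗ c , proj₂ (okJ c)
  okJ (M.List-βcons {C = C} {d = d′} _ C-ok l a c d) =
    ((okᵗ l , okᵗ a , tt) , okᵗ c , okᵗ d , tt) ,
    Ok-sub (λ where zero                → okᵗ l , okᵗ c , okᵗ d , tt
                    (suc zero)          → okᵗ a
                    (suc (suc zero))    → okᵗ l
                    (suc (suc (suc x))) → tt) d′ (okᵗ d) ,
    Ok-[] C (ok₁ C-ok) (okᵗ l , okᵗ a , tt)

  okJ (M.+-form a b) = (ok₁ a , ok₁ b , tt) , tt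
  okJ (M.+-cong a b) =
    let (A , _) , (A′ , _) = okJ a ; (B , _) , (B′ , _) = okJ b in
    ((A , B , tt) , tt) , ((A′ , B′ , tt) , tt)
  okJ (M.+-inl a b c) = (okᵗ c , tt) , ok₁ a , ok₁ b , tt
  okJ (M.+-inr a b c) = (okᵗ c , tt) , ok₁ a , ok₁ b , tt
  okJ (M.+-elim {C = C} _ _ C-ok e c d) =
    (okᵗ e , okᵗ c , okᵗ d , tt) , Ok-[] C (ok₁ C-ok) (okᵗ e)
  okJ (M.+-βinl {C = C} {c = c′} _ _ C-ok a c d) =
    ((okᵗ a , tt) , okᵗ c , okᵗ d , tt) , Ok-[] c′ (okᵗ c) (okᵗ a) ,
    Ok-[] C (ok₁ C-ok) (okᵗ a , tt)
  okJ (M.+-βinr {C = C} {d = d′} _ _ C-ok b c d) =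
    ((okᵗ b , tt) , okᵗ c , okᵗ d , tt) , Ok-[] d′ (okᵗ d) (okᵗ b) ,
    Ok-[] C (ok₁ C-ok) (okᵗ b , tt)

  okJ (M.Σ-form a b) = (ok₁ a , ok₁ b , tt) , tt
  okJ (M.Σ-cong a b) =
    let (A , _) , (A′ , _) = okJ a ; (B , _) , (B′ , _) = okJ b in
    ((A , B , tt) , tt) , ((A′ , B′ , tt) , tt)
  okJ (M.Σ-intro A B a b) = (okᵗ a , okᵗ b , tt) , ok₁ A , ok₁ B , tt
  okJ (M.Σ-elim {C = C} _ _ C-ok e c) = (okᵗ e , okᵗ c , tt) , Ok-[] C (ok₁ C-ok) (okᵗ e)
  okJ (M.Σ-β {C = C} {c = c′} _ _ C-ok a b c) =
    ((okᵗ a , okᵗ b , tt) , okᵗ c , tt) , Ok-[⨾] c′ (okᵗ c) (okᵗ a) (okᵗ b) ,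
    Ok-[] C (ok₁ C-ok) (okᵗ a , okᵗ b , tt)

  okJ (M.Π-form a b) = (ok₁ a , ok₁ b , tt) , tt
  okJ (M.Π-cong a b) =
    let (A , _) , (A′ , _) = okJ a ; (B , _) , (B′ , _) = okJ b in
    ((A , B , tt) , tt) , ((A′ , B′ , tt) , tt)
  okJ (M.Π-intro A B b) = (okᵗ b , tt) , ok₁ A , ok₁ B , tt
  okJ (M.Π-elim {B = B′} A B f a) = (okᵗ f , okᵗ a , tt) , Ok-[] B′ (ok₁ B) (okᵗ a)
  okJ (M.Π-β {B = B′} {b = b′} A B b a) =
    ((okᵗ b , tt) , okᵗ a , tt) , Ok-[] b′ (okᵗ b) (okᵗ a) , Ok-[] B′ (ok₁ B) (okᵗ a)

  okJ (M.Propₛ-form γ) = tt , tt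
  okJ (M.→Propₛ-form a) = (ok₁ a , tt) , tt
  okJ (M.→Propₛ-cong a) =
    let (A , _) , (A′ , _) = okJ a in ((A , tt) , tt) , ((A′ , tt) , tt)
  okJ (M.→Propₛ-intro A p) = (okᵗ p , tt) , ok₁ A , tt
  okJ (M.→Propₛ-elim A f a) = (okᵗ f , okᵗ a , tt) , tt
  okJ (M.→Propₛ-β {p = p′} A p a) =
    ((okᵗ p , tt) , okᵗ a , tt) , Ok-[] p′ (okᵗ p) (okᵗ a) , tt

  okJ (M.⊥-form γ) = tt , tt
  okJ (M.⊥-elim C e) = (okᵗ e , tt) , ok₁ C

  okJ (M.∨-form a b) = (ok₁ a , ok₁ b , tt) , tt
  okJ (M.∨-cong a b) =
    let (A , _) , (A′ , _) = okJ a ; (B , _) , (B′ , _) = okJ b in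
    ((A , B , tt) , tt) , ((A′ , B′ , tt) , tt)
  okJ (M.∨-inl A B a) = (okᵗ a , tt) , ok₁ A , ok₁ B , tt
  okJ (M.∨-inr A B b) = (okᵗ b , tt) , ok₁ A , ok₁ B , tt
  okJ (M.∨-elim A B C e c d) = (okJ C , okᵗ e , okᵗ c , okᵗ d , tt) , ok₁ C
  okJ (M.∨-βinl {c = c′} A B C a c d) =
    (okJ C , (okᵗ a , tt) , okᵗ c , okᵗ d , tt) , Ok-[] c′ (okᵗ c) (okᵗ a) , ok₁ C
  okJ (M.∨-βinr {d = d′} A B C b c d) =
    (okJ C , (okᵗ b , tt) , okᵗ c , okᵗ d , tt) , Ok-[] d′ (okᵗ d) (okᵗ b) , ok₁ C

  okJ (M.∧-form a b) = (okJ a , okJ b , tt) , tt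
  okJ (M.∧-cong a b) =
    let A , A′ = okJ a ; B , B′ = okJ b in ((A , B , tt) , tt) , ((A′ , B′ , tt) , tt)
  okJ (M.∧-intro A B a b) = (okᵗ a , okᵗ b , tt) , okJ A , okJ B , tt
  okJ (M.∧-π₁ A B e) = (okᵗ e , tt) , ok₁ A
  okJ (M.∧-π₂ A B e) = (okᵗ e , tt) , ok₁ B
  okJ (M.∧-β₁ A B a b) = ((okᵗ a , okᵗ b , tt) , tt) , okᵗ a , ok₁ A
  okJ (M.∧-β₂ A B a b) = ((okᵗ a , okᵗ b , tt) , tt) , okᵗ b , ok₁ B

  okJ (M.⇒-form a b) = (ok₁ a , okJ b , tt) , tt
  okJ (M.⇒-cong a b) =
    let (A , _) , (A′ , _) = okJ a ; B , B′ = okJ b in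
    ((A , B , tt) , tt) , ((A′ , B′ , tt) , tt)
  okJ (M.⇒-intro A B b) = (okᵗ b , tt) , ok₁ A , okJ B , tt
  okJ (M.⇒-elim A B f a) = (okᵗ f , okᵗ a , tt) , ok₁ B
  okJ (M.⇒-β {b = b′} A B b a) =
    ((okᵗ b , tt) , okᵗ a , tt) , Ok-[] b′ (okᵗ b) (okᵗ a) , ok₁ B

  okJ (M.∃-form a b) = (ok₁ a , ok₁ b , tt) , tt
  okJ (M.∃-cong a b) =
    let (A , _) , (A′ , _) = okJ a ; (B , _) , (B′ , _) = okJ b in
    ((A , B , tt) , tt) , ((A′ , B′ , tt) , tt)
  okJ (M.∃-intro A B a b) = (okᵗ a , okᵗ b , tt) , ok₁ A , ok₁ B , tt
  okJ (M.∃-elim A B C e c) = (okJ C , okᵗ e , okᵗ c , tt) , ok₁ C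
  okJ (M.∃-β {c = c′} A B C a b c) =
    (okJ C , (okᵗ a , okᵗ b , tt) , okᵗ c , tt) ,
    Ok-[⨾] c′ (okᵗ c) (okᵗ a) (okᵗ b) , ok₁ C

  okJ (M.∀-form a b) = (ok₁ a , okJ b , tt) , tt
  okJ (M.∀-cong a b) =
    let (A , _) , (A′ , _) = okJ a ; B , B′ = okJ b in
    ((A , B , tt) , tt) , ((A′ , B′ , tt) , tt)
  okJ (M.∀-intro A B b) = (okᵗ b , tt) , ok₁ A , okJ B , tt
  okJ (M.∀-elim {B = B′} A B f a) = (okᵗ f , okᵗ a , tt) , Ok-[] B′ (ok₁ B) (okᵗ a)
  okJ (M.∀-β {B = B′} {b = b′} A B b a) =
    ((okᵗ b , tt) , okᵗ a , tt) , Ok-[] b′ (okᵗ b) (okᵗ a) , Ok-[] B′ (ok₁ B) (okᵗ a)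

  okJ (M.Id-form A a b) = (ok₁ A , okᵗ a , okᵗ b , tt) , tt
  okJ (M.Id-cong A a b) =
    let (A , _) , (A′ , _) = okJ A ; a , a′ , _ = okJ a ; b , b′ , _ = okJ b in
    ((A , a , b , tt) , tt) , ((A′ , a′ , b′ , tt) , tt)
  okJ (M.Id-intro A a) = (ok₁ A , okᵗ a , tt) , ok₁ A , okᵗ a , okᵗ a , tt
  okJ (M.Id-elim {C = C′} A C a b p c) =
    (okᵗ p , okᵗ c , tt) , Ok-[⨾] C′ (ok₁ C) (okᵗ a) (okᵗ b)
  okJ (M.Id-β {C = C′} {c = c′} A C a c) =
    ((ok₁ A , okᵗ a , tt) , okᵗ c , tt) , Ok-[] c′ (okᵗ c) (okᵗ a) ,
    Ok-[⨾] C′ (ok₁ C) (okᵗ a) (okᵗ a)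

  okJ (M.⊥ᶜ-intro γ) = tt , tt
  okJ (M.∨ᶜ-intro p q) = (okᵗ p , okᵗ q , tt) , tt
  okJ (M.∧ᶜ-intro p q) = (okᵗ p , okᵗ q , tt) , tt
  okJ (M.⇒ᶜ-intro p q) = (okᵗ p , okᵗ q , tt) , tt
  okJ (M.∃ᶜ-intro A p) = (ok₁ A , okᵗ p , tt) , tt
  okJ (M.∀ᶜ-intro A p) = (ok₁ A , okᵗ p , tt) , tt
  okJ (M.Idᶜ-intro A a b) = (ok₁ A , okᵗ a , okᵗ b , tt) , tt

  okJ (M.τ-form p) = (okᵗ p , tt) , tt
  okJ (M.τ-cong d) = let p , q , _ = okJ d in ((p , tt) , tt) , ((q , tt) , tt)
  okJ (M.τ-⊥ᶜ γ) = ((tt , tt) , tt) , (tt , tt)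
  okJ (M.τ-∨ᶜ p q) =
    (((okᵗ p , okᵗ q , tt) , tt) , tt) , (((okᵗ p , tt) , (okᵗ q , tt) , tt) , tt)
  okJ (M.τ-∧ᶜ p q) =
    (((okᵗ p , okᵗ q , tt) , tt) , tt) ,
    ((((okᵗ p , tt) , tt) , ((okᵗ q , tt) , tt) , tt) , tt)
  okJ (M.τ-⇒ᶜ p q) =
    (((okᵗ p , okᵗ q , tt) , tt) , tt) ,
    (((okᵗ p , tt) , ((okᵗ q , tt) , tt) , tt) , tt)
  okJ (M.τ-∃ᶜ A p) =
    (((ok₁ A , okᵗ p , tt) , tt) , tt) , ((ok₁ A , (okᵗ p , tt) , tt) , tt)
  okJ (M.τ-∀ᶜ A p) =
    (((ok₁ A , okᵗ p , tt) , tt) , tt) , ((ok₁ A , ((okᵗ p , tt) , tt) , tt) , tt)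
  okJ (M.τ-Idᶜ A a b) =
    (((ok₁ A , okᵗ a , okᵗ b , tt) , tt) , tt) , ((ok₁ A , okᵗ a , okᵗ b , tt) , tt)

-- Type formers together with their truncation proofs.

module TypeFormers (H : HITs) (𝔠 : ProofTerms H) where

  open HoTT H renaming (_×_ to _⊗_; refl to reflᵗ; subst to sub-∶; subst-≐ to sub-≐)
  open ProofTerms 𝔠
  open SyntaxProperties tt tt Op
  open Admissible H
  open DerivedRules H
  open Interpretation H 𝔠 using (level)
  open MTT using (Kind; type; prop′; Size; small; large)

  private variable
    m n i j           : ℕ
    z                 : Size
    k                 : Kind
    Γ                 : Ctx n
    A A′ B B′ C       : Tm n
    a a′ b b′ f f′ p p′ q q′ s s′ t t′ w w′ w″ : Tm n

  ctx≈ : Γ ⊢ a ≈ b ∶ A → Γ ctx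
  ctx≈ d = ⊢⇒ctx (proj₁ d)

  isSet-conv : Γ ⊢ A ≈ A′ ∶ U i → Γ ⊢ isSet A ≐ isSet A′ ∶ U i
  isSet-conv A = proj₂ (isSet-≈ A)

  isProp-conv : Γ ⊢ A ≈ A′ ∶ U i → Γ ⊢ isProp A ≐ isProp A′ ∶ U i
  isProp-conv A = proj₂ (isProp-≈ A)

  -- Type families are passed to the closed proof terms as abstractions lam B.
  app-lam : Γ ▸ A ⊢ B ∶ U i → Γ ▸ A ⊢ wk (lam B) · #0 ≈ B ∶ U i
  app-lam B =
    app-∶ (wk-∶ (proj₂ (head-type (⊢⇒ctx B))) (lam-∶ B)) (var-∶ (⊢⇒ctx B) zero) , lam-wk-β B

  app-lam˘ : Γ ▸ A ⊢ B ∶ U i → Γ ▸ A ⊢ B ≈ wk (lam B) · #0 ∶ U i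
  app-lam˘ B = B , ≐-sym (lam-wk-β B)

  -- Needed when the argument of `isProp` binds a variable, as with `⟶`, `⊗`, `Π` and `Σ`: weakening
  -- and substitution then commute only up to `≡`. For `∨`, `+`, `List` and `Id` the type computes
  -- and `typed` is enough.
  typed-isProp : ∀ {k} {σ : Sub k n} {A : Tm k} →
                 Spine Γ f f′ σ (isProp A) → Γ ⊢ f ≈ f′ ∶ isProp (sub σ A)
  typed-isProp {A = A} d = cast-≈ (isProp-sub A) (typed d)

  typed-isSet : ∀ {k} {σ : Sub k n} {A : Tm k} →
                Spine Γ f f′ σ (isSet A) → Γ ⊢ f ≈ f′ ∶ isSet (sub σ A)
  typed-isSet {A = A} d = cast-≈ (isSet-sub A) (typed d)

  𝔭→-≈ : Γ ⊢ A ≈ A′ ∶ U 1 → Γ ⊢ B ≈ B′ ∶ U 1 → Γ ⊢ q ≈ q′ ∶ isProp B →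
         Γ ⊢ ⌜ 𝔭→ ⌝ · A · B · q ≈ ⌜ 𝔭→ ⌝ · A′ · B′ · q′ ∶ isProp (A ⟶ B)
  𝔭→-≈ A B q =
    typed-isProp (closed (ctx≈ A) ⊢𝔭→ ∙ A ∙ B ∙ q)

  𝔭×-≈ : Γ ⊢ A ≈ A′ ∶ U 1 → Γ ⊢ B ≈ B′ ∶ U 1 →
         Γ ⊢ p ≈ p′ ∶ isProp A → Γ ⊢ q ≈ q′ ∶ isProp B →
         Γ ⊢ ⌜ 𝔭× ⌝ · A · B · p · q ≈ ⌜ 𝔭× ⌝ · A′ · B′ · p′ · q′ ∶ isProp (A ⊗ B)
  𝔭×-≈ A B p q =
    typed-isProp (closed (ctx≈ A) ⊢𝔭× ∙ A ∙ B ∙ p ∙ q)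

  𝔭∨-≈ : Γ ⊢ A ≈ A′ ∶ U 1 → Γ ⊢ B ≈ B′ ∶ U 1 →
         Γ ⊢ ⌜ 𝔭∨ ⌝ · A · B ≈ ⌜ 𝔭∨ ⌝ · A′ · B′ ∶ isProp (A ∨ B)
  𝔭∨-≈ A B = typed (closed (ctx≈ A) ⊢𝔭∨ ∙ A ∙ B)

  -- The type of `𝔭Π` mentions a family applied to a variable. With `lam B` as the family, the type
  -- of `q` is β-expanded before application and the resulting type is β-reduced afterwards.
  𝔭Π-≈ : Γ ⊢ A ≈ A′ ∶ U 1 → Γ ▸ A ⊢ B ≈ B′ ∶ U 1 → Γ ▸ A ⊢ q ≈ q′ ∶ isProp B →
         Γ ⊢ ⌜ 𝔭Π ⌝ · A · lam B · lam q ≈ ⌜ 𝔭Π ⌝ · A′ · lam B′ · lam q′ ∶ isProp (Π A B)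
  𝔭Π-≈ A B q =
    conv-≈
      (typed-isProp (closed (ctx≈ A) ⊢𝔭Π ∙ A ∙ lam-≈ B
        ∙ lam-≈ (conv-≈ q (isProp-conv (app-lam˘ (proj₁ B))))))
      (isProp-conv (Π-≈ (≈-refl (proj₁ A)) (app-lam (proj₁ B))))

  𝔭∃-≈ : Γ ⊢ A ≈ A′ ∶ U 1 → Γ ▸ A ⊢ B ≈ B′ ∶ U 1 →
         Γ ⊢ ⌜ 𝔭∃ ⌝ · A · lam B ≈ ⌜ 𝔭∃ ⌝ · A′ · lam B′ ∶ isProp (Exists A B)
  𝔭∃-≈ A B =
    conv-≈
      (typed-isProp (closed (ctx≈ A) ⊢𝔭∃ ∙ A ∙ lam-≈ B))
      (isProp-conv (∥∥-≈ (Σ-≈ (≈-refl (proj₁ A)) (app-lam (proj₁ B)))))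

  𝔭Id-≈ : Γ ⊢ A ≈ A′ ∶ U 1 → Γ ⊢ s ≈ s′ ∶ isSet A →
          Γ ⊢ a ≈ a′ ∶ A → Γ ⊢ b ≈ b′ ∶ A →
          Γ ⊢ ⌜ 𝔭Id ⌝ · A · s · a · b ≈ ⌜ 𝔭Id ⌝ · A′ · s′ · a′ · b′ ∶ isProp (Id A a b)
  𝔭Id-≈ A s a b = typed (closed (ctx≈ A) ⊢𝔭Id ∙ A ∙ s ∙ a ∙ b)

  𝔰coe-≈ : Γ ⊢ A ≈ A′ ∶ U 1 → Γ ⊢ p ≈ p′ ∶ isProp A →
           Γ ⊢ ⌜ 𝔰coe ⌝ · A · p ≈ ⌜ 𝔰coe ⌝ · A′ · p′ ∶ isSet A
  𝔰coe-≈ A p = typed (closed (ctx≈ A) ⊢𝔰coe ∙ A ∙ p)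

  𝔰Π-≈ : Γ ⊢ A ≈ A′ ∶ U 1 → Γ ▸ A ⊢ B ≈ B′ ∶ U 1 → Γ ▸ A ⊢ t ≈ t′ ∶ isSet B →
         Γ ⊢ ⌜ 𝔰Π ⌝ · A · lam B · lam t ≈ ⌜ 𝔰Π ⌝ · A′ · lam B′ · lam t′ ∶ isSet (Π A B)
  𝔰Π-≈ A B t =
    conv-≈
      (typed-isSet (closed (ctx≈ A) ⊢𝔰Π ∙ A ∙ lam-≈ B
        ∙ lam-≈ (conv-≈ t (isSet-conv (app-lam˘ (proj₁ B))))))
      (isSet-conv (Π-≈ (≈-refl (proj₁ A)) (app-lam (proj₁ B))))

  𝔰Σ-≈ : Γ ⊢ A ≈ A′ ∶ U 1 → Γ ▸ A ⊢ B ≈ B′ ∶ U 1 →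
         Γ ⊢ s ≈ s′ ∶ isSet A → Γ ▸ A ⊢ t ≈ t′ ∶ isSet B →
         Γ ⊢ ⌜ 𝔰Σ ⌝ · A · lam B · s · lam t ≈ ⌜ 𝔰Σ ⌝ · A′ · lam B′ · s′ · lam t′
           ∶ isSet (Σ A B)
  𝔰Σ-≈ A B s t =
    conv-≈
      (typed-isSet (closed (ctx≈ A) ⊢𝔰Σ ∙ A ∙ lam-≈ B ∙ s
        ∙ lam-≈ (conv-≈ t (isSet-conv (app-lam˘ (proj₁ B))))))
      (isSet-conv (Σ-≈ (≈-refl (proj₁ A)) (app-lam (proj₁ B))))

  𝔰+-≈ : Γ ⊢ A ≈ A′ ∶ U 1 → Γ ⊢ B ≈ B′ ∶ U 1 →
         Γ ⊢ s ≈ s′ ∶ isSet A → Γ ⊢ t ≈ t′ ∶ isSet B →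
         Γ ⊢ ⌜ 𝔰+ ⌝ · A · B · s · t ≈ ⌜ 𝔰+ ⌝ · A′ · B′ · s′ · t′ ∶ isSet (A + B)
  𝔰+-≈ A B s t = typed (closed (ctx≈ A) ⊢𝔰+ ∙ A ∙ B ∙ s ∙ t)

  𝔰List-≈ : Γ ⊢ A ≈ A′ ∶ U 1 → Γ ⊢ s ≈ s′ ∶ isSet A →
            Γ ⊢ ⌜ 𝔰List ⌝ · A · s ≈ ⌜ 𝔰List ⌝ · A′ · s′ ∶ isSet (List A)
  𝔰List-≈ A s = typed (closed (ctx≈ A) ⊢𝔰List ∙ A ∙ s)

  universe : Kind → ℕ
  universe (type z)  = level z
  universe (prop′ z) = level z

  truncated : Kind → Tm n → Tm n
  truncated (type z)  A = isSet A
  truncated (prop′ z) A = isProp A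

  truncated-sub : ∀ k {σ : Sub n m} (A : Tm n) →
                  sub σ (truncated k A) ≡ truncated k (sub σ A)
  truncated-sub (type z)  = isSet-sub
  truncated-sub (prop′ z) = isProp-sub

  truncated-≈ : ∀ k → Γ ⊢ A ≈ A′ ∶ U i → Γ ⊢ truncated k A ≈ truncated k A′ ∶ U i
  truncated-≈ (type z)  = isSet-≈
  truncated-≈ (prop′ z) = isProp-≈

  infix 4 _⊢_,_is_ _⊢_,_≈_,_is_

  _⊢_,_is_ : Ctx n → Tm n → Tm n → Kind → Set
  Γ ⊢ A , w is k = (Γ ⊢ A ∶ U (universe k)) × (Γ ⊢ w ∶ truncated k A)

  -- The equality of pairs in componentwise form. Congruences act on the components directly, and
  -- pairs are formed only at the end, in `pair-truncated`; recovering components from an equality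
  -- of pairs would involve projections and their β-rules.
  _⊢_,_≈_,_is_ : Ctx n → Tm n → Tm n → Tm n → Tm n → Kind → Set
  Γ ⊢ A , w ≈ A′ , w′ is k =
    (Γ ⊢ A ≈ A′ ∶ U (universe k)) × (Γ ⊢ w ≈ w′ ∶ truncated k A)

  is-refl : Γ ⊢ A , w is k → Γ ⊢ A , w ≈ A , w is k
  is-refl (A , w) = ≈-refl A , ≈-refl w

  -- A formation rule is the reflexive instance of the corresponding congruence, with only the
  -- typing of the left-hand side retained. Each former thus needs a single lemma.
  is-left : {P Q R S : Set} → (P × Q) × (R × S) → P × R
  is-left = Prod.map proj₁ proj₁

  is-sym : ∀ k → Γ ⊢ A , w ≈ A′ , w′ is k → Γ ⊢ A′ , w′ is k → Γ ⊢ A′ , w′ ≈ A , w is k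
  is-sym k (A , (_ , w≐)) (A′ , w′) =
    (A′ , ≐-sym (proj₂ A)) , (w′ , conv-≐ (≐-sym w≐) (proj₂ (truncated-≈ k A)))

  is-trans : ∀ k → Γ ⊢ A , w ≈ A′ , w′ is k → Γ ⊢ A′ , w′ ≈ C , w″ is k →
             Γ ⊢ A , w ≈ C , w″ is k
  is-trans k (A , (w , w≐)) ((_ , A′≐) , (_ , w′≐)) =
    (proj₁ A , ≐-trans (proj₂ A) A′≐) ,
    (w , ≐-trans w≐ (conv-≐ w′≐ (≐-sym (proj₂ (truncated-≈ k A)))))

  level-≤1 : ∀ z → Γ ⊢ A ≈ A′ ∶ U (level z) → Γ ⊢ A ≈ A′ ∶ U 1
  level-≤1 small A = cumul-≈ A
  level-≤1 large A = A

  List-is : ∀ z → Γ ⊢ A , s ≈ A′ , s′ is type z →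
            Γ ⊢ List A , ⌜ 𝔰List ⌝ · A · s ≈ List A′ , ⌜ 𝔰List ⌝ · A′ · s′ is type z
  List-is z (A , s) = List-≈ A , 𝔰List-≈ (level-≤1 z A) s

  +-is : ∀ z → Γ ⊢ A , s ≈ A′ , s′ is type z → Γ ⊢ B , t ≈ B′ , t′ is type z →
         Γ ⊢ A + B , ⌜ 𝔰+ ⌝ · A · B · s · t ≈ A′ + B′ , ⌜ 𝔰+ ⌝ · A′ · B′ · s′ · t′ is type z
  +-is z (A , s) (B , t) = +-≈ A B , 𝔰+-≈ (level-≤1 z A) (level-≤1 z B) s t

  Σ-is : ∀ z → Γ ⊢ A , s ≈ A′ , s′ is type z → Γ ▸ A ⊢ B , t ≈ B′ , t′ is type z →
         Γ ⊢ Σ A B , ⌜ 𝔰Σ ⌝ · A · lam B · s · lam t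
           ≈ Σ A′ B′ , ⌜ 𝔰Σ ⌝ · A′ · lam B′ · s′ · lam t′ is type z
  Σ-is z (A , s) (B , t) = Σ-≈ A B , 𝔰Σ-≈ (level-≤1 z A) (level-≤1 z B) s t

  Π-is : ∀ z → Γ ⊢ A ≈ A′ ∶ U (level z) → Γ ▸ A ⊢ B , t ≈ B′ , t′ is type z →
         Γ ⊢ Π A B , ⌜ 𝔰Π ⌝ · A · lam B · lam t
           ≈ Π A′ B′ , ⌜ 𝔰Π ⌝ · A′ · lam B′ · lam t′ is type z
  Π-is z A (B , t) = Π-≈ A B , 𝔰Π-≈ (level-≤1 z A) (level-≤1 z B) t

  ∨-is : ∀ z → Γ ⊢ A ≈ A′ ∶ U (level z) → Γ ⊢ B ≈ B′ ∶ U (level z) →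
         Γ ⊢ A ∨ B , ⌜ 𝔭∨ ⌝ · A · B ≈ A′ ∨ B′ , ⌜ 𝔭∨ ⌝ · A′ · B′ is prop′ z
  ∨-is z A B = ∥∥-≈ (+-≈ A B) , 𝔭∨-≈ (level-≤1 z A) (level-≤1 z B)

  ∧-is : ∀ z → Γ ⊢ A , p ≈ A′ , p′ is prop′ z → Γ ⊢ B , q ≈ B′ , q′ is prop′ z →
         Γ ⊢ A ⊗ B , ⌜ 𝔭× ⌝ · A · B · p · q
           ≈ A′ ⊗ B′ , ⌜ 𝔭× ⌝ · A′ · B′ · p′ · q′ is prop′ z
  ∧-is z (A , p) (B , q) = ⊗-≈ A B , 𝔭×-≈ (level-≤1 z A) (level-≤1 z B) p q

  ⇒-is : ∀ z → Γ ⊢ A ≈ A′ ∶ U (level z) → Γ ⊢ B , q ≈ B′ , q′ is prop′ z →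
         Γ ⊢ A ⟶ B , ⌜ 𝔭→ ⌝ · A · B · q ≈ A′ ⟶ B′ , ⌜ 𝔭→ ⌝ · A′ · B′ · q′ is prop′ z
  ⇒-is z A (B , q) = ⟶-≈ A B , 𝔭→-≈ (level-≤1 z A) (level-≤1 z B) q

  ∃-is : ∀ z → Γ ⊢ A ≈ A′ ∶ U (level z) → Γ ▸ A ⊢ B ≈ B′ ∶ U (level z) →
         Γ ⊢ Exists A B , ⌜ 𝔭∃ ⌝ · A · lam B
           ≈ Exists A′ B′ , ⌜ 𝔭∃ ⌝ · A′ · lam B′ is prop′ z
  ∃-is z A B = ∥∥-≈ (Σ-≈ A B) , 𝔭∃-≈ (level-≤1 z A) (level-≤1 z B)

  ∀-is : ∀ z → Γ ⊢ A ≈ A′ ∶ U (level z) → Γ ▸ A ⊢ B , q ≈ B′ , q′ is prop′ z →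
         Γ ⊢ Π A B , ⌜ 𝔭Π ⌝ · A · lam B · lam q
           ≈ Π A′ B′ , ⌜ 𝔭Π ⌝ · A′ · lam B′ · lam q′ is prop′ z
  ∀-is z A (B , q) = Π-≈ A B , 𝔭Π-≈ (level-≤1 z A) (level-≤1 z B) q

  Id-is : ∀ z → Γ ⊢ A , s ≈ A′ , s′ is type z → Γ ⊢ a ≈ a′ ∶ A → Γ ⊢ b ≈ b′ ∶ A →
          Γ ⊢ Id A a b , ⌜ 𝔭Id ⌝ · A · s · a · b
            ≈ Id A′ a′ b′ , ⌜ 𝔭Id ⌝ · A′ · s′ · a′ · b′ is prop′ z
  Id-is z (A , s) a b = Id-≈ A a b , 𝔭Id-≈ (level-≤1 z A) s a b

  𝟎-isProp : Γ ctx → Γ ⊢ 𝟎 , ⌜ 𝔭₀ ⌝ is prop′ small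
  𝟎-isProp γ = 𝟎-form γ , proj₁ (typed (closed γ ⊢𝔭₀))

  𝟎-isSet : Γ ctx → Γ ⊢ 𝟎 , ⌜ 𝔰₀ ⌝ is type small
  𝟎-isSet γ = 𝟎-form γ , proj₁ (typed (closed γ ⊢𝔰₀))

  𝟏-isSet : Γ ctx → Γ ⊢ 𝟏 , ⌜ 𝔰₁ ⌝ is type small
  𝟏-isSet γ = 𝟏-form γ , proj₁ (typed (closed γ ⊢𝔰₁))

  #0-in-U : ∀ i → Γ ctx → Γ ▸ U i ⊢ #0 ≈ #0 ∶ U i
  #0-in-U i γ = ≈-refl (var-∶ (ctx-▸ (U-form γ)) zero)

  PropU-is : Γ ctx → Γ ⊢ PropU 0 , ⌜ 𝔰Prop₀ ⌝ is type large
  PropU-is γ =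
    -- `isProp #0` lies in `U 0`, but `U 0` itself lies in `U 1`, so the family is raised to that
    -- level.
    Σ-form (U-form γ) (cumul (proj₁ (isProp-≈ (#0-in-U 0 γ)))) ,
    proj₁ (typed (closed γ ⊢𝔰Prop₀))

  -- `wk (PropU 0)` computes to `PropU 0`, so this is a `Π` with constant family at the large size,
  -- the small domain being raised by cumulativity.
  →PropU-is : Γ ⊢ A ≈ A′ ∶ U 0 →
              Γ ⊢ A ⟶ PropU 0 , ⌜ 𝔰Π ⌝ · A · lam (PropU 0) · lam ⌜ 𝔰Prop₀ ⌝
                ≈ A′ ⟶ PropU 0 , ⌜ 𝔰Π ⌝ · A′ · lam (PropU 0) · lam ⌜ 𝔰Prop₀ ⌝ is type large
  →PropU-is A = Π-is large (cumul-≈ A) (is-refl {k = type large} (PropU-is (ctx-▸ (proj₁ A))))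

  -- The type of `pr₂ p` is `isProp #0` taken at `pr₁ p`, which computes to `isProp (pr₁ p)`. An
  -- equality of codes therefore yields equal types with equal proofs.
  pr-is : Γ ⊢ p ≈ q ∶ PropU 0 → Γ ⊢ pr₁ p , pr₂ p ≈ pr₁ q , pr₂ q is prop′ small
  pr-is d =
    let γ = ctx≈ d ; ⊢U = U-form γ ; ⊢isProp = cumul (proj₁ (isProp-≈ (#0-in-U 0 γ))) in
    pr₁-≈ ⊢U ⊢isProp d , pr₂-≈ ⊢U ⊢isProp d

  pair-code : Γ ⊢ A , p is prop′ small → Γ ⊢ pair A p ∶ PropU 0
  pair-code (A , p) = pair-∶ (proj₁ (isProp-≈ (#0-in-U 0 (⊢⇒ctx A)))) A p

  pr-code : Γ ⊢ A , p is prop′ small →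
            Γ ⊢ pr₁ (pair A p) , pr₂ (pair A p) ≈ A , p is prop′ small
  pr-code (A , p) =
    let γ = ⊢⇒ctx A ; ⊢U = U-form γ ; ⊢isProp = cumul (proj₁ (isProp-≈ (#0-in-U 0 γ))) in
    pr₁-β ⊢U ⊢isProp A p , pr₂-β ⊢U ⊢isProp A p

  -- `SetU` and `PropU` both unfold to this `Σ`, so one statement covers all four kinds.
  pair-truncated : ∀ k → Γ ⊢ A , w ≈ A′ , w′ is k →
                   Γ ⊢ pair A w ≐ pair A′ w′ ∶ Σ (U (universe k)) (truncated k #0)
  pair-truncated k ((A , A≐) , (w , w≐)) =
    pair-cong (proj₁ (truncated-≈ k (#0-in-U _ (⊢⇒ctx A)))) A≐
      (cast-≐ (sym (truncated-sub k #0)) w≐)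

-- Soundness of the total interpretation.

module Soundness (H : HITs) (𝔠 : ProofTerms H) where

  open HoTT H renaming (_×_ to _⊗_; refl to reflᵗ; subst to sub-∶; subst-≐ to sub-≐)
  open ProofTerms 𝔠 using (𝔰coe)
  open SyntaxProperties tt tt Op
  open Admissible H
  open DerivedRules H
  open TotalInterpretation H 𝔠
  open Definedness H 𝔠
  open TypeFormers H 𝔠
  open MTT using (Kind; type; prop′; Size; small; large)
  private module M = MTT

  private variable
    n m               : ℕ
    i                 : ℕ
    S                 : M.Sort
    k                 : Kind
    Γ Δ               : M.Ctx n
    Γ′                : Ctx n
    A′ B′ x y w w′    : Tm n
    a b p             : M.Tm n
    A B               : M.Ty n
    J                 : M.Judgement n

  -- The universe level is existential because a term judgement does not record the kind of its
  -- type.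
  Element : Ctx n → Tm n → Tm n → Set
  Element Γ a A = (∃ λ i → Γ ⊢ A ∶ U i) × (Γ ⊢ a ∶ A)

  EqualElements : Ctx n → Tm n → Tm n → Tm n → Set
  EqualElements Γ a b A = (∃ λ i → Γ ⊢ A ∶ U i) × (Γ ⊢ a ≈ b ∶ A) × (Γ ⊢ b ∶ A)

  witness : Kind → M.Ty n → Tm n
  witness (type z)  A = ∣ A ∣ˢ
  witness (prop′ z) A = ∣ A ∣ᵖ

  -- Both sides of an equality and the type of a term are required to be well-formed,
  -- since replacement of equals in HoTT needs typed substitutions.
  Valid : M.Ctx n → M.Judgement n → Set
  Valid Γ (A M.is k)     = ∣ Γ ∣ᶜ ⊢ ∣ A ∣ᵛ , witness k A is k
  Valid Γ (A M.≐ B is k) =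
    (∣ Γ ∣ᶜ ⊢ ∣ A ∣ᵛ , witness k A ≈ ∣ B ∣ᵛ , witness k B is k) ×
    (∣ Γ ∣ᶜ ⊢ ∣ B ∣ᵛ , witness k B is k)
  Valid Γ (a M.∈ A)      = Element ∣ Γ ∣ᶜ ∣ a ∣ᵛ ∣ A ∣ᵛ
  Valid Γ (a M.≐ b ∈ A)  = EqualElements ∣ Γ ∣ᶜ ∣ a ∣ᵛ ∣ b ∣ᵛ ∣ A ∣ᵛ

  ∣[]∣ : (e : M.Expr S (suc n)) (a : M.Tm n) → ∣ e M.[ a ] ∣ᵛ ≡ ∣ e ∣ᵛ [ ∣ a ∣ᵛ ]
  ∣[]∣ e a = ∣∣ᵛ-sub (λ { zero → refl ; (suc x) → refl }) e

  ∣[⨾]∣ : (e : M.Expr S (suc (suc n))) (a b : M.Tm n) →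
          ∣ e M.[ a ⨾ b ] ∣ᵛ ≡ ∣ e ∣ᵛ [ ∣ a ∣ᵛ ⨾ ∣ b ∣ᵛ ]
  ∣[⨾]∣ e a b = ∣∣ᵛ-sub (λ { zero → refl ; (suc zero) → refl ; (suc (suc x)) → refl }) e

  ∣↑∣ : ∀ k (e : M.Expr S (suc n)) (a : M.Tm (k ℕ.+ n)) →
        ∣ e M.↑ k [ a ] ∣ᵛ ≡ ∣ e ∣ᵛ ↑ k [ ∣ a ∣ᵛ ]
  ∣↑∣ k e a = ∣∣ᵛ-sub (λ { zero → refl ; (suc x) → refl }) e

  ∣wk∣ : (e : M.Expr S n) → ∣ M.wk e ∣ᵛ ≡ wk ∣ e ∣ᵛ
  ∣wk∣ = ∣∣ᵛ-ren

  ∣wk²∣ : (e : M.Expr S n) → ∣ M.wk (M.wk e) ∣ᵛ ≡ wk (wk ∣ e ∣ᵛ)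
  ∣wk²∣ e = trans (∣wk∣ (M.wk e)) (cong wk (∣wk∣ e))

  ↑-[] : ∀ {a : Tm (suc n)} {b c : Tm n} → (C : Tm (suc n)) →
         sub (var ▹ b) a ≡ c → (C ↑ 1 [ a ]) [ b ] ≡ C [ c ]
  ↑-[] C eq = sub-sub (λ { zero → eq ; (suc x) → refl }) C

  ↑-[⨾] : ∀ {a : Tm (suc (suc n))} {b c d : Tm n} → (C : Tm (suc n)) →
          sub (var ▹ b ▹ c) a ≡ d → (C ↑ 2 [ a ]) [ b ⨾ c ] ≡ C [ d ]
  ↑-[⨾] C eq = sub-sub (λ { zero → eq ; (suc x) → refl }) C

  in-[] : (C : M.Ty (suc n)) (a : M.Tm n) → Γ′ ▸ A′ ⊢ ∣ C ∣ᵛ ∶ U i → Γ′ ⊢ ∣ a ∣ᵛ ∶ A′ →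
          Γ′ ⊢ x ∶ ∣ C ∣ᵛ [ ∣ a ∣ᵛ ] → Element Γ′ x ∣ C M.[ a ] ∣ᵛ
  in-[] C a ⊢C ⊢a d rewrite ∣[]∣ C a = (_ , sub₁-∶ ⊢C ⊢a) , d

  eq-in-[] : (C : M.Ty (suc n)) (a : M.Tm n) → Γ′ ▸ A′ ⊢ ∣ C ∣ᵛ ∶ U i → Γ′ ⊢ ∣ a ∣ᵛ ∶ A′ →
             Γ′ ⊢ x ≈ y ∶ ∣ C ∣ᵛ [ ∣ a ∣ᵛ ] → Γ′ ⊢ y ∶ ∣ C ∣ᵛ [ ∣ a ∣ᵛ ] →
             EqualElements Γ′ x y ∣ C M.[ a ] ∣ᵛ
  eq-in-[] C a ⊢C ⊢a d e rewrite ∣[]∣ C a = (_ , sub₁-∶ ⊢C ⊢a) , d , e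

  in-[⨾] : (C : M.Ty (suc (suc n))) (a b : M.Tm n) → Γ′ ▸ A′ ▸ B′ ⊢ ∣ C ∣ᵛ ∶ U i →
           Γ′ ⊢ ∣ a ∣ᵛ ∶ A′ → Γ′ ⊢ ∣ b ∣ᵛ ∶ B′ [ ∣ a ∣ᵛ ] →
           Γ′ ⊢ x ∶ ∣ C ∣ᵛ [ ∣ a ∣ᵛ ⨾ ∣ b ∣ᵛ ] → Element Γ′ x ∣ C M.[ a ⨾ b ] ∣ᵛ
  in-[⨾] C a b ⊢C ⊢a ⊢b d rewrite ∣[⨾]∣ C a b = (_ , sub₂-∶ ⊢C ⊢a ⊢b) , d

  eq-in-[⨾] : (C : M.Ty (suc (suc n))) (a b : M.Tm n) → Γ′ ▸ A′ ▸ B′ ⊢ ∣ C ∣ᵛ ∶ U i →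
              Γ′ ⊢ ∣ a ∣ᵛ ∶ A′ → Γ′ ⊢ ∣ b ∣ᵛ ∶ B′ [ ∣ a ∣ᵛ ] →
              Γ′ ⊢ x ≈ y ∶ ∣ C ∣ᵛ [ ∣ a ∣ᵛ ⨾ ∣ b ∣ᵛ ] → Γ′ ⊢ y ∶ ∣ C ∣ᵛ [ ∣ a ∣ᵛ ⨾ ∣ b ∣ᵛ ] →
              EqualElements Γ′ x y ∣ C M.[ a ⨾ b ] ∣ᵛ
  eq-in-[⨾] C a b ⊢C ⊢a ⊢b d e rewrite ∣[⨾]∣ C a b = (_ , sub₂-∶ ⊢C ⊢a ⊢b) , d , e

  List-branch : (A : M.Ty n) (C : M.Ty (suc n)) →
    Γ′ ▸ List ∣ A ∣ᵛ ▸ ∣ M.wk A ∣ᵛ ▸ ∣ C M.↑ 2 [ M.#1 ] ∣ᵛ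
      ⊢ x ∶ ∣ C M.↑ 3 [ M.cons M.#2 M.#1 ] ∣ᵛ →
    Γ′ ▸ List ∣ A ∣ᵛ ▸ wk ∣ A ∣ᵛ ▸ ∣ C ∣ᵛ ↑ 2 [ #1 ] ⊢ x ∶ ∣ C ∣ᵛ ↑ 3 [ cons #2 #1 ]
  List-branch A C d
    rewrite ∣wk∣ A | ∣↑∣ 2 C M.#1 | ∣↑∣ 3 C (M.cons M.#2 M.#1) = d

  Id-motive : (A : M.Ty n) → Γ′ ▸ ∣ A ∣ᵛ ▸ ∣ M.wk A ∣ᵛ ⊢ x ∶ y → Γ′ ▸ ∣ A ∣ᵛ ▸ wk ∣ A ∣ᵛ ⊢ x ∶ y
  Id-motive A d rewrite ∣wk∣ A = d

  ∣diagonal∣ : (C : M.Ty (suc (suc n))) → ∣ C M.[ M.#0 ] ∣ᵛ ≡ diagonal ∣ C ∣ᵛ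
  ∣diagonal∣ C = ∣∣ᵛ-sub (λ { zero → refl ; (suc zero) → refl ; (suc (suc x)) → refl }) C

  cast-rhs : y ≡ x → EqualElements Γ′ w x A′ → EqualElements Γ′ w y A′
  cast-rhs refl d = d

  ∣sub∣ : (σ : M.Sub n m) (e : M.Expr S n) → ∣ M.sub σ e ∣ᵛ ≡ sub (λ x → ∣ σ x ∣ᵛ) ∣ e ∣ᵛ
  ∣sub∣ σ = ∣∣ᵛ-sub (λ _ → refl)

  witness-sub : ∀ k (σ : M.Sub n m) (A : M.Ty n) →
                witness k (M.sub σ A) ≡ sub (λ x → ∣ σ x ∣ᵛ) (witness k A)
  witness-sub (type z)  σ = ∣∣ˢ-sub (λ _ → refl)
  witness-sub (prop′ z) σ = ∣∣ᵖ-sub (λ _ → refl)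

  -- Leaving the propositional kinds replaces `prP` by `prS`. The hypotheses on heads guarantee that
  -- `prS` is `𝔰coe` applied to `prP`, so equal proofs stay equal; the other two inclusions use only
  -- cumulativity.
  subsume-valid : ∀ {k k′} → k M.⊑ k′ → (A B : M.Ty n) → KindOk k A → KindOk k B →
                  Γ′ ⊢ ∣ A ∣ᵛ , witness k A ≈ ∣ B ∣ᵛ , witness k B is k →
                  Γ′ ⊢ ∣ A ∣ᵛ , witness k′ A ≈ ∣ B ∣ᵛ , witness k′ B is k′
  subsume-valid M.propₛ⊑set A B p q (d , e)
    rewrite prS-proposition A p | prS-proposition B q = d , 𝔰coe-≈ (cumul-≈ d) e
  subsume-valid M.propₛ⊑prop A B p q (d , e) = cumul-≈ d , e
  subsume-valid M.set⊑col A B p q (d , e) = cumul-≈ d , e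
  subsume-valid M.prop⊑col A B p q (d , e)
    rewrite prS-proposition A p | prS-proposition B q = d , 𝔰coe-≈ d e

  module _ (σ σ′ : M.Sub n m) {Γ : Ctx n} {Δ : Ctx m} (δ : Δ ctx)
           (s : Δ ⊢ˢ (λ x → ∣ σ x ∣ᵛ) ≈ (λ x → ∣ σ′ x ∣ᵛ) ∶ Γ)
           (s′ : Δ ⊢ˢ (λ x → ∣ σ′ x ∣ᵛ) ∶ Γ) where

    sub-is : ∀ k (A : M.Ty n) → Γ ⊢ ∣ A ∣ᵛ , witness k A is k →
             (Δ ⊢ ∣ M.sub σ A ∣ᵛ , witness k (M.sub σ A)
                ≈ ∣ M.sub σ′ A ∣ᵛ , witness k (M.sub σ′ A) is k) ×
             (Δ ⊢ ∣ M.sub σ′ A ∣ᵛ , witness k (M.sub σ′ A) is k)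
    sub-is k A (d , e)
      rewrite ∣sub∣ σ A | ∣sub∣ σ′ A | witness-sub k σ A | witness-sub k σ′ A =
      (sub-≈ (≈-refl d) δ s , cast-≈ (truncated-sub k ∣ A ∣ᵛ) (sub-≈ (≈-refl e) δ s)) ,
      (sub-∶ d δ s′ , cast (truncated-sub k ∣ A ∣ᵛ) (sub-∶ e δ s′))

    sub-element : (a : M.Tm n) (A : M.Ty n) → Element Γ ∣ a ∣ᵛ ∣ A ∣ᵛ →
                  EqualElements Δ ∣ M.sub σ a ∣ᵛ ∣ M.sub σ′ a ∣ᵛ ∣ M.sub σ A ∣ᵛ
    sub-element a A ((i , d) , e)
      rewrite ∣sub∣ σ A | ∣sub∣ σ a | ∣sub∣ σ′ a =
      -- Under `σ′` the term is typed at the `σ′`-instance of `A`; the equality of the two instances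
      -- brings it back to the `σ`-instance.
      let A≈ = sub-≈ (≈-refl d) δ s in
      (i , proj₁ A≈) , sub-≈ (≈-refl e) δ s , conv (sub-∶ e δ s′) (≐-sym (proj₂ A≈))

  lookup-type : WF Γ′ → (x : Fin n) → ∃ λ i → Γ′ ⊢ lookup Γ′ x ∶ U i
  lookup-type (wf-▸ w d) zero    = _ , wk-∶ d d
  lookup-type (wf-▸ w d) (suc x) = _ , wk-∶ d (proj₂ (lookup-type w x))

  PropU-∶ : Γ′ ctx → ∃ λ i → Γ′ ⊢ PropU 0 ∶ U i
  PropU-∶ γ = _ , proj₁ (PropU-is γ)

  code-valid : Γ′ ⊢ A′ , w is prop′ small → Element Γ′ (pair A′ w) (PropU 0)
  code-valid d = PropU-∶ (⊢⇒ctx (proj₁ d)) , pair-code d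

  τ-valid : Γ′ ⊢ A′ , w is prop′ small →
            (Γ′ ⊢ pr₁ (pair A′ w) , pr₂ (pair A′ w) ≈ A′ , w is prop′ small) ×
            (Γ′ ⊢ A′ , w is prop′ small)
  τ-valid d = pr-code d , d

  -- The formation premises repeated in the rules supply the typings of families and motives that
  -- the HoTT rules require, so no inversion on type formers is involved.
  sound-ctx : Γ M.ctx → ∣ Γ ∣ᶜ ctx
  sound     : Γ M.⊢ J → Valid Γ J

  ⊢ty : Γ M.⊢ A M.is k → ∣ Γ ∣ᶜ ⊢ ∣ A ∣ᵛ ∶ U (universe k)
  ⊢ty d = proj₁ (sound d)

  ⊢tm : Γ M.⊢ a M.∈ A → ∣ Γ ∣ᶜ ⊢ ∣ a ∣ᵛ ∶ ∣ A ∣ᵛ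
  ⊢tm d = proj₂ (sound d)

  is≈ : Γ M.⊢ A M.is k → ∣ Γ ∣ᶜ ⊢ ∣ A ∣ᵛ , witness k A ≈ ∣ A ∣ᵛ , witness k A is k
  is≈ d = ≈-refl (proj₁ (sound d)) , ≈-refl (proj₂ (sound d))

  right≈ : Γ M.⊢ A M.≐ B is k → ∣ Γ ∣ᶜ ⊢ ∣ B ∣ᵛ , witness k B ≈ ∣ B ∣ᵛ , witness k B is k
  right≈ d = ≈-refl (proj₁ (proj₂ (sound d))) , ≈-refl (proj₂ (proj₂ (sound d)))

  -- Soundness of the second premise types `B₁` over the left-hand domain `A`, whereas the
  -- right-hand side of a congruence lives over `A₁`; the context is converted along the first
  -- premise.
  right≈-under : ∀ {A A₁ : M.Ty n} {B B₁ : M.Ty (suc n)} {k k′} →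
                 Γ M.⊢ A M.≐ A₁ is k → Γ M.▸ A M.⊢ B M.≐ B₁ is k′ →
                 ∣ Γ ∣ᶜ ▸ ∣ A₁ ∣ᵛ ⊢ ∣ B₁ ∣ᵛ , witness k′ B₁ ≈ ∣ B₁ ∣ᵛ , witness k′ B₁ is k′
  right≈-under d e =
    let A≐ , (⊢A₁ , _) = sound d ; _ , (⊢B₁ , ⊢w) = sound e ; q = proj₂ (proj₁ A≐) in
    ≈-refl (ctx-conv ⊢B₁ ⊢A₁ q) , ≈-refl (ctx-conv ⊢w ⊢A₁ q)

  τ≈ : Γ M.⊢ p M.∈ M.Propₛ →
       ∣ Γ ∣ᶜ ⊢ pr₁ ∣ p ∣ᵛ , pr₂ ∣ p ∣ᵛ ≈ pr₁ ∣ p ∣ᵛ , pr₂ ∣ p ∣ᵛ is prop′ small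
  τ≈ d = pr-is (≈-refl (⊢tm d))

  -- The interpreted code is by definition the pair of this type and this proof. The same fact
  -- therefore justifies both the introduction of the code and its decoding equation, and likewise
  -- for the other connectives.
  ∨ᶜ-is : ∀ {p q} → Γ M.⊢ p M.∈ M.Propₛ → Γ M.⊢ q M.∈ M.Propₛ →
          Valid Γ (M.τ p M.∨ M.τ q M.is M.propₛ)
  ∨ᶜ-is p q = is-left (∨-is small (proj₁ (τ≈ p)) (proj₁ (τ≈ q)))

  ∧ᶜ-is : ∀ {p q} → Γ M.⊢ p M.∈ M.Propₛ → Γ M.⊢ q M.∈ M.Propₛ →
          Valid Γ (M.τ p M.∧ M.τ q M.is M.propₛ)
  ∧ᶜ-is p q = is-left (∧-is small (τ≈ p) (τ≈ q))

  ⇒ᶜ-is : ∀ {p q} → Γ M.⊢ p M.∈ M.Propₛ → Γ M.⊢ q M.∈ M.Propₛ →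
          Valid Γ (M.τ p M.⇒ M.τ q M.is M.propₛ)
  ⇒ᶜ-is p q = is-left (⇒-is small (proj₁ (τ≈ p)) (τ≈ q))

  ∃ᶜ-is : ∀ {A p} → Γ M.⊢ A M.is M.set → Γ M.▸ A M.⊢ p M.∈ M.Propₛ →
          Valid Γ (M.Exists A (M.τ p) M.is M.propₛ)
  ∃ᶜ-is ⊢A p = is-left (∃-is small (proj₁ (is≈ ⊢A)) (proj₁ (τ≈ p)))

  ∀ᶜ-is : ∀ {A p} → Γ M.⊢ A M.is M.set → Γ M.▸ A M.⊢ p M.∈ M.Propₛ →
          Valid Γ (M.Forall A (M.τ p) M.is M.propₛ)
  ∀ᶜ-is ⊢A p = is-left (∀-is small (proj₁ (is≈ ⊢A)) (τ≈ p))

  Idᶜ-is : ∀ {A a b} → Γ M.⊢ A M.is M.set → Γ M.⊢ a M.∈ A → Γ M.⊢ b M.∈ A →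
           Valid Γ (M.Id A a b M.is M.propₛ)
  Idᶜ-is ⊢A a b = is-left (Id-is small (is≈ ⊢A) (≈-refl (⊢tm a)) (≈-refl (⊢tm b)))

  ⊢sub : {σ σ′ : M.Sub n m} (Γ : M.Ctx n) →
         (∀ x → Δ M.⊢ σ x M.≐ σ′ x ∈ M.sub σ (M.lookup Γ x)) →
         ∣ Δ ∣ᶜ ⊢ˢ (λ x → ∣ σ x ∣ᵛ) ≈ (λ x → ∣ σ′ x ∣ᵛ) ∶ ∣ Γ ∣ᶜ
  ⊢sub {σ = σ} Γ s x =
    cast-≈ (trans (∣sub∣ σ (M.lookup Γ x)) (cong (sub _) (∣∣-lookup Γ x)))
      (proj₁ (proj₂ (sound (s x))))

  -- `Valid` types each entry of `σ′` only at a type instantiated by `σ`; `⊢ˢ-right` changes these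
  -- to the types instantiated by `σ′`.
  ⊢sub-right : {σ σ′ : M.Sub n m} (Γ : M.Ctx n) → ∣ Γ ∣ᶜ ctx → ∣ Δ ∣ᶜ ctx →
               (∀ x → Δ M.⊢ σ x M.≐ σ′ x ∈ M.sub σ (M.lookup Γ x)) →
               ∣ Δ ∣ᶜ ⊢ˢ (λ x → ∣ σ′ x ∣ᵛ) ∶ ∣ Γ ∣ᶜ
  ⊢sub-right {σ = σ} Γ γ δ s =
    ⊢ˢ-right (ctx⇒wf γ) δ (⊢sub Γ s) λ x →
      cast (trans (∣sub∣ σ (M.lookup Γ x)) (cong (sub _) (∣∣-lookup Γ x)))
        (proj₂ (proj₂ (sound (s x))))

  sound-ctx M.ctx-∅     = ctx-∅
  sound-ctx (M.ctx-▸ d) = ctx-▸ (⊢ty d)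

  sound (M.var-∈ {Γ = Γ} γ x) rewrite ∣∣-lookup Γ x =
    lookup-type (ctx⇒wf (sound-ctx γ)) x , var-∶ (sound-ctx γ) x

  sound (M.ty-refl d) = is≈ d , sound d
  sound (M.ty-sym {k = k} d) =
    let d≈ , r = sound d in is-sym k d≈ r , is-left d≈
  sound (M.ty-trans {k = k} d e) =
    is-trans k (proj₁ (sound d)) (proj₁ (sound e)) , proj₂ (sound e)
  sound (M.tm-refl d) = let A , a = sound d in A , ≈-refl a , a
  sound (M.tm-sym d) = let A , (a , a≐) , b = sound d in A , (b , ≐-sym a≐) , a
  sound (M.tm-trans d e) =
    let A , (a , a≐) , _ = sound d ; _ , (_ , b≐) , c = sound e in
    A , (a , ≐-trans a≐ b≐) , c

  sound (M.conv d e) =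
    let (A≈ , _) , (B , _) = sound e in (_ , B) , conv (⊢tm d) (proj₂ A≈)
  sound (M.conv-≐ d e) =
    let (A≈ , _) , (B , _) = sound e ; _ , a≈ , b = sound d in
    (_ , B) , conv-≈ a≈ (proj₂ A≈) , conv b (proj₂ A≈)

  sound (M.subsume {A = A} i d) =
    let _ , p = okJ d in is-left (subsume-valid i A A p p (is≈ d))
  sound (M.subsume-≐ {A = A} {B = B} i d) =
    let (_ , p) , (_ , q) = okJ d ; d≈ , r = sound d in
    subsume-valid i A B p q d≈ , is-left (subsume-valid i B B q q (right≈ d))

  sound (M.repl-ty {C = C} {k = k} {σ = σ} {σ′ = σ′} {Γ = Γ} d δ s) =
    let ⊢C = sound d ; ⊢δ = sound-ctx δ in
    -- `repl-ty` has no premise that `Γ` is a context; this is read off from the interpreted typing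
    -- of `C`.
    sub-is σ σ′ ⊢δ (⊢sub Γ s) (⊢sub-right Γ (⊢⇒ctx (proj₁ ⊢C)) ⊢δ s) k C ⊢C
  sound (M.repl-tm {c = c} {C = C} {σ = σ} {σ′ = σ′} {Γ = Γ} d δ s) =
    let ⊢c = sound d ; ⊢δ = sound-ctx δ in
    sub-element σ σ′ ⊢δ (⊢sub Γ s) (⊢sub-right Γ (⊢⇒ctx (proj₂ ⊢c)) ⊢δ s) c C ⊢c

  sound (M.N₀-form γ) = 𝟎-isSet (sound-ctx γ)
  sound (M.N₀-elim {C = C} {e = e} ⊢C d) =
    in-[] C e (⊢ty ⊢C) (⊢tm d) (ind𝟎-∶ (⊢ty ⊢C) (⊢tm d))

  sound (M.N₁-form γ) = 𝟏-isSet (sound-ctx γ)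
  sound (M.N₁-intro γ) = (0 , 𝟏-form (sound-ctx γ)) , ⋆-∶ (sound-ctx γ)
  sound (M.N₁-elim {C = C} {e = e} ⊢C d c) =
    in-[] C e (⊢ty ⊢C) (⊢tm d) (ind𝟏-∶ (⊢ty ⊢C) (⊢tm d) (cast (∣[]∣ C M.⋆) (⊢tm c)))
  sound (M.N₁-β {C = C} ⊢C c) =
    let c′ = cast (∣[]∣ C M.⋆) (⊢tm c) ; ⋆′ = ⋆-∶ (⊢⇒ctx c′) in
    eq-in-[] C M.⋆ (⊢ty ⊢C) ⋆′ (ind𝟏-∶ (⊢ty ⊢C) ⋆′ c′ , 𝟏-β (⊢ty ⊢C) c′) c′

  sound (M.List-form d) = is-left (List-is small (is≈ d))
  sound (M.List-cong d) =
    List-is small (proj₁ (sound d)) , is-left (List-is small (right≈ d))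
  sound (M.List-ε d) = (_ , List-form (⊢ty d)) , nil-∶ (⊢ty d)
  sound (M.List-cons ⊢A l a) = (_ , List-form (⊢ty ⊢A)) , cons-∶ (⊢tm l) (⊢tm a)
  sound (M.List-elim {A = A} {C = C} {l = l} _ ⊢C ⊢l c d) =
    in-[] C l (⊢ty ⊢C) (⊢tm ⊢l)
      (indList-∶ (⊢ty ⊢C) (⊢tm ⊢l) (cast (∣[]∣ C M.ε) (⊢tm c)) (List-branch A C (⊢tm d)))
  sound (M.List-βε {A = A} {C = C} ⊢A ⊢C c d) =
    let ⊢ε = nil-∶ (⊢ty ⊢A) ; c′ = cast (∣[]∣ C M.ε) (⊢tm c) ; d′ = List-branch A C (⊢tm d) in
    eq-in-[] C M.ε (⊢ty ⊢C) ⊢ε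
      (indList-∶ (⊢ty ⊢C) ⊢ε c′ d′ , List-βnil (⊢ty ⊢C) c′ d′) c′
  sound (M.List-βcons {A = A} {C = C} {l = l} {a = a} {c = c} {d = d} ⊢A ⊢C ⊢l ⊢a ⊢c ⊢d) =
    let c′ = cast (∣[]∣ C M.ε) (⊢tm ⊢c)
        d′ = List-branch A C (⊢tm ⊢d)
        al = cons-∶ (⊢tm ⊢l) (⊢tm ⊢a)
    in cast-rhs (∣∣ᵛ-sub (λ where zero                → refl
                                  (suc zero)          → refl
                                  (suc (suc zero))    → refl
                                  (suc (suc (suc x))) → refl) d)
      (eq-in-[] C (M.cons l a) (⊢ty ⊢C) al
        (indList-∶ (⊢ty ⊢C) al c′ d′ , List-βcons (⊢ty ⊢C) (⊢tm ⊢l) (⊢tm ⊢a) c′ d′)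
        -- The right-hand side has to be typed as well: the branch is instantiated at `l`, `a` and
        -- the recursive value, which itself has the motive at `l` as its type.
        (cast (sub-sub (λ { zero → refl ; (suc x) → refl }) ∣ C ∣ᵛ)
          (sub₃-∶ d′ (⊢tm ⊢l) (cast (sym (wk-[] ∣ A ∣ᵛ)) (⊢tm ⊢a))
            (cast (sym (sub-sub (λ { zero → refl ; (suc x) → refl }) ∣ C ∣ᵛ))
              (indList-∶ (⊢ty ⊢C) (⊢tm ⊢l) c′ d′)))))

  sound (M.+-form d e) = is-left (+-is small (is≈ d) (is≈ e))
  sound (M.+-cong d e) =
    +-is small (proj₁ (sound d)) (proj₁ (sound e)) ,
    is-left (+-is small (right≈ d) (right≈ e))
  sound (M.+-inl ⊢A ⊢B a) =
    (_ , +-form (⊢ty ⊢A) (⊢ty ⊢B)) , inl-∶ (⊢ty ⊢A) (⊢ty ⊢B) (⊢tm a)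
  sound (M.+-inr ⊢A ⊢B b) =
    (_ , +-form (⊢ty ⊢A) (⊢ty ⊢B)) , inr-∶ (⊢ty ⊢A) (⊢ty ⊢B) (⊢tm b)
  sound (M.+-elim {C = C} {e = e} _ _ ⊢C ⊢e c d) =
    in-[] C e (⊢ty ⊢C) (⊢tm ⊢e)
      (ind+-∶ (⊢ty ⊢C) (⊢tm ⊢e) (cast (∣↑∣ 1 C (M.inl M.#0)) (⊢tm c))
                                (cast (∣↑∣ 1 C (M.inr M.#0)) (⊢tm d)))
  sound (M.+-βinl {C = C} {a = a} {c = c} ⊢A ⊢B ⊢C ⊢a ⊢c ⊢d) =
    let c′ = cast (∣↑∣ 1 C (M.inl M.#0)) (⊢tm ⊢c)
        d′ = cast (∣↑∣ 1 C (M.inr M.#0)) (⊢tm ⊢d)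
        e′ = inl-∶ (⊢ty ⊢A) (⊢ty ⊢B) (⊢tm ⊢a)
    in cast-rhs (∣[]∣ c a)
      (eq-in-[] C (M.inl a) (⊢ty ⊢C) e′
        (ind+-∶ (⊢ty ⊢C) e′ c′ d′ , +-βinl (⊢ty ⊢C) (⊢tm ⊢a) c′ d′)
        (cast (↑-[] ∣ C ∣ᵛ refl) (sub₁-∶ c′ (⊢tm ⊢a))))
  sound (M.+-βinr {C = C} {b = b} {d = d} ⊢A ⊢B ⊢C ⊢b ⊢c ⊢d) =
    let c′ = cast (∣↑∣ 1 C (M.inl M.#0)) (⊢tm ⊢c)
        d′ = cast (∣↑∣ 1 C (M.inr M.#0)) (⊢tm ⊢d)
        e′ = inr-∶ (⊢ty ⊢A) (⊢ty ⊢B) (⊢tm ⊢b)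
    in cast-rhs (∣[]∣ d b)
      (eq-in-[] C (M.inr b) (⊢ty ⊢C) e′
        (ind+-∶ (⊢ty ⊢C) e′ c′ d′ , +-βinr (⊢ty ⊢C) (⊢tm ⊢b) c′ d′)
        (cast (↑-[] ∣ C ∣ᵛ refl) (sub₁-∶ d′ (⊢tm ⊢b))))

  sound (M.Σ-form {z = z} d e) = is-left (Σ-is z (is≈ d) (is≈ e))
  sound (M.Σ-cong {z = z} d e) =
    Σ-is z (proj₁ (sound d)) (proj₁ (sound e)) ,
    is-left (Σ-is z (right≈ d) (right≈-under d e))
  sound (M.Σ-intro {B = B} {a = a} ⊢A ⊢B ⊢a ⊢b) =
    (_ , Σ-form (⊢ty ⊢A) (⊢ty ⊢B)) , pair-∶ (⊢ty ⊢B) (⊢tm ⊢a) (cast (∣[]∣ B a) (⊢tm ⊢b))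
  sound (M.Σ-elim {C = C} {e = e} _ _ ⊢C ⊢e c) =
    in-[] C e (⊢ty ⊢C) (⊢tm ⊢e)
      (indΣ-∶ (⊢ty ⊢C) (⊢tm ⊢e) (cast (∣↑∣ 2 C (M.pair M.#1 M.#0)) (⊢tm c)))
  sound (M.Σ-β {B = B} {C = C} {a = a} {b = b} {c = c} ⊢A ⊢B ⊢C ⊢a ⊢b ⊢c) =
    let b′ = cast (∣[]∣ B a) (⊢tm ⊢b)
        c′ = cast (∣↑∣ 2 C (M.pair M.#1 M.#0)) (⊢tm ⊢c)
        e′ = pair-∶ (⊢ty ⊢B) (⊢tm ⊢a) b′
    in cast-rhs (∣[⨾]∣ c a b)
      (eq-in-[] C (M.pair a b) (⊢ty ⊢C) e′
        (indΣ-∶ (⊢ty ⊢C) e′ c′ , Σ-β (⊢ty ⊢C) (⊢tm ⊢a) b′ c′)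
        (cast (↑-[⨾] ∣ C ∣ᵛ refl) (sub₂-∶ c′ (⊢tm ⊢a) b′)))

  sound (M.Π-form d e) = is-left (Π-is small (proj₁ (is≈ d)) (is≈ e))
  sound (M.Π-cong d e) =
    Π-is small (proj₁ (proj₁ (sound d))) (proj₁ (sound e)) ,
    is-left (Π-is small (proj₁ (right≈ d)) (right≈-under d e))
  sound (M.Π-intro ⊢A ⊢B b) = (_ , Π-form (⊢ty ⊢A) (⊢ty ⊢B)) , lam-∶ (⊢tm b)
  sound (M.Π-elim {B = B} {a = a} ⊢A ⊢B f ⊢a) =
    in-[] B a (⊢ty ⊢B) (⊢tm ⊢a) (app-∶ (⊢tm f) (⊢tm ⊢a))
  sound (M.Π-β {B = B} {b = b} {a = a} ⊢A ⊢B ⊢b ⊢a) =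
    cast-rhs (∣[]∣ b a)
      (eq-in-[] B a (⊢ty ⊢B) (⊢tm ⊢a)
        (app-∶ (lam-∶ (⊢tm ⊢b)) (⊢tm ⊢a) , Π-β (⊢tm ⊢b) (⊢tm ⊢a))
        (sub₁-∶ (⊢tm ⊢b) (⊢tm ⊢a)))

  sound (M.Propₛ-form γ) = PropU-is (sound-ctx γ)
  sound (M.→Propₛ-form d) = is-left (→PropU-is (proj₁ (is≈ d)))
  sound (M.→Propₛ-cong d) =
    →PropU-is (proj₁ (proj₁ (sound d))) , is-left (→PropU-is (proj₁ (right≈ d)))
  sound (M.→Propₛ-intro ⊢A p) =
    (_ , proj₁ (proj₁ (→PropU-is (proj₁ (is≈ ⊢A))))) , lam-∶ (⊢tm p)
  sound (M.→Propₛ-elim ⊢A f a) = PropU-∶ (⊢⇒ctx (⊢tm a)) , app-∶ (⊢tm f) (⊢tm a)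
  sound (M.→Propₛ-β {p = p} {a = a} ⊢A ⊢p ⊢a) =
    cast-rhs (∣[]∣ p a)
      (PropU-∶ (⊢⇒ctx (⊢tm ⊢a)) ,
       (app-∶ (lam-∶ (⊢tm ⊢p)) (⊢tm ⊢a) , Π-β (⊢tm ⊢p) (⊢tm ⊢a)) ,
       sub₁-∶ (⊢tm ⊢p) (⊢tm ⊢a))

  sound (M.⊥-form γ) = 𝟎-isProp (sound-ctx γ)
  sound (M.⊥-elim {C = C} ⊢C e) =
    (_ , ⊢ty ⊢C) ,
    -- `𝟎` lies in every universe, so its level has to be chosen; the motive is constant because `C`
    -- does not depend on the refutation.
    cast (wk-[] ∣ C ∣ᵛ) (ind𝟎-∶ (wk-∶ (𝟎-form {i = 0} (⊢⇒ctx (⊢tm e))) (⊢ty ⊢C)) (⊢tm e))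

  sound (M.∨-form {z = z} d e) = is-left (∨-is z (proj₁ (is≈ d)) (proj₁ (is≈ e)))
  sound (M.∨-cong {z = z} d e) =
    ∨-is z (proj₁ (proj₁ (sound d))) (proj₁ (proj₁ (sound e))) ,
    is-left (∨-is z (proj₁ (right≈ d)) (proj₁ (right≈ e)))
  sound (M.∨-inl ⊢A ⊢B a) =
    (_ , ∥∥-form (+-form (⊢ty ⊢A) (⊢ty ⊢B))) , ∣∣-∶ (inl-∶ (⊢ty ⊢A) (⊢ty ⊢B) (⊢tm a))
  sound (M.∨-inr ⊢A ⊢B b) =
    (_ , ∥∥-form (+-form (⊢ty ⊢A) (⊢ty ⊢B))) , ∣∣-∶ (inr-∶ (⊢ty ⊢A) (⊢ty ⊢B) (⊢tm b))
  sound (M.∨-elim {C = C} ⊢A ⊢B ⊢C e c d) =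
    (_ , ⊢ty ⊢C) ,
    ind∨-∶ (⊢ty ⊢A) (⊢ty ⊢B) (⊢ty ⊢C) (⊢tm e)
      (cast (∣wk∣ C) (⊢tm c)) (cast (∣wk∣ C) (⊢tm d)) (proj₂ (sound ⊢C))
  sound (M.∨-βinl {C = C} {a = a} {c = c} ⊢A ⊢B ⊢C ⊢a ⊢c ⊢d) =
    let c′ = cast (∣wk∣ C) (⊢tm ⊢c) in
    cast-rhs (∣[]∣ c a)
      ((_ , ⊢ty ⊢C) ,
       ind∨-βinl (⊢ty ⊢A) (⊢ty ⊢B) (⊢ty ⊢C) (⊢tm ⊢a)
         c′ (cast (∣wk∣ C) (⊢tm ⊢d)) (proj₂ (sound ⊢C)) ,
       cast (wk-[] ∣ C ∣ᵛ) (sub₁-∶ c′ (⊢tm ⊢a)))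
  sound (M.∨-βinr {C = C} {b = b} {d = d} ⊢A ⊢B ⊢C ⊢b ⊢c ⊢d) =
    let d′ = cast (∣wk∣ C) (⊢tm ⊢d) in
    cast-rhs (∣[]∣ d b)
      ((_ , ⊢ty ⊢C) ,
       ind∨-βinr (⊢ty ⊢A) (⊢ty ⊢B) (⊢ty ⊢C) (⊢tm ⊢b)
         (cast (∣wk∣ C) (⊢tm ⊢c)) d′ (proj₂ (sound ⊢C)) ,
       cast (wk-[] ∣ C ∣ᵛ) (sub₁-∶ d′ (⊢tm ⊢b)))

  sound (M.∧-form {z = z} d e) = is-left (∧-is z (is≈ d) (is≈ e))
  sound (M.∧-cong {z = z} d e) =
    ∧-is z (proj₁ (sound d)) (proj₁ (sound e)) ,
    is-left (∧-is z (right≈ d) (right≈ e))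
  sound (M.∧-intro {B = B} ⊢A ⊢B a b) =
    let ⊢B′ = wk-∶ (⊢ty ⊢A) (⊢ty ⊢B) in
    (_ , Σ-form (⊢ty ⊢A) ⊢B′) , pair-∶ ⊢B′ (⊢tm a) (cast (sym (wk-[] ∣ B ∣ᵛ)) (⊢tm b))
  sound (M.∧-π₁ ⊢A ⊢B e) =
    (_ , ⊢ty ⊢A) ,
    proj₁ (pr₁-≈ (⊢ty ⊢A) (wk-∶ (⊢ty ⊢A) (⊢ty ⊢B)) (≈-refl (⊢tm e)))
  sound (M.∧-π₂ {B = B} ⊢A ⊢B e) =
    (_ , ⊢ty ⊢B) ,
    cast (wk-[] ∣ B ∣ᵛ)
      (proj₁ (pr₂-≈ (⊢ty ⊢A) (wk-∶ (⊢ty ⊢A) (⊢ty ⊢B)) (≈-refl (⊢tm e))))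
  sound (M.∧-β₁ {B = B} ⊢A ⊢B a b) =
    (_ , ⊢ty ⊢A) ,
    pr₁-β (⊢ty ⊢A) (wk-∶ (⊢ty ⊢A) (⊢ty ⊢B)) (⊢tm a) (cast (sym (wk-[] ∣ B ∣ᵛ)) (⊢tm b)) ,
    ⊢tm a
  sound (M.∧-β₂ {B = B} ⊢A ⊢B a b) =
    (_ , ⊢ty ⊢B) ,
    cast-≈ (wk-[] ∣ B ∣ᵛ)
      (pr₂-β (⊢ty ⊢A) (wk-∶ (⊢ty ⊢A) (⊢ty ⊢B)) (⊢tm a) (cast (sym (wk-[] ∣ B ∣ᵛ)) (⊢tm b))) ,
    ⊢tm b

  sound (M.⇒-form {z = z} d e) = is-left (⇒-is z (proj₁ (is≈ d)) (is≈ e))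
  sound (M.⇒-cong {z = z} d e) =
    ⇒-is z (proj₁ (proj₁ (sound d))) (proj₁ (sound e)) ,
    is-left (⇒-is z (proj₁ (right≈ d)) (right≈ e))
  sound (M.⇒-intro {B = B} ⊢A ⊢B b) =
    (_ , Π-form (⊢ty ⊢A) (wk-∶ (⊢ty ⊢A) (⊢ty ⊢B))) , lam-∶ (cast (∣wk∣ B) (⊢tm b))
  sound (M.⇒-elim {B = B} ⊢A ⊢B f a) =
    (_ , ⊢ty ⊢B) , cast (wk-[] ∣ B ∣ᵛ) (app-∶ (⊢tm f) (⊢tm a))
  sound (M.⇒-β {B = B} {b = b} {a = a} ⊢A ⊢B ⊢b ⊢a) =
    let b′ = cast (∣wk∣ B) (⊢tm ⊢b) in
    cast-rhs (∣[]∣ b a)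
      ((_ , ⊢ty ⊢B) ,
       cast-≈ (wk-[] ∣ B ∣ᵛ) (app-∶ (lam-∶ b′) (⊢tm ⊢a) , Π-β b′ (⊢tm ⊢a)) ,
       cast (wk-[] ∣ B ∣ᵛ) (sub₁-∶ b′ (⊢tm ⊢a)))

  sound (M.∃-form {z = z} d e) = is-left (∃-is z (proj₁ (is≈ d)) (proj₁ (is≈ e)))
  sound (M.∃-cong {z = z} d e) =
    ∃-is z (proj₁ (proj₁ (sound d))) (proj₁ (proj₁ (sound e))) ,
    is-left (∃-is z (proj₁ (right≈ d)) (proj₁ (right≈-under d e)))
  sound (M.∃-intro {B = B} {a = a} ⊢A ⊢B ⊢a ⊢b) =
    (_ , ∥∥-form (Σ-form (⊢ty ⊢A) (⊢ty ⊢B))) ,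
    ∣∣-∶ (pair-∶ (⊢ty ⊢B) (⊢tm ⊢a) (cast (∣[]∣ B a) (⊢tm ⊢b)))
  sound (M.∃-elim {C = C} ⊢A ⊢B ⊢C e c) =
    (_ , ⊢ty ⊢C) ,
    ind∃-∶ (⊢ty ⊢A) (⊢ty ⊢B) (⊢ty ⊢C) (⊢tm e) (cast (∣wk²∣ C) (⊢tm c)) (proj₂ (sound ⊢C))
  sound (M.∃-β {B = B} {C = C} {a = a} {b = b} {c = c} ⊢A ⊢B ⊢C ⊢a ⊢b ⊢c) =
    let b′ = cast (∣[]∣ B a) (⊢tm ⊢b) ; c′ = cast (∣wk²∣ C) (⊢tm ⊢c) in
    cast-rhs (∣[⨾]∣ c a b)
      ((_ , ⊢ty ⊢C) ,
       ind∃-β (⊢ty ⊢A) (⊢ty ⊢B) (⊢ty ⊢C) (⊢tm ⊢a) b′ c′ (proj₂ (sound ⊢C)) ,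
       cast (trans (sub-▹-wk (wk ∣ C ∣ᵛ)) (wk-[] ∣ C ∣ᵛ)) (sub₂-∶ c′ (⊢tm ⊢a) b′))

  sound (M.∀-form {z = z} d e) = is-left (∀-is z (proj₁ (is≈ d)) (is≈ e))
  sound (M.∀-cong {z = z} d e) =
    ∀-is z (proj₁ (proj₁ (sound d))) (proj₁ (sound e)) ,
    is-left (∀-is z (proj₁ (right≈ d)) (right≈-under d e))
  sound (M.∀-intro ⊢A ⊢B b) = (_ , Π-form (⊢ty ⊢A) (⊢ty ⊢B)) , lam-∶ (⊢tm b)
  sound (M.∀-elim {B = B} {a = a} ⊢A ⊢B f ⊢a) =
    in-[] B a (⊢ty ⊢B) (⊢tm ⊢a) (app-∶ (⊢tm f) (⊢tm ⊢a))
  sound (M.∀-β {B = B} {b = b} {a = a} ⊢A ⊢B ⊢b ⊢a) =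
    cast-rhs (∣[]∣ b a)
      (eq-in-[] B a (⊢ty ⊢B) (⊢tm ⊢a)
        (app-∶ (lam-∶ (⊢tm ⊢b)) (⊢tm ⊢a) , Π-β (⊢tm ⊢b) (⊢tm ⊢a))
        (sub₁-∶ (⊢tm ⊢b) (⊢tm ⊢a)))

  sound (M.Id-form {z = z} ⊢A a b) =
    is-left (Id-is z (is≈ ⊢A) (≈-refl (⊢tm a)) (≈-refl (⊢tm b)))
  sound (M.Id-cong {z = z} ⊢A a b) =
    let A≈ , _ = sound ⊢A ; _ , a≈ , a′ = sound a ; _ , b≈ , b′ = sound b
        A≐ = proj₂ (proj₁ A≈)
    in Id-is z A≈ a≈ b≈ ,
       -- The right-hand endpoints are known only at the type `A`, while the right-hand identity
       -- type needs them at `A′`.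
       is-left (Id-is z (right≈ ⊢A) (≈-refl (conv a′ A≐)) (≈-refl (conv b′ A≐)))
  sound (M.Id-intro ⊢A a) = (_ , Id-form (⊢ty ⊢A) (⊢tm a) (⊢tm a)) , refl-∶ (⊢tm a)
  sound (M.Id-elim {A = A} {C = C} {a = a} {b = b} ⊢A ⊢C ⊢a ⊢b p c) =
    let C′ = Id-motive A (⊢ty ⊢C) in
    in-[⨾] C a b C′ (⊢tm ⊢a) (cast (sym (wk-[] ∣ A ∣ᵛ)) (⊢tm ⊢b))
      (transport-∶ (⊢ty ⊢A) C′ (⊢tm ⊢a) (⊢tm ⊢b) (⊢tm p) (cast (∣diagonal∣ C) (⊢tm c)))
  sound (M.Id-β {A = A} {C = C} {a = a} {c = c} ⊢A ⊢C ⊢a ⊢c) =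
    let C′ = Id-motive A (⊢ty ⊢C) ; c′ = cast (∣diagonal∣ C) (⊢tm ⊢c) in
    cast-rhs (∣[]∣ c a)
      (eq-in-[⨾] C a a C′ (⊢tm ⊢a) (cast (sym (wk-[] ∣ A ∣ᵛ)) (⊢tm ⊢a))
        (transport-β (⊢ty ⊢A) C′ (⊢tm ⊢a) c′)
        (cast (sub-sub (λ { zero → refl ; (suc zero) → refl ; (suc (suc x)) → refl }) ∣ C ∣ᵛ)
          (sub₁-∶ c′ (⊢tm ⊢a))))

  sound (M.⊥ᶜ-intro γ) = code-valid (𝟎-isProp (sound-ctx γ))
  sound (M.∨ᶜ-intro p q) = code-valid (∨ᶜ-is p q)
  sound (M.∧ᶜ-intro p q) = code-valid (∧ᶜ-is p q)
  sound (M.⇒ᶜ-intro p q) = code-valid (⇒ᶜ-is p q)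
  sound (M.∃ᶜ-intro A p) = code-valid (∃ᶜ-is A p)
  sound (M.∀ᶜ-intro A p) = code-valid (∀ᶜ-is A p)
  sound (M.Idᶜ-intro A a b) = code-valid (Idᶜ-is A a b)

  sound (M.τ-form p) = is-left (τ≈ p)
  sound (M.τ-cong d) =
    let _ , p≈ , q = sound d in pr-is p≈ , is-left (pr-is (≈-refl q))
  sound (M.τ-⊥ᶜ γ) = τ-valid (𝟎-isProp (sound-ctx γ))
  sound (M.τ-∨ᶜ p q) = τ-valid (∨ᶜ-is p q)
  sound (M.τ-∧ᶜ p q) = τ-valid (∧ᶜ-is p q)
  sound (M.τ-⇒ᶜ p q) = τ-valid (⇒ᶜ-is p q)
  sound (M.τ-∃ᶜ A p) = τ-valid (∃ᶜ-is A p)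
  sound (M.τ-∀ᶜ A p) = τ-valid (∀ᶜ-is A p)
  sound (M.τ-Idᶜ A a b) = τ-valid (Idᶜ-is A a b)

  -- Return to the partial interpretation.

  open Interpretation H 𝔠
    using (⟦_⟧ᴶ; isSet-via-coe; Holds; level)

  judgements : M.Judgement n → List.List (Judgement n)
  judgements (A M.is k)     = (∣ A ∣ᵛ ∶ U (universe k)) ∷ (witness k A ∶ truncated k ∣ A ∣ᵛ) ∷ []
  judgements (A M.≐ B is k) =
    (pair ∣ A ∣ᵛ (witness k A) ≐ pair ∣ B ∣ᵛ (witness k B)
       ∶ Σ (U (universe k)) (truncated k #0)) ∷ []
  judgements (a M.∈ A)      = (∣ a ∣ᵛ ∶ ∣ A ∣ᵛ) ∷ []
  judgements (a M.≐ b ∈ A)  = (∣ a ∣ᵛ ≐ ∣ b ∣ᵛ ∶ ∣ A ∣ᵛ) ∷ []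

  ⟦⟧ᴶ-def : (J : M.Judgement n) → OkJudgement J → ⟦ J ⟧ᴶ ≡ just (judgements J)
  ⟦⟧ᴶ-def (A M.is type z) (h , _) rewrite ⟦⟧-def A h | prS-def A h = refl
  ⟦⟧ᴶ-def (A M.is prop′ z) (h , p) rewrite ⟦⟧-def A h | prP-def A h p = refl
  ⟦⟧ᴶ-def (A M.≐ B is type z) ((h , _) , (i , _))
    rewrite ⟦⟧-def A h | prS-def A h | ⟦⟧-def B i | prS-def B i = refl
  ⟦⟧ᴶ-def (A M.≐ B is prop′ z) ((h , p) , (i , q))
    rewrite ⟦⟧-def A h | prP-def A h p | ⟦⟧-def B i | prP-def B i q = refl
  ⟦⟧ᴶ-def (a M.∈ A) (h , i) rewrite ⟦⟧-def a h | ⟦⟧-def A i = refl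
  ⟦⟧ᴶ-def (a M.≐ b ∈ A) (h , i , j)
    rewrite ⟦⟧-def a h | ⟦⟧-def b i | ⟦⟧-def A j = refl

  valid⇒derivable : (J : M.Judgement n) → Valid Γ J → All (∣ Γ ∣ᶜ ⊢_) (judgements J)
  valid⇒derivable (A M.is k)     (d , e)           = d ∷ e ∷ []
  valid⇒derivable (A M.≐ B is k) (d , _)           = pair-truncated k d ∷ []
  valid⇒derivable (a M.∈ A)      (_ , d)           = d ∷ []
  valid⇒derivable (a M.≐ b ∈ A)  (_ , (_ , d) , _) = d ∷ []

  ⟦⟧ᴶ-holds : (Γ : M.Ctx n) (J : M.Judgement n) → Γ M.⊢ J → Holds Γ ⟦ J ⟧ᴶ
  ⟦⟧ᴶ-holds Γ J d = record
    { context-def    = ⟦⟧ᶜ-def Γ (okΓ d)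
    ; judgements-def = ⟦⟧ᴶ-def J (okJ d)
    ; derivable      = valid⇒derivable J (sound d)
    }

  isSet-via-coe-def : (P : M.Ty n) → Ok P → IsProposition P →
    isSet-via-coe P ≡ just ((⌜ 𝔰coe ⌝ · ∣ P ∣ᵛ · ∣ P ∣ᵖ ∶ isSet ∣ P ∣ᵛ) ∷ [])
  isSet-via-coe-def P h p rewrite ⟦⟧-def P h | prP-def P h p = refl

  isSet-via-coe-holds : ∀ z (Γ : M.Ctx n) (P : M.Ty n) → Γ M.⊢ P M.is prop′ z →
                        Holds Γ (isSet-via-coe P)
  isSet-via-coe-holds z Γ P d = record
    { context-def    = ⟦⟧ᶜ-def Γ (okΓ d)
    ; judgements-def = let h , p = okJ d in isSet-via-coe-def P h p
    ; derivable      = proj₁ (𝔰coe-≈ (level-≤1 z (≈-refl (⊢ty d))) (≈-refl (proj₂ (sound d)))) ∷ []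
    }

theorem3p3 :
  (H : HITs) (𝔠 : ProofTerms H) →
  let open Interpretation H 𝔠 in
    (∀ {n} (Γ : MTT.Ctx n) (J : MTT.Judgement n) →
       Γ MTT.⊢ J → Holds Γ ⟦ J ⟧ᴶ)
  × (∀ {n} (Γ : MTT.Ctx n) (P : MTT.Ty n) →
       (Γ MTT.⊢ P MTT.is MTT.prop) ⊎ (Γ MTT.⊢ P MTT.is MTT.propₛ) →
       Holds Γ (isSet-via-coe P))
theorem3p3 H 𝔠 = ⟦⟧ᴶ-holds , λ where
    Γ P (inj₁ d) → isSet-via-coe-holds MTT.large Γ P d
    Γ P (inj₂ d) → isSet-via-coe-holds MTT.small Γ P d
  where open Soundness H 𝔠
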